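{- Let $T$ be a tree with spread $k\ge 72$ and diameter at most $k^{3/2}/\sqrt{72}$. Then $T^3$ is stackable.
   Context: The spread of a tree is the minimum distance between two distinct leaves. $T^3=T\,\square\, T\,\square\, T$ is the Cartesian cube, where $G\,\square\, H$ has vertex set $V(G)\times V(H)$ and $(v,w)\sim(v',w')$ iff ($v=v'$ and $ww'\in E(H)$) or ($vv'\in E(G)$ and $w=w'$). Cup stacking on a finite connected graph: initially one cup on every vertex; a move takes all $r\ge1$ cups from a vertex $x$ onto a vertex $y\neq x$ that already carries at least one cup and satisfies $d(x,y)=r$ (shortest-path distance). The graph is stackable if for every vertex $t$ some sequence of moves ends with all cups on $t$. -}

module Defs where

open import Data.Nat using (ℕ; zero; suc; _+_; _*_; _^_; _≤_; _<_)
open import Data.Fin using (Fin)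
open import Data.Product using (Σ; ∃; _×_; _,_)
open import Data.List using (List; []; _∷_; length)
open import Data.List.Relation.Unary.Unique.Propositional using (Unique)
open import Data.Empty using (⊥)
open import Relation.Nullary using (¬_; Dec; yes; no)
open import Relation.Binary.PropositionalEquality using (_≡_; _≢_)
open import Data.Product.Properties using (≡-dec)
open import Data.Fin.Properties as FinP using ()

record Graph : Set₁ where
  field
    V     : Set
    _≟V_  : (x y : V) → Dec (x ≡ y)
    Adj   : V → V → Set
open Graph public

data Walk (G : Graph) : V G → V G → ℕ → Set where
  [] : ∀ {x} → Walk G x x 0
  _∷_ : ∀ {x y z n} → Adj G x y → Walk G y z n → Walk G x z (suc n)

Dist : (G : Graph) → V G → V G → ℕ → Set
Dist G x y r = Walk G x y r × (∀ m → m < r → ¬ Walk G x y m)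

Connected : Graph → Set
Connected G = ∀ x y → ∃ λ n → Walk G x y n

record SimpleGraph (n : ℕ) : Set₁ where
  field
    adj   : Fin n → Fin n → Set
    sym   : ∀ {x y} → adj x y → adj y x
    irrfl : ∀ {x} → ¬ adj x x
open SimpleGraph public

toGraph : ∀ {n} → SimpleGraph n → Graph
toGraph {n} G = record { V = Fin n ; _≟V_ = FinP._≟_ ; Adj = adj G }

data Chain {n} (G : SimpleGraph n) : List (Fin n) → Set where
  one  : ∀ {x} → Chain G (x ∷ [])
  cons : ∀ {x y vs} → adj G x y → Chain G (y ∷ vs) → Chain G (x ∷ y ∷ vs)

data Last {A : Set} : List A → A → Set where
  here  : ∀ {x} → Last (x ∷ []) x
  there : ∀ {x y xs z} → Last (y ∷ xs) z → Last (x ∷ y ∷ xs) z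

HasCycle : ∀ {n} → SimpleGraph n → Set
HasCycle {n} G = Σ (Fin n) λ v0 → Σ (List (Fin n)) λ vs → Σ (Fin n) λ vm →
  (3 ≤ length (v0 ∷ vs)) × Unique (v0 ∷ vs) × Chain G (v0 ∷ vs) ×
  Last (v0 ∷ vs) vm × adj G vm v0

IsTree : ∀ {n} → SimpleGraph n → Set
IsTree {n} G = (1 ≤ n) × Connected (toGraph G) × ¬ HasCycle G

IsLeaf : ∀ {n} → SimpleGraph n → Fin n → Set
IsLeaf {n} G x = Σ (Fin n) λ u → adj G x u × (∀ w → adj G x w → w ≡ u)

HasSpread : ∀ {n} → SimpleGraph n → ℕ → Set
HasSpread {n} G k =
  (Σ (Fin n) λ x → Σ (Fin n) λ y → x ≢ y × IsLeaf G x × IsLeaf G y × Dist (toGraph G) x y k)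
  × (∀ x y r → x ≢ y → IsLeaf G x → IsLeaf G y → Dist (toGraph G) x y r → k ≤ r)

-- (the diameter bound d ≤ k^{3/2}/√72 is stated in Statement as 72·d² ≤ k³ for all distances d)
-- Cartesian product
_□_ : Graph → Graph → Graph
G □ H = record
  { V = V G × V H
  ; _≟V_ = ≡-dec (_≟V_ G) (_≟V_ H)
  ; Adj = λ { (v , w) (v' , w') → (v ≡ v' × Adj H w w') Data.Sum.⊎ (Adj G v v' × w ≡ w') }
  }
  where import Data.Sum

Config : Graph → Set
Config G = V G → ℕ

after : (G : Graph) → Config G → V G → V G → Config G
after G c x y v with _≟V_ G v x
... | yes _ = 0
... | no _ with _≟V_ G v y
...   | yes _ = c y + c x
...   | no _ = c v

data Reaches (G : Graph) (c : Config G) : Config G → Set where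
  done : Reaches G c c
  step : ∀ {c'} x y → x ≢ y → 1 ≤ c x → 1 ≤ c y → Dist G x y (c x) →
         Reaches G (after G c x y) c' → Reaches G c c'

Stackable : Graph → Set
Stackable G = ∀ t → Σ (Config G) λ c' →
  Reaches G (λ _ → 1) c' × (∀ v → v ≢ t → c' v ≡ 0)

cube : Graph → Graph
cube G = G □ (G □ G)

{-# OPTIONS --safe #-}
-- Collecting cups on t amounts to splitting the other vertices into piles, where a pile that has been collected on
-- a vertex v may move to t as soon as its size is d(v, t). A geodesic path can be collected on any of its vertices.
--
-- Root each factor at the corresponding coordinate of t and cut off descending paths that always run to a nearest
-- leaf: of two such paths meeting at a branching the longer one has at least k/2 vertices, so the tree splits into a
-- spine through the root, whose longer arm has at least k/2 vertices, and branches of at least k/2 vertices along which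
-- the distance to the root increases. The cube becomes a union of boxes, products of three paths.
--
-- In a box take rows of w vertices along one factor; rows correspond to cells of the product of the other two factors.
-- Let σ be the distance from the first vertex of a row to t. A pile of s rows can move to t if one of them satisfies
-- σ ≤ w s < σ + w, that is s = ⌈σ/w⌉. Greedily cutting a snake through the cells leaves fewer than H cells, where
-- H ≥ ⌈σ/w⌉ for all rows. If σ ≤ w at the start of the snake, nothing is left. Otherwise the leftovers of two snakes
-- are arranged to lie around a place where ⌈σ/w⌉ changes from h to h + 1: there piles of both sizes are possible, and every
-- large number is a sum of h's and (h + 1)'s. The room this needs is about H² ≤ (3d/w)² cells for diameter d, and
-- 72 d² ≤ k³ gives (3d/w)² ≤ k/2 when w ≥ k/2.

module Submission where

open import Defs hiding (sym; here; there)
open import Data.Nat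
open import Data.Nat.Properties
open import Data.Nat.DivMod using (_/_; _%_; m≡m%n+[m/n]*n; m%n<n)
open import Data.Nat.Tactic.RingSolver using (solve; solve-∀)
open import Data.Product using (∃; ∃₂; Σ; _×_; _,_; proj₁; proj₂)
open import Data.Sum as Sum using (_⊎_; inj₁; inj₂)
open import Data.Empty using (⊥; ⊥-elim)
open import Data.Unit using (⊤; tt)
open import Data.Fin using (Fin)
import Data.Fin.Properties as Fin
open import Data.List using (List; []; _∷_; _++_; length; concat; concatMap; downFrom; filter; allFin)
open import Data.List.Properties using (length-++; concatMap-++)
import Data.List.Properties as Listₚ
import Data.List.Base as L
open import Data.List.Membership.Propositional using (_∈_; _∉_; lose)
open import Data.List.Membership.Propositional.Properties using (∈-++⁺ˡ; ∈-++⁺ʳ; ∈-++⁻; ∈-filter⁺; ∈-filter⁻; ∈-allFin; ∈-concatMap⁺)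
open import Data.List.Relation.Unary.Any using (here; there; any?)
open import Data.List.Relation.Unary.All as All using (All; []; _∷_)
import Data.List.Relation.Unary.All.Properties as Allₚ
open import Data.List.Relation.Unary.AllPairs using ([]; _∷_)
open import Data.List.Relation.Unary.Unique.Propositional using (Unique)
import Data.List.Relation.Unary.Unique.Propositional.Properties as Uniqueₚ
open import Data.List.Relation.Binary.Permutation.Propositional using (_↭_; ↭-refl; ↭-sym; ↭-trans; ↭-reflexive; prep; ↭⇒↭ₛ; module PermutationReasoning)
open import Data.List.Relation.Binary.Permutation.Propositional.Properties using (∈-resp-↭; ↭-length; ++⁺ˡ; ++⁺ʳ; ++⁺; ++-comm; shifts; shift; ++-commutativeMonoid)
import Data.List.Relation.Binary.Permutation.Setoid.Properties as SetoidPerm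
import Algebra.Solver.CommutativeMonoid as CMSolver
open import Function using (id)
open import Relation.Nullary using (¬_; Dec; yes; no)
open import Relation.Nullary.Decidable using (_×-dec_; map′)
open import Relation.Binary.Definitions using (Tri; tri<; tri≈; tri>)
open import Relation.Binary.PropositionalEquality

-- To meet a change of ⌈σ/w⌉ at all, σ must run through w consecutive values on the cells, and about
-- H² cells are needed around that place. So the two factors across the rows must together offer a
-- monotone length of about w + H². If two factors are branches, rows along the shorter one leave
-- the longer branch to pay for w, and the third factor, of length at least k/2, pays for H². The
-- tight case is one branch against two spines, whose longer arms guarantee only k together. If they
-- offer 9k/8, pieces of the branch of length between k/2 and k can serve as rows. Otherwise the
-- distances on the two spines add up to less than 9k/8 instead of 2d, which lowers H enough for
-- rows between 5k/12 and 6k/7.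
--
-- Products of arms of the three spines start next to t and need no change of ⌈σ/w⌉, but they do
-- need a long arm for the rows, and a product of three shorter arms may have none. There, in the
-- factor whose shorter arm is longest, the whole spine is taken as a row, through the root and out
-- again, and each such row moves on its own.

private variable
  A B C : Set

-- Permutations of iterated concatenations

Unique-resp-↭ : {xs ys : List A} → xs ↭ ys → Unique xs → Unique ys
Unique-resp-↭ {A} p = SetoidPerm.Unique-resp-↭ (setoid A) (↭⇒↭ₛ p)

interchange-↭ : (as bs cs ds : List A) → (as ++ bs) ++ (cs ++ ds) ↭ (as ++ cs) ++ (bs ++ ds)
interchange-↭ as bs cs ds = ↭-trans (↭-reflexive (Listₚ.++-assoc as bs _))
  (↭-trans (++⁺ˡ as (shifts bs cs)) (↭-reflexive (sym (Listₚ.++-assoc as cs _))))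

concatMap-distrib : (f g : A → List B) (xs : List A) →
  concatMap (λ x → f x ++ g x) xs ↭ concatMap f xs ++ concatMap g xs
concatMap-distrib f g [] = ↭-refl
concatMap-distrib f g (x ∷ xs) =
  ↭-trans (++⁺ˡ (f x ++ g x) (concatMap-distrib f g xs)) (interchange-↭ (f x) (g x) _ _)

concatMap-cong-↭ : {f g : A → List B} → (∀ x → f x ↭ g x) → (xs : List A) → concatMap f xs ↭ concatMap g xs
concatMap-cong-↭ e [] = ↭-refl
concatMap-cong-↭ e (x ∷ xs) = ++⁺ (e x) (concatMap-cong-↭ e xs)

concatMap-[] : (ys : List A) → concatMap {B = B} (λ _ → []) ys ≡ []
concatMap-[] [] = refl
concatMap-[] (y ∷ ys) = concatMap-[] ys

concatMap-comm : (f : A → B → List C) (xs : List A) (ys : List B) →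
  concatMap (λ x → concatMap (f x) ys) xs ↭ concatMap (λ y → concatMap (λ x → f x y) xs) ys
concatMap-comm f [] ys = ↭-reflexive (sym (concatMap-[] ys))
concatMap-comm f (x ∷ xs) ys = ↭-trans (++⁺ˡ _ (concatMap-comm f xs ys))
  (↭-sym (concatMap-distrib (f x) _ ys))

concatMap⁺ : (f : A → List B) {xs ys : List A} → xs ↭ ys → concatMap f xs ↭ concatMap f ys
concatMap⁺ f _↭_.refl = ↭-refl
concatMap⁺ f (prep x p) = ++⁺ˡ (f x) (concatMap⁺ f p)
concatMap⁺ f (_↭_.swap x y p) = ↭-trans (shifts (f x) (f y)) (++⁺ˡ (f y) (++⁺ˡ (f x) (concatMap⁺ f p)))
concatMap⁺ f (_↭_.trans p q) = ↭-trans (concatMap⁺ f p) (concatMap⁺ f q)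

Unique-++⁻ : (xs : List A) {ys : List A} → Unique (xs ++ ys) →
  Unique xs × Unique ys × (∀ {z} → z ∈ xs → z ∉ ys)
Unique-++⁻ [] u = [] , u , λ ()
Unique-++⁻ (x ∷ xs) (x∉ ∷ u) with Unique-++⁻ xs u
... | ux , uy , dis = (Allₚ.++⁻ˡ xs x∉ ∷ ux) , uy ,
  λ { (here refl) z∈ → All.lookup (Allₚ.++⁻ʳ xs x∉) z∈ refl ; (there p) → dis p }

-- Collecting cups

-- Into G v xs: the cups of xs (one on each) can be brought to v. They are split into piles; the pile
-- of u ∷ us is first collected on u and then moved to v.
data Into (G : Graph) (v : V G) : List (V G) → Set where
  nil  : Into G v []
  pile : ∀ {u us xs} → Into G u us → Dist G u v (suc (length us)) → Into G v xs →
         Into G v ((u ∷ us) ++ xs)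
  perm : ∀ {xs ys} → xs ↭ ys → Into G v xs → Into G v ys

module _ {G : Graph} where

  Into-++ : ∀ {v xs ys} → Into G v xs → Into G v ys → Into G v (xs ++ ys)
  Into-++ nil j = j
  Into-++ {v} {ys = ys} (pile {u} {us} {xs} a d b) j =
    subst (Into G v) (sym (Listₚ.++-assoc (u ∷ us) xs ys)) (pile a d (Into-++ b j))
  Into-++ {ys = ys} (perm p i) j = perm (++⁺ʳ ys p) (Into-++ i j)

  Into-pile : ∀ {u us v} → Into G u us → Dist G u v (suc (length us)) → Into G v (u ∷ us)
  Into-pile {u} {us} {v} i d = subst (Into G v) (Listₚ.++-identityʳ (u ∷ us)) (pile i d nil)

  Into-concatMap : ∀ {v} (f : A → List (V G)) xs → (∀ {x} → x ∈ xs → Into G v (f x)) → Into G v (concatMap f xs)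
  Into-concatMap f [] h = nil
  Into-concatMap f (x ∷ xs) h = Into-++ (h (here refl)) (Into-concatMap f xs (λ p → h (there p)))

  Reaches-trans : ∀ {a b c} → Reaches G a b → Reaches G b c → Reaches G a c
  Reaches-trans done q = q
  Reaches-trans (step x y n p r d s) q = step x y n p r d (Reaches-trans s q)

  after-source : ∀ c x y → after G c x y x ≡ 0
  after-source c x y with _≟V_ G x x
  ... | yes _ = refl
  ... | no n = ⊥-elim (n refl)

  after-target : ∀ c x y → x ≢ y → after G c x y y ≡ c y + c x
  after-target c x y n with _≟V_ G y x
  ... | yes e = ⊥-elim (n (sym e))
  ... | no _ with _≟V_ G y y
  ...   | yes _ = refl
  ...   | no m = ⊥-elim (m refl)

  after-other : ∀ c x y v → v ≢ x → v ≢ y → after G c x y v ≡ c v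
  after-other c x y v n m with _≟V_ G v x
  ... | yes e = ⊥-elim (n e)
  ... | no _ with _≟V_ G v y
  ...   | yes e = ⊥-elim (m e)
  ...   | no _ = refl

  record Collected (v : V G) (xs : List (V G)) (c : Config G) : Set where
    field
      final   : Config G
      reaches : Reaches G c final
      at-v    : final v ≡ c v + length xs
      emptied : ∀ {x} → x ∈ xs → final x ≡ 0
      others  : ∀ {x} → x ≢ v → x ∉ xs → final x ≡ c x

  -- The configuration off `xs` is arbitrary and `v` may already hold many cups, because a pile
  -- brought in early stays on `v` while the others follow. The field `others` makes the nested
  -- collection on `u` harmless: it leaves `v` and the vertices still to be treated as they were.
  collect : ∀ {v xs} → Into G v xs → Unique (v ∷ xs) → ∀ c → (∀ {x} → x ∈ xs → c x ≡ 1) → 1 ≤ c v →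
    Collected v xs c
  collect nil _ c _ _ = record
    { final = c ; reaches = done ; at-v = sym (+-identityʳ _) ; emptied = λ () ; others = λ _ _ → refl }
  collect {v} (perm {xs} {ys} p i) u c ones v≥1
    with collect i (Unique-resp-↭ (prep v (↭-sym p)) u) c (λ x∈ → ones (∈-resp-↭ p x∈)) v≥1
  ... | r = record
    { final = final ; reaches = reaches
    ; at-v = trans at-v (cong (c v +_) (↭-length p))
    ; emptied = λ x∈ → emptied (∈-resp-↭ (↭-sym p) x∈)
    ; others = λ n x∉ → others n (λ x∈ → x∉ (∈-resp-↭ p x∈)) }
    where open Collected r
  collect {v} (pile {u} {us} {xs} i d j) (v∉ ∷ uq) c ones v≥1 = record
    { final = R₂.final
    ; reaches = Reaches-trans R₁.reaches
        (step u v u≢v (subst (1 ≤_) (sym u-size) (s≤s z≤n)) (subst (1 ≤_) (sym v-same) v≥1)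
          (subst (Dist G u v) (sym u-size) d) R₂.reaches)
    ; at-v = v-final
    ; emptied = emptied′
    ; others = others′ }
    where
    parts = Unique-++⁻ (u ∷ us) uq
    uq₁ = proj₁ parts
    uq₂ = proj₁ (proj₂ parts)
    dis = proj₂ (proj₂ parts)
    v≢ : ∀ {x} → x ∈ (u ∷ us) ++ xs → v ≢ x
    v≢ = All.lookup v∉
    u≢v : u ≢ v
    u≢v e = v≢ (here refl) (sym e)
    v∉us : v ∉ u ∷ us
    v∉us p = v≢ (∈-++⁺ˡ p) refl
    module R₁ = Collected (collect i uq₁ c (λ p → ones (there (∈-++⁺ˡ p))) (≤-reflexive (sym (ones (here refl)))))
    u-size : R₁.final u ≡ suc (length us)
    u-size = trans R₁.at-v (cong (_+ length us) (ones (here refl)))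
    v-same : R₁.final v ≡ c v
    v-same = R₁.others (λ e → u≢v (sym e)) (λ p → v∉us (there p))
    mid = after G R₁.final u v
    mid-v : mid v ≡ c v + suc (length us)
    mid-v = trans (after-target R₁.final u v u≢v) (cong₂ _+_ v-same u-size)
    mid-xs : ∀ {x} → x ∈ xs → mid x ≡ 1
    mid-xs {x} p = trans (after-other R₁.final u v x x≢u (λ e → v≢ (∈-++⁺ʳ (u ∷ us) p) (sym e)))
      (trans (R₁.others x≢u (λ q → dis (there q) p)) (ones (∈-++⁺ʳ (u ∷ us) p)))
      where
      x≢u : x ≢ u
      x≢u refl = dis (here refl) p
    module R₂ = Collected (collect j (Allₚ.++⁻ʳ (u ∷ us) v∉ ∷ uq₂) mid mid-xs
      (subst (1 ≤_) (sym mid-v) (≤-trans v≥1 (m≤m+n _ _))))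
    v-final : R₂.final v ≡ c v + length ((u ∷ us) ++ xs)
    v-final = trans R₂.at-v (trans (cong (_+ length xs) mid-v)
      (trans (+-assoc (c v) _ _) (cong (c v +_) (sym (length-++ (u ∷ us))))))
    emptied-first : ∀ {x} → x ∈ u ∷ us → mid x ≡ 0
    emptied-first (here refl) = after-source R₁.final u v
    emptied-first {x} (there p) = trans (after-other R₁.final u v x
        (λ { refl → Uniqueₚ.Unique[x∷xs]⇒x∉xs uq₁ p }) (λ { refl → v∉us (there p) })) (R₁.emptied p)
    emptied′ : ∀ {x} → x ∈ (u ∷ us) ++ xs → R₂.final x ≡ 0
    emptied′ {x} p with ∈-++⁻ (u ∷ us) p
    ... | inj₂ q = R₂.emptied q
    ... | inj₁ q = trans (R₂.others (λ { refl → v∉us q }) (dis q)) (emptied-first q)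
    others′ : ∀ {x} → x ≢ v → x ∉ (u ∷ us) ++ xs → R₂.final x ≡ c x
    others′ {x} n x∉ = trans (R₂.others n (λ p → x∉ (∈-++⁺ʳ (u ∷ us) p)))
      (trans (after-other R₁.final u v x (λ { refl → x∉ (here refl) }) n)
        (R₁.others (λ { refl → x∉ (here refl) }) (λ p → x∉ (there (∈-++⁺ˡ p)))))

  stackable-onto : ∀ t rest → Into G t rest → Unique (t ∷ rest) → (∀ v → v ∈ t ∷ rest) →
    Σ (Config G) λ c' → Reaches G (λ _ → 1) c' × (∀ v → v ≢ t → c' v ≡ 0)
  stackable-onto t rest i u all with collect i u (λ _ → 1) (λ _ → refl) ≤-refl
  ... | r = final , reaches , λ v v≢t → go v v≢t (all v)
    where
    open Collected r
    go : ∀ v → v ≢ t → v ∈ t ∷ rest → final v ≡ 0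
    go v n (here e) = ⊥-elim (n e)
    go v n (there p) = emptied p

-- Paths

seg : (ℕ → A) → ℕ → ℕ → List A
seg f i zero = []
seg f i (suc m) = f i ∷ seg f (suc i) m

length-seg : (f : ℕ → A) (i m : ℕ) → length (seg f i m) ≡ m
length-seg f i zero = refl
length-seg f i (suc m) = cong suc (length-seg f (suc i) m)

seg-++ : (f : ℕ → A) (i m n : ℕ) → seg f i (m + n) ≡ seg f i m ++ seg f (i + m) n
seg-++ f i zero n = cong (λ z → seg f z n) (sym (+-identityʳ i))
seg-++ f i (suc m) n = cong (f i ∷_) (trans (seg-++ f (suc i) m n) (cong (λ z → seg f (suc i) m ++ seg f z n) (sym (+-suc i m))))

seg-split : (f : ℕ → A) (i a m : ℕ) → seg f i (a + suc m) ↭ f (i + a) ∷ (seg f i a ++ seg f (suc (i + a)) m)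
seg-split f i a m = ↭-trans (↭-reflexive (seg-++ f i a (suc m))) (shift (f (i + a)) (seg f i a) _)

∣m+n-m∣≡n : ∀ m n → ∣ m + n - m ∣ ≡ n
∣m+n-m∣≡n m n = trans (∣-∣-comm (m + n) m) (∣m-m+n∣≡n m n)

module _ {G : Graph} where

  Dist-cong : ∀ {x x′ y y′ m m′} → x ≡ x′ → y ≡ y′ → m ≡ m′ → Dist G x y m → Dist G x′ y′ m′
  Dist-cong refl refl refl d = d

  module Path (f : ℕ → V G) (N : ℕ) (geo : ∀ {i j} → i < N → j < N → Dist G (f i) (f j) ∣ i - j ∣) where

    -- The m cups following a vertex are collected on the farthest of them, at distance exactly m.
    mutual
      seg-up : ∀ i m → i + m < N → Into G (f i) (seg f (suc i) m)
      seg-up i zero _ = nil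
      seg-up i (suc m) lt = perm
        (↭-trans (↭-reflexive (sym (cong (f (suc i + m) ∷_) (Listₚ.++-identityʳ _))))
          (↭-trans (↭-sym (seg-split f (suc i) m 0)) (↭-reflexive (cong (seg f (suc i)) (+-comm m 1)))))
        (Into-pile (seg-down (suc i) m lt′)
          (Dist-cong refl refl
            (trans (cong (λ z → ∣ z - i ∣) (sym (+-suc i m))) (trans (∣m+n-m∣≡n i (suc m)) (cong suc (sym (length-seg f (suc i) m)))))
            (geo lt′ (≤-<-trans (m≤m+n i (suc m)) lt))))
        where
        lt′ : suc i + m < N
        lt′ = subst (_< N) (+-suc i m) lt

      seg-down : ∀ i m → i + m < N → Into G (f (i + m)) (seg f i m)
      seg-down i zero _ = nil
      seg-down i (suc m) lt = Into-pile
        (seg-up i m (<-trans (+-monoʳ-< i (n<1+n m)) lt))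
        (Dist-cong refl refl (trans (∣m-m+n∣≡n i (suc m)) (cong suc (sym (length-seg f (suc i) m))))
          (geo (≤-<-trans (m≤m+n i (suc m)) lt) lt))

    seg-around : ∀ i a m → i + (a + suc m) ≤ N → Into G (f (i + a)) (seg f i a ++ seg f (suc (i + a)) m)
    seg-around i a m le = Into-++ (seg-down i a (≤-trans (s≤s (+-monoʳ-≤ i (m≤m+n a m))) le′))
      (seg-up (i + a) m (≤-trans (s≤s (≤-reflexive (+-assoc i a m))) le′))
      where
      le′ : suc (i + (a + m)) ≤ N
      le′ = subst (_≤ N) (trans (cong (i +_) (+-suc a m)) (+-suc i (a + m))) le

    -- The target `v` may lie off the path. The pile has `m` cups wherever it is collected, so only
    -- the position `a` has to be adapted to `v`.
    seg-hop : ∀ {v} i a m → a < m → i + m ≤ N → Dist G (f (i + a)) v m → Into G v (seg f i m)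
    seg-hop {v} i a m a<m le d with m≤n⇒∃[o]m+o≡n a<m
    ... | o , refl = subst (λ z → Into G v (seg f i z)) (+-suc a o)
      (perm (↭-sym (seg-split f i a o))
        (Into-pile (seg-around i a o (subst (λ z → i + z ≤ N) (sym (+-suc a o)) le))
          (Dist-cong refl refl
            (cong suc (sym (trans (length-++ (seg f i a)) (cong₂ _+_ (length-seg f i a) (length-seg f _ o))))) d)))

-- Rows of cells

Cell : Set
Cell = ℕ × ℕ

δ : Cell → Cell → ℕ
δ (j , l) (j′ , l′) = ∣ j - j′ ∣ + ∣ l - l′ ∣

δ-refl : ∀ c → δ c c ≡ 0
δ-refl (j , l) = cong₂ _+_ (∣n-n∣≡0 j) (∣n-n∣≡0 l)

-- Only along a row must the distance to `t` grow. Across the rows `σ` is an arbitrary function of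
-- the cell, since along a spine that distance first falls and then rises.
record RowSystem (G : Graph) (t : V G) : Set₁ where
  field
    w      : ℕ
    φ      : ℕ → Cell → V G
    dom    : Cell → Set
    σ      : Cell → ℕ
    φ-dist : ∀ {i j c c′} → i < w → j < w → dom c → dom c′ → Dist G (φ i c) (φ j c′) (∣ i - j ∣ + δ c c′)
    φ-t    : ∀ {i c} → i < w → dom c → Dist G (φ i c) t (σ c + i)

module Rows {G : Graph} {t : V G} (S : RowSystem G t) where
  open RowSystem S

  row : Cell → List (V G)
  row c = seg (λ i → φ i c) 0 w

  rows : List Cell → List (V G)
  rows = concatMap row

  length-rows : ∀ cs → length (rows cs) ≡ w * length cs
  length-rows [] = sym (*-zeroʳ w)
  length-rows (c ∷ cs) = trans (length-++ (row c))
    (trans (cong₂ _+_ (length-seg _ 0 w) (length-rows cs)) (sym (*-suc w (length cs))))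

  row-geo : ∀ {c} → dom c → ∀ {i j} → i < w → j < w → Dist G (φ i c) (φ j c) ∣ i - j ∣
  row-geo {c} dc {i} {j} p q =
    Dist-cong refl refl (trans (cong (∣ i - j ∣ +_) (δ-refl c)) (+-identityʳ _)) (φ-dist p q dc dc)

  -- Excludes the one position that defeats `row-into`: the target sits above the exact middle of
  -- the row, at a cross distance equal to half the row. The whole row then has no vertex far enough
  -- away, and of two consecutive parts with η and η + 1 vertices the one with η vertices would have
  -- to be collected in the middle, which it does not contain.
  OffCentre : ℕ → ℕ → Set
  OffCentre η ξ = suc (η + η) ≢ w ⊎ suc (ξ + ξ) ≢ w

  -- A row at cross distance η from the target moves as one pile if the target is within η of an end of
  -- its own row; otherwise it is cut at the target's position into two piles.
  row-into : ∀ {c c′ ξ} → ξ < w → dom c → dom c′ → 1 ≤ δ c′ c → δ c′ c ≤ w → OffCentre (δ c′ c) ξ →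
    Into G (φ ξ c) (row c′)
  row-into {c} {c′} {ξ} ξ<w dc dc′ 1≤η η≤w off with m≤n⇒∃[o]m+o≡n ξ<w
  ... | r , eq = go (η ≤? ξ) (η ≤? r)
    where
    η = δ c′ c
    open Path (λ i → φ i c′) w (row-geo dc′)
    dist-to : ∀ {a d m} → a < w → ∣ a - ξ ∣ ≡ d → d + η ≡ m → Dist G (φ a c′) (φ ξ c) m
    dist-to a<w e e′ = Dist-cong refl refl (trans (cong (_+ η) e) e′) (φ-dist a<w ξ<w dc′ dc)
    whole : ∀ a → a < w → ∣ a - ξ ∣ ≡ w ∸ η → Into G (φ ξ c) (row c′)
    whole a a<w e = seg-hop 0 a w a<w ≤-refl (dist-to a<w e (m∸n+n≡m η≤w))
    cut : ∀ a m b n → a < m → b < n → m + n ≡ w →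
      Dist G (φ a c′) (φ ξ c) m → Dist G (φ (m + b) c′) (φ ξ c) n → Into G (φ ξ c) (row c′)
    cut a m b n a<m b<n e d₁ d₂ = subst (Into G (φ ξ c)) (trans (sym (seg-++ _ 0 m n)) (cong (seg _ 0) e))
      (Into-++ (seg-hop 0 a m a<m (subst (m ≤_) e (m≤m+n m n)) d₁)
               (seg-hop m b n b<n (≤-reflexive e) d₂))
    go : Dec (η ≤ ξ) → Dec (η ≤ r) → Into G (φ ξ c) (row c′)
    go (no η≰ξ) _ = whole (ξ + (w ∸ η))
      (subst (ξ + (w ∸ η) <_) (m+[n∸m]≡n η≤w) (+-monoˡ-< (w ∸ η) (≰⇒> η≰ξ)))
      (∣m+n-m∣≡n ξ (w ∸ η))
    go (yes η≤ξ) (no η≰r) = whole (ξ ∸ (w ∸ η)) (≤-<-trans (m∸n≤m ξ (w ∸ η)) ξ<w)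
      (trans (m≤n⇒∣m-n∣≡n∸m (m∸n≤m ξ (w ∸ η))) (m∸[m∸n]≡n w∸η≤ξ))
      where
      w∸η≤ξ : w ∸ η ≤ ξ
      w∸η≤ξ = m≤n+o⇒m∸n≤o w η (subst (_≤ η + ξ) eq
        (subst (λ z → suc (ξ + r) ≤ z) (+-comm ξ η) (subst (_≤ ξ + η) (+-suc ξ r) (+-monoʳ-≤ ξ (≰⇒> η≰r)))))
    -- The parts have ξ + 1 and r vertices or ξ and r + 1 vertices, according to which part receives
    -- the vertex level with the target. A right part of r = η vertices would need that very vertex
    -- for its pile, so in this case it goes to the right; the left part then needs η < ξ.
    go (yes η≤ξ) (yes η≤r) with η <? r | η <? ξ
    ... | yes η<r | _ with m≤n⇒∃[o]m+o≡n η<r | m≤n⇒∃[o]m+o≡n 1≤η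
    ...   | s , refl | η′ , η′+ = cut η′ (suc ξ) s (suc η + s) (s≤s η′≤ξ) (s≤s (m≤n+m s η)) eq
      (dist-to (≤-<-trans η′≤ξ ξ<w) (m≤n⇒∣m-n∣≡n∸m η′≤ξ)
        (trans (cong ((ξ ∸ η′) +_) (sym η′+)) (trans (+-suc _ η′) (cong suc (m∸n+n≡m η′≤ξ)))))
      (dist-to (subst (suc ξ + s <_) eq (s≤s (+-monoʳ-< ξ (s≤s (m≤n+m s η)))))
        (trans (cong (λ z → ∣ z - ξ ∣) (sym (+-suc ξ s))) (∣m+n-m∣≡n ξ (suc s)))
        (cong suc (+-comm s η)))
      where
      η′≤ξ : η′ ≤ ξ
      η′≤ξ = ≤-trans (n≤1+n η′) (subst (_≤ ξ) (sym η′+) η≤ξ)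
    go (yes η≤ξ) (yes η≤r) | no _ | yes η<ξ = cut η ξ (suc r ∸ η) (suc r) η<ξ
      (s≤s (m≤n+o⇒m∸n≤o (suc r) η (subst (_≤ η + r) refl (+-monoˡ-≤ r 1≤η))))
      (trans (+-suc ξ r) eq)
      (dist-to (<-trans η<ξ ξ<w) (m≤n⇒∣m-n∣≡n∸m η≤ξ) (m∸n+n≡m η≤ξ))
      (dist-to (subst (ξ + (suc r ∸ η) <_) eq
          (s≤s (+-monoʳ-≤ ξ (m≤n+o⇒m∸n≤o (suc r) η (+-monoˡ-≤ r 1≤η)))))
        (∣m+n-m∣≡n ξ (suc r ∸ η)) (m∸n+n≡m (m≤n⇒m≤1+n η≤r)))
    go (yes η≤ξ) (yes η≤r) | no η≮r | no η≮ξ = ⊥-elim (bad off)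
      where
      η≡ξ : η ≡ ξ
      η≡ξ = ≤-antisym η≤ξ (≮⇒≥ η≮ξ)
      η≡r : η ≡ r
      η≡r = ≤-antisym η≤r (≮⇒≥ η≮r)
      bad : OffCentre η ξ → ⊥
      bad (inj₁ n) = n (trans (cong suc (cong₂ _+_ η≡ξ η≡r)) eq)
      bad (inj₂ n) = n (trans (cong (λ z → suc (ξ + z)) (trans (sym η≡ξ) η≡r)) eq)

  Fits : Cell → ℕ → Cell → Set
  Fits c ξ c′ = dom c′ × 1 ≤ δ c′ c × δ c′ c ≤ w × OffCentre (δ c′ c) ξ

  group-into : ∀ {c cs ξ} → dom c → ξ < w → σ c + ξ ≡ w * suc (length cs) → All (Fits c ξ) cs →
    Into G t (rows (c ∷ cs))
  group-into {c} {cs} {ξ} dc ξ<w eq fits with m≤n⇒∃[o]m+o≡n ξ<w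
  ... | r , refl = perm reorder (Into-pile (Into-++ (seg-around 0 ξ r (≤-reflexive (+-suc ξ r))) (others cs fits))
          (Dist-cong refl refl (trans eq size) (φ-t ξ<w dc)))
    where
    open Path (λ i → φ i c) w (row-geo dc)
    arms = seg (λ i → φ i c) 0 ξ ++ seg (λ i → φ i c) (suc ξ) r
    row-split : row c ↭ φ ξ c ∷ arms
    row-split = ↭-trans (↭-reflexive (cong (seg (λ i → φ i c) 0) (sym (+-suc ξ r)))) (seg-split _ 0 ξ r)
    reorder : φ ξ c ∷ (arms ++ rows cs) ↭ rows (c ∷ cs)
    reorder = ++⁺ʳ (rows cs) (↭-sym row-split)
    size : w * suc (length cs) ≡ suc (length (arms ++ rows cs))
    size = trans (sym (length-rows (c ∷ cs))) (sym (Data.List.Relation.Binary.Permutation.Propositional.Properties.↭-length reorder))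
    others : ∀ ds → All (Fits c ξ) ds → Into G (φ ξ c) (rows ds)
    others [] [] = nil
    others (d ∷ ds) ((dd , p , q , o) ∷ ps) = Into-++ (row-into ξ<w dc dd p q o) (others ds ps)

-- A certificate for inequalities: `s ≤ r` is a combination of the hypotheses, `z` is the slack, and
-- the equation that remains is one for the ring solver.
≤-cert : ∀ {a b s r} z → s ≤ r → a + r + z ≡ b + s → a ≤ b
≤-cert {a} {b} {s} {r} z s≤r e = +-cancelʳ-≤ r a b
  (≤-trans (≤-trans (m≤m+n (a + r) z) (≤-reflexive e)) (+-monoʳ-≤ b s≤r))

-- Ceilings and sums of two consecutive pile sizes

ceiling : ∀ s w → 1 ≤ s → 1 ≤ w → ∃₂ λ τ ξ → ξ < w × s + ξ ≡ w * suc τ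
-- Dividing the predecessor turns the floor into a ceiling: `suc (s / w)` is ⌈(s + 1)/w⌉.
ceiling (suc s) w@(suc w′) _ _ = s / w , w′ ∸ s % w , s≤s (m∸n≤m w′ (s % w)) , (begin
  suc s + (w′ ∸ r)           ≡⟨ cong (λ z → suc z + (w′ ∸ r)) (m≡m%n+[m/n]*n s w) ⟩
  suc (r + q * w) + (w′ ∸ r) ≡⟨ cong suc (trans (+-assoc r (q * w) _) (trans (cong (r +_) (+-comm (q * w) _)) (sym (+-assoc r _ (q * w))))) ⟩
  suc (r + (w′ ∸ r)) + q * w ≡⟨ cong (λ z → suc z + q * w) (m+[n∸m]≡n (s≤s⁻¹ (m%n<n s w))) ⟩
  suc q * w                  ≡⟨ *-comm (suc q) w ⟩
  w * suc q                  ∎)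
  where
  open ≡-Reasoning
  r = s % w
  q = s / w

-- Because (h - 1)(h + 1) < h². From h² on, rounding up to a multiple of h + 1 yields enough piles
-- that the excess can be removed by shrinking distinct piles by one.
square-large : ∀ {g h} → g < h → ¬ (h * h ≤ g * suc h)
square-large {g} g<h le with m≤n⇒∃[o]m+o≡n g<h
... | o , refl = <-irrefl refl (≤-cert {1} {0} (o * o + o + o + o * g) le (solve (g L.∷ o L.∷ L.[])))

-- N = (x + y)(h + 1) − x, where x + y = ⌈N / (h + 1)⌉.
two-sizes : ∀ h N n → h * h ≤ N → N ≤ n * suc h →
  ∃₂ λ x y → x ≤ h × y ≤ n × x * h + y * suc h ≡ N
two-sizes h N n lo hi = x , G ∸ x , m∸n≤m h s , ≤-trans (m∸n≤m G x) G≤n , total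
  where
  open ≡-Reasoning
  s = (N + h) % suc h
  G = (N + h) / suc h
  x = h ∸ s
  s≤h : s ≤ h
  s≤h = s≤s⁻¹ (m%n<n (N + h) (suc h))
  e : N + h ≡ s + G * suc h
  e = m≡m%n+[m/n]*n (N + h) (suc h)
  e′ : N + x ≡ G * suc h
  e′ = +-cancelʳ-≡ s _ _ (begin
    N + x + s     ≡⟨ +-assoc N x s ⟩
    N + (x + s)   ≡⟨ cong (N +_) (m∸n+n≡m s≤h) ⟩
    N + h         ≡⟨ e ⟩
    s + G * suc h ≡⟨ +-comm s _ ⟩
    G * suc h + s ∎)
  G≤n : G ≤ n
  G≤n = s≤s⁻¹ (*-cancelʳ-< (suc h) G (suc n) (≤-trans (s≤s (≤-trans (≤-reflexive (sym e′))
    (+-mono-≤ hi (m∸n≤m h s)))) (≤-reflexive (trans (sym (+-suc (n * suc h) h)) (+-comm (n * suc h) (suc h))))))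
  x≤G : x ≤ G
  x≤G with x ≤? G
  ... | yes p = p
  ... | no ¬p = ⊥-elim (square-large (≤-trans (≰⇒> ¬p) (m∸n≤m h s))
                  (≤-trans lo (≤-trans (m≤m+n N x) (≤-reflexive e′))))
  total : x * h + (G ∸ x) * suc h ≡ N
  total = +-cancelʳ-≡ x _ _ (begin
    x * h + (G ∸ x) * suc h + x   ≡⟨ +-assoc (x * h) _ x ⟩
    x * h + ((G ∸ x) * suc h + x) ≡⟨ cong (x * h +_) (+-comm _ x) ⟩
    x * h + (x + (G ∸ x) * suc h) ≡⟨ sym (+-assoc (x * h) x _) ⟩
    x * h + x + (G ∸ x) * suc h   ≡⟨ cong (_+ (G ∸ x) * suc h) (trans (+-comm (x * h) x) (sym (*-suc x h))) ⟩
    x * suc h + (G ∸ x) * suc h   ≡⟨ sym (*-distribʳ-+ (suc h) x (G ∸ x)) ⟩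
    (x + (G ∸ x)) * suc h         ≡⟨ cong (_* suc h) (m+[n∸m]≡n x≤G) ⟩
    G * suc h                     ≡⟨ sym e′ ⟩
    N + x                         ∎)

split-at : ∀ n (xs : List A) → n ≤ length xs → ∃₂ λ ys zs → xs ≡ ys ++ zs × length ys ≡ n
split-at zero xs _ = [] , xs , refl , refl
split-at (suc n) (x ∷ xs) (s≤s le) with split-at n xs le
... | ys , zs , e , l = x ∷ ys , zs , cong (x ∷_) e , cong suc l

δ-sym : ∀ c d → δ c d ≡ δ d c
δ-sym (j , l) (j′ , l′) = cong₂ _+_ (∣-∣-comm j j′) (∣-∣-comm l l′)

δ-triangle : ∀ a b c → δ a c ≤ δ a b + δ b c
δ-triangle (j , l) (j′ , l′) (j″ , l″) = ≤-trans
  (+-mono-≤ (∣-∣-triangle j j′ j″) (∣-∣-triangle l l′ l″))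
  (≤-reflexive (+-interchange ∣ j - j′ ∣ ∣ j′ - j″ ∣ ∣ l - l′ ∣ ∣ l′ - l″ ∣))
  where
  +-interchange : ∀ a b c d → (a + b) + (c + d) ≡ (a + c) + (b + d)
  +-interchange a b c d = solve (a L.∷ b L.∷ c L.∷ d L.∷ L.[])

δ-pos : ∀ {c d} → c ≢ d → 1 ≤ δ c d
δ-pos {j , l} {j′ , l′} n with δ (j , l) (j′ , l′) in e
... | zero = ⊥-elim (n (cong₂ _,_ (∣m-n∣≡0⇒m≡n (m+n≡0⇒m≡0 _ e)) (∣m-n∣≡0⇒m≡n (m+n≡0⇒n≡0 _ e))))
... | suc _ = s≤s z≤n

-- A snake comes with the cell from which it is entered, so that the position of its first cells is
-- controlled relative to something outside it.
data Near : Cell → List Cell → Set where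
  []  : ∀ {y} → Near y []
  _∷_ : ∀ {y c cs} → δ c y ≤ 1 → Near c cs → Near y (c ∷ cs)

Near-++⁻ˡ : ∀ {y} xs {ys} → Near y (xs ++ ys) → Near y xs
Near-++⁻ˡ [] _ = []
Near-++⁻ˡ (x ∷ xs) (p ∷ n) = p ∷ Near-++⁻ˡ xs n

near-bound : ∀ {y m c} → Near y m → c ∈ m → δ c y ≤ length m
near-bound {y} {x ∷ m} (p ∷ n) (here refl) = ≤-trans p (s≤s z≤n)
near-bound {y} {x ∷ m} {c} (p ∷ n) (there q) =
  ≤-trans (δ-triangle c x y) (≤-trans (+-mono-≤ (near-bound n q) p) (≤-reflexive (+-comm _ 1)))

-- Dividing the cells into piles

module Tiling {G : Graph} {t : V G} (S : RowSystem G t) where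
  open RowSystem S
  open Rows S

  rows-↭ : ∀ {cs ds} → cs ↭ ds → Into G t (rows cs) → Into G t (rows ds)
  rows-↭ p = perm (concatMap⁺ row p)

  rows-++ : ∀ cs {ds} → Into G t (rows cs) → Into G t (rows ds) → Into G t (rows (cs ++ ds))
  rows-++ cs {ds} i j = subst (Into G t) (sym (concatMap-++ row cs ds)) (Into-++ i j)

  module Greedy (H : ℕ) (2H≤w : H + H ≤ w) where

    Ok : Cell → Set
    Ok c = dom c × 1 ≤ σ c × σ c ≤ w * H

    -- A pile under construction, waiting for τ rows and going to be collected in the row of z.
    record Pending (m : List Cell) : Set where
      field
        z     : Cell
        ms    : List Cell
        τ ξ   : ℕ
        split : z ∷ ms ↭ m
        short : length m < τ
        ξ<w   : ξ < w
        type  : σ z + ξ ≡ w * τ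
        dz    : dom z
        τ≤H   : τ ≤ H
        fits  : All (λ c → dom c × 1 ≤ δ c z × δ c z < H) ms

    -- The unfinished pile is a prefix: a snake is consumed from its far end, so whatever is left
    -- over lies next to the place where the snake starts.
    record Tiled (cs : List Cell) : Set where
      field
        m rest  : List Cell
        parts   : cs ≡ m ++ rest
        into    : Into G t (rows rest)
        pending : m ≡ [] ⊎ Pending m

    -- Here 2δ + 1 < 2H ≤ w, so the cross distance alone excludes the exceptional position, whatever
    -- `ξ` is.
    short-fits : ∀ {z ξ c} → dom c × 1 ≤ δ c z × δ c z < H → Fits z ξ c
    short-fits {z} {ξ} {c} (dc , p , q) = dc , p , ≤-trans (<⇒≤ q) (≤-trans (m≤m+n H H) 2H≤w) ,
      inj₁ (<⇒≢ (≤-trans (s≤s (≤-trans (≤-reflexive (sym (+-suc _ _))) (+-monoʳ-≤ _ q)))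
        (≤-trans (+-monoˡ-≤ H q) 2H≤w)))

    close : ∀ {x m} rest z ms τ ξ → z ∷ ms ↭ x ∷ m → length (x ∷ m) ≤ τ → ξ < w → σ z + ξ ≡ w * τ → dom z → τ ≤ H →
      All (λ c → dom c × 1 ≤ δ c z × δ c z < H) ms → Into G t (rows rest) → Tiled ((x ∷ m) ++ rest)
    close {x} {m} rest z ms τ ξ p le ξ<w ty dz τ≤H fits i with length (x ∷ m) <? τ
    ... | yes lt = record { m = x ∷ m ; rest = rest ; parts = refl ; into = i ; pending = inj₂ (record
            { z = z ; ms = ms ; τ = τ ; ξ = ξ ; split = p ; short = lt ; ξ<w = ξ<w ; type = ty ; dz = dz ; τ≤H = τ≤H ; fits = fits }) }
    ... | no ¬lt = record { m = [] ; rest = (x ∷ m) ++ rest ; parts = refl ; pending = inj₁ refl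
            ; into = rows-++ (x ∷ m) (rows-↭ p (group-into dz ξ<w
                (trans ty (cong (w *_) (trans (≤-antisym (≮⇒≥ ¬lt) le) (sym (↭-length p))))) (All.map (short-fits {ξ = ξ}) fits))) i }

    type≤ : ∀ {s τ ξ} → s ≤ w * H → ξ < w → s + ξ ≡ w * τ → τ ≤ H
    type≤ {s} {τ} {ξ} s≤ ξ<w e = s≤s⁻¹ (*-cancelˡ-< w τ (suc H)
      (≤-trans (≤-reflexive (trans (cong suc (sym e)) (sym (+-suc s ξ))))
        (≤-trans (+-mono-≤ s≤ ξ<w) (≤-reflexive (trans (+-comm (w * H) w) (sym (*-suc w H)))))))

    -- The row that opens a pile, its farthest one along the snake, becomes the centre `z` and fixes
    -- the size ⌈σ/w⌉. A pile is a stretch of at most H consecutive cells, so every row joining it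
    -- lies at distance less than H from `z`.
    greedy : ∀ {y} cs → Near y cs → Unique cs → All Ok cs → Tiled cs
    greedy [] _ _ _ = record { m = [] ; rest = [] ; parts = refl ; into = nil ; pending = inj₁ refl }
    greedy (x ∷ cs) (_ ∷ near) (x∉ ∷ uq) ((dx , σ≥1 , σ≤) ∷ oks) with greedy cs near uq oks
    ... | record { m = .[] ; rest = rest ; parts = refl ; into = i ; pending = inj₁ refl }
      with ceiling (σ x) w σ≥1 (n≢0⇒n>0 λ { refl → <-irrefl refl (≤-trans σ≥1 σ≤) })
    ...   | τ , ξ , ξ<w , ty = close rest x [] (suc τ) ξ ↭-refl (s≤s z≤n) ξ<w ty dx (type≤ σ≤ ξ<w ty) [] i
    greedy (x ∷ cs) (_ ∷ near) (x∉ ∷ uq) ((dx , σ≥1 , σ≤) ∷ oks)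
        | record { m = m ; rest = rest ; parts = refl ; into = i ; pending = inj₂ P } =
      close rest z (x ∷ ms) τ ξ (↭-trans (_↭_.swap z x ↭-refl) (prep x split)) short ξ<w type dz τ≤H
        ((dx , δ-pos x≢z , ≤-trans (s≤s (≤-trans (≤-reflexive (δ-sym x z)) (near-bound (Near-++⁻ˡ m near) z∈m))) (≤-trans short τ≤H)) ∷ fits) i
      where
      open Pending P
      z∈m : z ∈ m
      z∈m = ∈-resp-↭ split (here refl)
      x≢z : x ≢ z
      x≢z = All.lookup x∉ (∈-++⁺ˡ z∈m)

    -- A leftover of n + 1 rows would satisfy wτ = σ z + ξ ≤ (w + n) + (w - 1) < w(n + 2). Hence τ ≤
    -- n + 1, and the pile would already have been complete.
    near-into : ∀ {y} cs → Near y cs → Unique cs → All Ok cs → 1 ≤ w →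
      (∀ m rest → cs ≡ m ++ rest → ∀ {c} → c ∈ m → σ c < w + length m) → Into G t (rows cs)
    near-into cs near uq oks 1≤w slow with greedy cs near uq oks
    ... | record { m = .[] ; parts = refl ; into = i ; pending = inj₁ refl } = i
    ... | record { m = [] ; parts = refl ; into = i ; pending = inj₂ P } = i
    ... | record { m = m@(_ ∷ ms) ; rest = rest ; parts = parts ; pending = inj₂ P } =
      ⊥-elim (<⇒≱ (Pending.short P) (s≤s⁻¹ (*-cancelˡ-< w τ (suc (length m)) bound)))
      where
      open Pending P using (τ; ξ; z; ξ<w; type; split)
      n = length ms
      bound : w * τ < w * suc (suc n)
      bound = s≤s⁻¹ (begin
        suc (suc (w * τ))       ≡⟨ cong (λ k → suc (suc k)) (sym type) ⟩
        suc (suc (σ z + ξ))     ≡⟨ cong suc (sym (+-suc (σ z) ξ)) ⟩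
        suc (σ z) + suc ξ       ≤⟨ +-mono-≤ (slow m rest parts (∈-resp-↭ split (here refl))) ξ<w ⟩
        w + suc n + w           ≡⟨ cong (_+ w) (+-suc w n) ⟩
        suc (w + n + w)         ≤⟨ s≤s (+-monoˡ-≤ w (+-monoʳ-≤ w (≤-trans (≤-reflexive (sym (*-identityˡ n))) (*-monoˡ-≤ n 1≤w)))) ⟩
        suc (w + w * n + w)     ≡⟨ cong suc (trans (cong (_+ w) (sym (*-suc w n))) (trans (+-comm _ w) (sym (*-suc w (suc n))))) ⟩
        suc (w * suc (suc n))   ∎)
        where open ≤-Reasoning

  -- The last condition keeps the collecting vertex off the middle of its row. Rows at any cross
  -- distance up to `w` may then join, not only those within H as in `short-fits`.
  Anchor : ℕ → Cell → Set
  Anchor s c = dom c × ∃ λ ξ → ξ < w × σ c + ξ ≡ w * s × suc (ξ + ξ) ≢ w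

  Close : Cell → Cell → Set
  Close a c = dom c × 1 ≤ δ c a × δ c a ≤ w

  distribute : ∀ s as rs → length rs ≡ length as * s → All (Anchor (suc s)) as →
    (∀ {a r} → a ∈ as → r ∈ rs → Close a r) → Into G t (rows (as ++ rs))
  distribute s [] [] _ _ _ = nil
  distribute s (a ∷ as) rs len ((da , ξ , ξ<w , type , off) ∷ anchors) close
    with split-at s rs (subst (s ≤_) (sym len) (m≤m+n s _))
  ... | rs₁ , rs₂ , refl , len₁ = rows-↭ reorder
    (rows-++ (a ∷ rs₁)
      (group-into {cs = rs₁} da ξ<w (trans type (cong (λ z → w * suc z) (sym len₁)))
        (All.tabulate λ p → let (d , q , r) = close (here refl) (∈-++⁺ˡ p) in d , q , r , inj₂ off))
      (distribute s as rs₂ len₂ anchors λ p q → close (there p) (∈-++⁺ʳ rs₁ q)))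
    where
    len₂ : length rs₂ ≡ length as * s
    len₂ = +-cancelˡ-≡ s _ _ (trans (cong (_+ length rs₂) (sym len₁)) (trans (sym (length-++ rs₁)) len))
    reorder : (a ∷ rs₁) ++ (as ++ rs₂) ↭ (a ∷ as) ++ (rs₁ ++ rs₂)
    reorder = prep a (shifts rs₁ as)

  -- Only `x` cells of `X₁` and `y` cells of `X₂` become centres; the others join `R` as ordinary
  -- members. The bounds on the total are those of `two-sizes`, and `X₁` suffices because
  -- `x ≤ suc h`.
  zone-into : ∀ h X₁ X₂ R → length X₁ ≡ suc h → All (Anchor (suc h)) X₁ → All (Anchor (suc (suc h))) X₂ →
    Unique (X₁ ++ X₂ ++ R) →
    (∀ {a r} → a ∈ X₁ ++ X₂ → r ∈ X₁ ++ X₂ ++ R → dom r × δ r a ≤ w) →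
    suc h * suc h ≤ length (X₁ ++ X₂ ++ R) → length (X₁ ++ X₂ ++ R) ≤ length X₂ * suc (suc h) →
    Into G t (rows (X₁ ++ X₂ ++ R))
  zone-into h X₁ X₂ R lenX₁ anch₁ anch₂ uq close lo hi
    with two-sizes (suc h) (length (X₁ ++ X₂ ++ R)) (length X₂) lo hi
  ... | x , y , x≤ , y≤ , total
    with split-at x X₁ (subst (x ≤_) (sym lenX₁) x≤) | split-at y X₂ y≤
  ...   | A₁ , B₁ , refl , lenA₁ | A₂ , B₂ , refl , lenA₂ = go
    where
    R′ = B₁ ++ B₂ ++ R
    reorder : (A₁ ++ B₁) ++ (A₂ ++ B₂) ++ R ↭ (A₁ ++ A₂) ++ R′
    reorder = ↭-trans (++⁺ˡ (A₁ ++ B₁) (↭-reflexive (Listₚ.++-assoc A₂ B₂ R)))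
      (interchange-↭ A₁ B₁ A₂ (B₂ ++ R))
    uq′ = Unique-++⁻ (A₁ ++ A₂) (Unique-resp-↭ reorder uq)
    sizes : x + y + length R′ ≡ x * suc h + y * suc (suc h)
    sizes = trans (cong (λ z → z + length R′) (sym (trans (length-++ A₁) (cong₂ _+_ lenA₁ lenA₂))))
      (trans (sym (length-++ (A₁ ++ A₂))) (trans (sym (↭-length reorder)) (sym total)))
    lenR′ : length R′ ≡ x * h + y * suc h
    lenR′ = +-cancelˡ-≡ (x + y) _ _ (trans sizes (lemma x y h))
      where
      lemma : ∀ x y h → x * suc h + y * suc (suc h) ≡ (x + y) + (x * h + y * suc h)
      lemma x y h = solve (x L.∷ y L.∷ h L.∷ L.[])
    near : ∀ {a r} → a ∈ A₁ ++ A₂ → r ∈ R′ → Close a r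
    near {a} {r} p q = let (d , le) = close (member p) (∈-resp-↭ (↭-sym reorder) (∈-++⁺ʳ (A₁ ++ A₂) q)) in
      d , δ-pos {r} {a} (λ { refl → proj₂ (proj₂ uq′) p q }) , le
      where
      member : ∀ {a} → a ∈ A₁ ++ A₂ → a ∈ (A₁ ++ B₁) ++ (A₂ ++ B₂)
      member p with ∈-++⁻ A₁ p
      ... | inj₁ q = ∈-++⁺ˡ (∈-++⁺ˡ q)
      ... | inj₂ q = ∈-++⁺ʳ (A₁ ++ B₁) (∈-++⁺ˡ q)
    go : Into G t (rows ((A₁ ++ B₁) ++ (A₂ ++ B₂) ++ R))
    go with split-at (x * h) R′ (subst (x * h ≤_) (sym lenR′) (m≤m+n _ _))
    ... | R₁ , R₂ , e , lenR₁ = rows-↭ (↭-trans (interchange-↭ A₁ R₁ A₂ R₂) (↭-trans (++⁺ˡ (A₁ ++ A₂) (↭-reflexive (sym e))) (↭-sym reorder)))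
      (rows-++ (A₁ ++ R₁)
        (distribute h A₁ R₁ (trans lenR₁ (cong (_* h) (sym lenA₁))) (Allₚ.++⁻ˡ A₁ anch₁)
          λ p q → near (∈-++⁺ˡ p) (subst (_ ∈_) (sym e) (∈-++⁺ˡ q)))
        (distribute (suc h) A₂ R₂ lenR₂ (Allₚ.++⁻ˡ A₂ anch₂)
          λ p q → near (∈-++⁺ʳ A₁ p) (subst (_ ∈_) (sym e) (∈-++⁺ʳ R₁ q))))
      where
      lenR₂ : length R₂ ≡ length A₂ * suc h
      lenR₂ = trans (+-cancelˡ-≡ (x * h) _ _ (trans (cong (_+ length R₂) (sym lenR₁))
        (trans (sym (length-++ R₁)) (trans (cong length (sym e)) lenR′)))) (cong (_* suc h) (sym lenA₂))

∈-≡ : ∀ {x : A} {xs ys} → xs ≡ ys → x ∈ xs → x ∈ ys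
∈-≡ refl p = p

∈-seg : ∀ {f : ℕ → A} {x} i m → x ∈ seg f i m → ∃ λ j → j < m × x ≡ f (i + j)
∈-seg {f = f} i (suc m) (here refl) = 0 , s≤s z≤n , cong f (sym (+-identityʳ i))
∈-seg {f = f} i (suc m) (there p) with ∈-seg (suc i) m p
... | j , lt , refl = suc j , s≤s lt , cong f (sym (+-suc i j))

Unique-seg : ∀ {f : ℕ → A} → (∀ {i j} → f i ≡ f j → i ≡ j) → ∀ i m → Unique (seg f i m)
Unique-seg inj i zero = []
Unique-seg {f = f} inj i (suc m) = All.tabulate fresh ∷ Unique-seg inj (suc i) m
  where
  fresh : ∀ {x} → x ∈ seg f (suc i) m → f i ≢ x
  fresh p e with ∈-seg (suc i) m p
  ... | j , _ , refl = m≢1+m+n i (inj e)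

-- Grids of cells and snakes through them

line : ℕ → ℕ → ℕ → List Cell
line a m l = seg (λ j → (j , l)) a m

lines : ℕ → List ℕ → List Cell
lines B = concatMap (line 0 B)

grid : ℕ → ℕ → List Cell
grid B C = lines B (seg id 0 C)

∈-lines : ∀ {c} B a C → c ∈ lines B (seg id a C) → proj₁ c < B × a ≤ proj₂ c × proj₂ c < a + C
∈-lines B a (suc C) p with ∈-++⁻ (line 0 B a) p
... | inj₁ q with ∈-seg 0 B q
...   | j , lt , refl = lt , ≤-refl , m<m+n a (s≤s z≤n)
∈-lines B a (suc C) p | inj₂ q with ∈-lines B (suc a) C q
...   | x , y , z = x , <⇒≤ y , ≤-trans z (≤-reflexive (sym (+-suc a C)))

Unique-lines : ∀ B a C → Unique (lines B (seg id a C))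
Unique-lines B a zero = []
Unique-lines B a (suc C) = Uniqueₚ.++⁺ (Unique-seg (cong proj₁) 0 B) (Unique-lines B (suc a) C) disjoint
  where
  disjoint : ∀ {c} → ¬ (c ∈ line 0 B a × c ∈ lines B (seg id (suc a) C))
  disjoint (p , q) with ∈-seg 0 B p
  ... | j , _ , refl = <-irrefl refl (proj₁ (proj₂ (∈-lines B (suc a) C q)))

downline : ℕ → ℕ → List Cell
downline zero l = []
downline (suc m) l = (m , l) ∷ downline m l

seg-∷ʳ : ∀ (f : ℕ → A) i m → seg f i (suc m) ↭ f (i + m) ∷ seg f i m
seg-∷ʳ f i m = ↭-trans (↭-reflexive (cong (seg f i) (+-comm 1 m)))
  (↭-trans (seg-split f i m 0) (prep _ (↭-reflexive (Listₚ.++-identityʳ _))))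

downline-↭ : ∀ m l → downline m l ↭ line 0 m l
downline-↭ zero l = ↭-refl
downline-↭ (suc m) l = ↭-trans (prep _ (downline-↭ m l)) (↭-sym (seg-∷ʳ _ 0 m))

downFrom-↭ : ∀ m → downFrom m ↭ seg id 0 m
downFrom-↭ zero = ↭-refl
downFrom-↭ (suc m) = ↭-trans (prep m (downFrom-↭ m)) (↭-sym (seg-∷ʳ id 0 m))

∣suc-∣ : ∀ a → ∣ suc a - a ∣ ≡ 1
∣suc-∣ zero = refl
∣suc-∣ (suc a) = ∣suc-∣ a

∣-suc∣ : ∀ a → ∣ a - suc a ∣ ≡ 1
∣-suc∣ zero = refl
∣-suc∣ (suc a) = ∣-suc∣ a

near-line : ∀ a m l {rest} → Near (a + m , l) rest → Near (a , l) (line (suc a) m l ++ rest)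
near-line a zero l {rest} n = subst (λ z → Near (z , l) rest) (+-identityʳ a) n
near-line a (suc m) l {rest} n = ≤-reflexive (cong₂ _+_ (∣suc-∣ a) (∣n-n∣≡0 l)) ∷
  near-line (suc a) m l (subst (λ z → Near (z , l) rest) (+-suc a m) n)

near-downline : ∀ m l {rest} → Near (0 , l) rest → Near (m , l) (downline m l ++ rest)
near-downline zero l n = n
near-downline (suc m) l n = ≤-reflexive (cong₂ _+_ (∣-suc∣ m) (∣n-n∣≡0 l)) ∷ near-downline m l n

data LineNear : ℕ → List ℕ → Set where
  []  : ∀ {l} → LineNear l []
  _∷_ : ∀ {l l′ ls} → ∣ l′ - l ∣ ≤ 1 → LineNear l′ ls → LineNear l (l′ ∷ ls)

lineNear-up : ∀ l m → LineNear l (seg id (suc l) m)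
lineNear-up l zero = []
lineNear-up l (suc m) = ≤-reflexive (∣suc-∣ l) ∷ lineNear-up (suc l) m

lineNear-down : ∀ l → LineNear l (downFrom l)
lineNear-down zero = []
lineNear-down (suc l) = ≤-reflexive (∣-suc∣ l) ∷ lineNear-down l

module Snake (B : ℕ) where

  mutual
    -- The lines are run through alternately upwards and downwards. The two names tell at which end
    -- a line is entered, which is the end where the previous line was left.
    fromLow : List ℕ → List Cell
    fromLow [] = []
    fromLow (l ∷ ls) = line 0 (suc B) l ++ fromHigh ls

    fromHigh : List ℕ → List Cell
    fromHigh [] = []
    fromHigh (l ∷ ls) = downline (suc B) l ++ fromLow ls

  mutual
    fromLow-↭ : ∀ ls → fromLow ls ↭ lines (suc B) ls
    fromLow-↭ [] = ↭-refl
    fromLow-↭ (l ∷ ls) = ++⁺ˡ (line 0 (suc B) l) (fromHigh-↭ ls)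

    fromHigh-↭ : ∀ ls → fromHigh ls ↭ lines (suc B) ls
    fromHigh-↭ [] = ↭-refl
    fromHigh-↭ (l ∷ ls) = ++⁺ (downline-↭ (suc B) l) (fromLow-↭ ls)

  mutual
    near-fromLow : ∀ {l ls} → LineNear l ls → Near (0 , l) (fromLow ls)
    near-fromLow [] = []
    near-fromLow (_∷_ {l′ = l′} p n) = p ∷ near-line 0 B l′ (near-fromHigh n)

    near-fromHigh : ∀ {l ls} → LineNear l ls → Near (B , l) (fromHigh ls)
    near-fromHigh [] = []
    near-fromHigh (_∷_ {l′ = l′} p n) = subst (_≤ 1) (sym (cong (_+ _) (∣n-n∣≡0 B))) p ∷ near-downline B l′ (near-fromLow n)

-- Using up the leftovers of two snakes

private module Perm = CMSolver (++-commutativeMonoid {A = Cell})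

module Flexible {G : Graph} {t : V G} (S : RowSystem G t) (H : ℕ) (2H≤w : H + H ≤ RowSystem.w S) (1≤H : 1 ≤ H)
  (B C : ℕ) where
  open RowSystem S
  open Rows S
  open Tiling S
  open Greedy H 2H≤w
  open Snake B

  module _ (ok : ∀ {j l} → j < suc B → l < C → Ok (j , l)) where

    all-ok : ∀ {xs} → xs ↭ grid (suc B) C → All Ok xs
    all-ok p = All.tabulate λ q → let (x , _ , y) = ∈-lines (suc B) 0 C (∈-resp-↭ p q) in ok x y

    leftover-short : ∀ {cs} (T : Tiled cs) → length (Tiled.m T) < H
    leftover-short record { pending = inj₁ refl } = 1≤H
    leftover-short record { pending = inj₂ P } = ≤-trans (Pending.short P) (Pending.τ≤H P)

    -- Line `l` is cut into lengths u, h + 1, n₂, n₃, ρ. In the middle part σ reaches w(h + 1) at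
    -- the last cell of `X₁`, so `X₁` provides centres for piles of h + 1 rows and `X₂` for piles of
    -- h + 2 rows. One snake starts at each end of the middle part, one towards the lower and one
    -- towards the higher lines; its leftover has fewer than H cells and stays near that end.
    -- `near-w` keeps middle part and leftovers within `w` of all centres, `large` and `small` serve
    -- `two-sizes`, and `n₂-half` and `h-half` keep the centres off the middle of their rows. As
    -- this limits `X₂` to half a row, `X₃` fills up the middle part without providing centres.
    module _ (u h n₂ n₃ ρ l λ′ : ℕ) (eB : suc B ≡ u + (suc h + (n₂ + (n₃ + ρ)))) (eC : C ≡ l + suc λ′)
      (type : ∀ i → i < suc h + (n₂ + n₃) → σ (u + i , l) + suc h ≡ w * suc h + suc i)
      (near-w : suc h + (n₂ + n₃) + H ≤ suc (suc w))
      (large : suc h * suc h ≤ suc h + (n₂ + n₃))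
      (small : suc h + (n₂ + n₃) + (H + H) ≤ suc (suc (n₂ * suc (suc h))))
      (n₂-half : n₂ + n₂ ≤ w) (h-half : suc h + suc h ≤ w) where

      private
        M = n₂ + n₃
        X₁ = line u (suc h) l
        X₂ = line (u + suc h) n₂ l
        X₃ = line (u + suc h + n₂) n₃ l
        XR = line (u + suc h + n₂ + n₃) ρ l
        OL = downline u l ++ fromLow (downFrom l)
        OR = XR ++ fromHigh (seg id (suc l) λ′)

      line-parts : line 0 (suc B) l ≡ line 0 u l ++ X₁ ++ X₂ ++ X₃ ++ XR
      line-parts = trans (cong (λ z → line 0 z l) eB) (trans (seg-++ _ 0 u _) (cong (line 0 u l ++_)
        (trans (seg-++ _ u (suc h) _) (cong (X₁ ++_) (trans (seg-++ _ _ n₂ _) (cong (X₂ ++_) (seg-++ _ _ n₃ ρ)))))))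

      grid-parts : grid (suc B) C ↭ (X₁ ++ X₂ ++ X₃) ++ OL ++ OR
      grid-parts = ↭-trans (↭-reflexive (trans (cong (λ z → grid (suc B) z) eC)
          (trans (cong (lines (suc B)) (seg-++ id 0 l (suc λ′))) (concatMap-++ (line 0 (suc B)) (seg id 0 l) _))))
        (↭-trans (++⁺ (concatMap⁺ (line 0 (suc B)) (↭-sym (downFrom-↭ l)))
            (++⁺ (↭-reflexive line-parts) ↭-refl))
          (↭-trans (Perm.solve 7 (λ d a b c e f g → (d Perm.⊕ ((a Perm.⊕ (b Perm.⊕ (c Perm.⊕ (e Perm.⊕ f)))) Perm.⊕ g)) Perm.⊜ ((b Perm.⊕ (c Perm.⊕ e)) Perm.⊕ ((a Perm.⊕ d) Perm.⊕ (f Perm.⊕ g)))) ↭-refl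
              (lines (suc B) (downFrom l)) (line 0 u l) X₁ X₂ X₃ XR (lines (suc B) (seg id (suc l) λ′)))
            (++⁺ˡ (X₁ ++ X₂ ++ X₃) (++⁺ (++⁺ (↭-sym (downline-↭ u l)) (↭-sym (fromLow-↭ (downFrom l))))
               (++⁺ˡ XR (↭-sym (fromHigh-↭ (seg id (suc l) λ′))))))))

      private
        K = h + M
        oks : All Ok ((X₁ ++ X₂ ++ X₃) ++ OL ++ OR)
        oks = all-ok (↭-sym grid-parts)
        uq : Unique ((X₁ ++ X₂ ++ X₃) ++ OL ++ OR)
        uq = Unique-resp-↭ grid-parts (Unique-lines (suc B) 0 C)
        uqO = Unique-++⁻ OL (proj₁ (proj₂ (Unique-++⁻ (X₁ ++ X₂ ++ X₃) uq)))
        okO = Allₚ.++⁻ʳ (X₁ ++ X₂ ++ X₃) oks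
        nearL : Near (u , l) OL
        nearL = near-downline u l (near-fromLow (lineNear-down l))
        right-end : ∀ u h n₂ n₃ → suc (u + (h + (n₂ + n₃))) ≡ u + suc h + n₂ + n₃
        right-end u h n₂ n₃ = solve (u L.∷ h L.∷ n₂ L.∷ n₃ L.∷ L.[])
        last-end : ∀ u h n₂ n₃ ρ → u + (suc h + (n₂ + (n₃ + ρ))) ≡ suc (u + (h + (n₂ + n₃)) + ρ)
        last-end u h n₂ n₃ ρ = solve (u L.∷ h L.∷ n₂ L.∷ n₃ L.∷ ρ L.∷ L.[])
        nearR : Near (u + K , l) OR
        nearR = subst (λ z → Near (u + K , l) (line z ρ l ++ fromHigh (seg id (suc l) λ′))) (right-end u h n₂ n₃)
          (near-line (u + K) ρ l (subst (λ z → Near (z , l) (fromHigh (seg id (suc l) λ′)))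
            (suc-injective (trans eB (last-end u h n₂ n₃ ρ))) (near-fromHigh (lineNear-up l λ′))))

      module Zone (TL : Tiled OL) (TR : Tiled OR) where
        private
          mL = Tiled.m TL
          mR = Tiled.m TR
          R = X₃ ++ mL ++ mR
          reorder : (X₁ ++ X₂ ++ R) ++ (Tiled.rest TL ++ Tiled.rest TR) ↭ (X₁ ++ X₂ ++ X₃) ++ OL ++ OR
          reorder = ↭-trans (Perm.solve 7 (λ a b c d e f g → ((a Perm.⊕ (b Perm.⊕ (c Perm.⊕ (d Perm.⊕ e)))) Perm.⊕ (f Perm.⊕ g)) Perm.⊜ ((a Perm.⊕ (b Perm.⊕ c)) Perm.⊕ ((d Perm.⊕ f) Perm.⊕ (e Perm.⊕ g)))) ↭-refl
              X₁ X₂ X₃ mL mR (Tiled.rest TL) (Tiled.rest TR))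
            (↭-reflexive (cong₂ (λ p q → (X₁ ++ X₂ ++ X₃) ++ p ++ q) (sym (Tiled.parts TL)) (sym (Tiled.parts TR))))
          uqZ : Unique (X₁ ++ X₂ ++ R)
          uqZ = proj₁ (Unique-++⁻ (X₁ ++ X₂ ++ R) (Unique-resp-↭ (↭-sym reorder) uq))
          sizeZ : length (X₁ ++ X₂ ++ R) ≡ suc h + (n₂ + (n₃ + (length mL + length mR)))
          sizeZ = trans (length-++ X₁) (cong₂ _+_ (length-seg _ u (suc h)) (trans (length-++ X₂)
            (cong₂ _+_ (length-seg _ _ n₂) (trans (length-++ X₃) (cong₂ _+_ (length-seg _ _ n₃) (length-++ mL))))))
          lo : suc h * suc h ≤ length (X₁ ++ X₂ ++ R)
          lo = ≤-trans large (≤-trans (+-monoʳ-≤ (suc h) (+-monoʳ-≤ n₂ (m≤m+n n₃ _))) (≤-reflexive (sym sizeZ)))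
          hi : length (X₁ ++ X₂ ++ R) ≤ length X₂ * suc (suc h)
          hi = subst₂ (λ p q → p ≤ q * suc (suc h)) (sym sizeZ) (sym (length-seg _ (u + suc h) n₂))
            (≤-cert 0 (+-mono-≤ (+-mono-≤ (leftover-short TL) (leftover-short TR)) small)
              (arith h n₂ n₃ (length mL) (length mR) H (n₂ * suc (suc h))))
            where
            arith : ∀ h n₂ n₃ a b H z → suc h + (n₂ + (n₃ + (a + b))) + ((H + H) + suc (suc z)) + 0 ≡
              z + ((suc a + suc b) + (suc h + (n₂ + n₃) + (H + H)))
            arith h n₂ n₃ a b H z = solve (h L.∷ n₂ L.∷ n₃ L.∷ a L.∷ b L.∷ H L.∷ z L.∷ L.[])
          mid-≡ : line u (suc h + M) l ≡ X₁ ++ X₂ ++ X₃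
          mid-≡ = trans (seg-++ _ u (suc h) M) (cong (X₁ ++_) (seg-++ _ _ n₂ n₃))
          mid-member : ∀ {c} → c ∈ X₁ ++ X₂ ++ X₃ → ∃ λ i → i ≤ K × c ≡ (u + i , l)
          mid-member p with ∈-seg u (suc h + M) (∈-≡ (sym mid-≡) p)
          ... | i , lt , e = i , s≤s⁻¹ lt , e
          mid-dist : ∀ {i j} → i ≤ K → j ≤ K → δ (u + i , l) (u + j , l) ≤ K
          mid-dist {i} {j} p q = subst (_≤ K)
            (sym (trans (cong₂ _+_ (∣m+n-m+o∣≡∣n-o∣ u i j) (∣n-n∣≡0 l)) (+-identityʳ _)))
            (≤-trans (∣m-n∣≤m⊔n i j) (⊔-lub p q))
          short-dist : ∀ {n d e} → n < H → d ≤ n → e ≤ K → d + e ≤ w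
          short-dist {n} {d} {e} p q r = s≤s⁻¹ (s≤s⁻¹ (≤-trans (≤-trans (≤-reflexive (cong (λ z → suc (suc z)) (+-comm d e)))
            (≤-trans (≤-reflexive (cong suc (sym (+-suc e d)))) (s≤s (+-mono-≤ r (≤-trans (s≤s q) p))))) near-w))
          K≤w : K ≤ w
          K≤w = short-dist {0} {0} 1≤H z≤n ≤-refl
          to-first : ∀ {c} → c ∈ X₁ ++ X₂ → c ∈ X₁ ++ X₂ ++ X₃
          to-first p = ∈-≡ (Listₚ.++-assoc X₁ X₂ X₃) (∈-++⁺ˡ p)
          from-zone : ∀ {c} → c ∈ X₁ ++ X₂ ++ R → (c ∈ X₁ ++ X₂ ++ X₃ ⊎ c ∈ mL) ⊎ c ∈ mR
          from-zone p with ∈-++⁻ ((X₁ ++ X₂ ++ X₃) ++ mL) (∈-≡ regroup p)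
            where
            regroup : X₁ ++ X₂ ++ R ≡ ((X₁ ++ X₂ ++ X₃) ++ mL) ++ mR
            regroup = sym (trans (Listₚ.++-assoc (X₁ ++ X₂ ++ X₃) mL mR)
              (trans (Listₚ.++-assoc X₁ (X₂ ++ X₃) _) (cong (X₁ ++_) (Listₚ.++-assoc X₂ X₃ _))))
          ... | inj₂ q = inj₂ q
          ... | inj₁ q = inj₁ (∈-++⁻ (X₁ ++ X₂ ++ X₃) q)
          close-to : ∀ {a r} → a ∈ X₁ ++ X₂ → r ∈ X₁ ++ X₂ ++ R → dom r × δ r a ≤ w
          close-to {a} {r} p q = proj₁ (All.lookup oks (∈-resp-↭ reorder (∈-++⁺ˡ q))) , bound (mid-member (to-first p)) (from-zone q)
            where
            bound : (∃ λ i → i ≤ K × a ≡ (u + i , l)) → (r ∈ X₁ ++ X₂ ++ X₃ ⊎ r ∈ mL) ⊎ r ∈ mR → δ r a ≤ w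
            bound (i , i≤ , refl) (inj₁ (inj₁ m)) with mid-member m
            ... | j , j≤ , refl = ≤-trans (mid-dist j≤ i≤) K≤w
            bound (i , i≤ , refl) (inj₁ (inj₂ m)) = ≤-trans (δ-triangle r (u , l) a) (short-dist (leftover-short TL)
              (near-bound (Near-++⁻ˡ mL (subst (Near _) (Tiled.parts TL) nearL)) m)
              (subst (λ z → δ (z , l) a ≤ K) (+-identityʳ u) (mid-dist z≤n i≤)))
            bound (i , i≤ , refl) (inj₂ m) = ≤-trans (δ-triangle r (u + K , l) a) (short-dist (leftover-short TR)
              (near-bound (Near-++⁻ˡ mR (subst (Near _) (Tiled.parts TR) nearR)) m) (mid-dist ≤-refl i≤))
          dom-mid : ∀ {c} → c ∈ X₁ ++ X₂ ++ X₃ → dom c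
          dom-mid p = proj₁ (All.lookup oks (∈-++⁺ˡ p))
          anchor₁ : ∀ {c} → c ∈ X₁ → Anchor (suc h) c
          anchor₁ p with ∈-seg u (suc h) p
          ... | i , s≤s i≤h , refl = dom-mid (∈-++⁺ˡ p) , h ∸ i ,
            ≤-trans (s≤s (m∸n≤m h i)) (≤-trans (m≤m+n (suc h) (suc h)) h-half) ,
            +-cancelʳ-≡ (suc i) _ _ (trans (+-assoc _ (h ∸ i) (suc i))
              (trans (cong (σ (u + i , l) +_) (trans (+-suc (h ∸ i) i) (cong suc (m∸n+n≡m i≤h))))
                (type i (≤-trans (s≤s i≤h) (m≤m+n (suc h) M))))) ,
            <⇒≢ (≤-trans (s≤s (s≤s (+-mono-≤ (m∸n≤m h i) (m∸n≤m h i)))) (≤-trans (s≤s (≤-reflexive (sym (+-suc h h)))) h-half))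
          anchor₂ : ∀ {c} → c ∈ X₂ → Anchor (suc (suc h)) c
          anchor₂ p with ∈-seg (u + suc h) n₂ p
          ... | s , s<n₂ , refl with m≤n⇒∃[o]m+o≡n (≤-trans s<n₂ (≤-trans (m≤m+n n₂ n₂) n₂-half))
          ...   | ξ , eξ = dom-mid (∈-++⁺ʳ X₁ (∈-++⁺ˡ p)) , ξ , subst (ξ <_) eξ (s≤s (m≤n+m ξ s)) ,
            trans (cong (_+ ξ) value) (trans (+-assoc (w * suc h) (suc s) ξ)
              (trans (cong (w * suc h +_) eξ) (trans (+-comm _ w) (sym (*-suc w (suc h)))))) ,
            λ e → <⇒≢ s<ξ (+-cancelʳ-≡ ξ _ _ (suc-injective (trans eξ (sym e))))
            where
            value : σ (u + suc h + s , l) ≡ w * suc h + suc s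
            value = +-cancelʳ-≡ (suc h) _ _ (trans (cong (λ z → σ (z , l) + suc h) (+-assoc u (suc h) s))
              (trans (type (suc h + s) (+-monoʳ-< (suc h) (≤-trans s<n₂ (m≤m+n n₂ n₃))))
                (trans (cong (w * suc h +_) (cong suc (+-comm (suc h) s))) (sym (+-assoc (w * suc h) (suc s) (suc h))))))
            -- From s + 1 + ξ = w and 2n₂ ≤ w; thus 2ξ + 1 exceeds w.
            s<ξ : s < ξ
            s<ξ = +-cancelˡ-≤ (suc s) _ _ (≤-trans (+-mono-≤ s<n₂ s<n₂) (≤-trans n₂-half (≤-reflexive (sym eξ))))

        zone : Into G t (rows (grid (suc B) C))
        zone = rows-↭ (↭-trans reorder (↭-sym grid-parts))
          (rows-++ (X₁ ++ X₂ ++ R)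
            (zone-into h X₁ X₂ R (length-seg _ u (suc h)) (All.tabulate anchor₁) (All.tabulate anchor₂) uqZ close-to lo hi)
            (rows-++ (Tiled.rest TL) (Tiled.into TL) (Tiled.into TR)))

      flexible : Into G t (rows (grid (suc B) C))
      flexible = Zone.zone (greedy OL nearL (proj₁ uqO) (Allₚ.++⁻ˡ OL okO))
        (greedy OR nearR (proj₁ (proj₂ uqO)) (Allₚ.++⁻ʳ OL okO))

-- Locating the change of pile size in a box

triangular : ∀ m → ∃ λ n → n + n + m ≡ m * m
triangular zero = 0 , refl
triangular (suc m) with triangular m
... | n , e = n + m , trans (lemma n m) (trans (cong (_+ (m + suc m)) e) (lemma′ m))
  where
  lemma : ∀ n m → (n + m) + (n + m) + suc m ≡ (n + n + m) + (m + suc m)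
  lemma n m = solve (n L.∷ m L.∷ L.[])
  lemma′ : ∀ m → m * m + (m + suc m) ≡ suc m * suc m
  lemma′ m = solve (m L.∷ L.[])

-- The two bounds on `i` reserve room in the line of the chosen cell, before it and after it. The
-- cell is taken in the first line as long as the diagonal meets that line early enough.
on-diagonal : ∀ s m b c → m ≤ s → s < m + b + c → 1 ≤ c →
  ∃₂ λ i j → i + j ≡ s × m ≤ i × i ≤ m + b × j < c
on-diagonal s m b c m≤s s< 1≤c with s ≤? m + b
... | yes p = s , 0 , +-identityʳ s , m≤s , p , 1≤c
... | no ¬p with m≤n⇒∃[o]m+o≡n (<⇒≤ (≰⇒> ¬p))
...   | j , refl = m + b , j , refl , m≤m+n m b , ≤-refl , +-cancelˡ-< (m + b) j c s<

module _ {G : Graph} {t : V G} (S : RowSystem G t) where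
  open RowSystem S
  open Rows S
  open Tiling S

  module FlexibleBox (m : ℕ) (wide : m * m + 3 * m + 6 ≤ w) where

    H = suc (suc m)

    2H≤w : H + H ≤ w
    2H≤w = ≤-cert (m * m + m + 2) wide (shape m w)
      where
      shape : ∀ m w → suc (suc m) + suc (suc m) + w + (m * m + m + 2) ≡ w + (m * m + 3 * m + 6)
      shape m w = solve (m L.∷ w L.∷ L.[])

    open Greedy H 2H≤w

    -- The piles of suc h and suc (suc h) rows are used around a cell (i , j) of the main block with
    -- σ = w * suc h.
    flexible-box : ∀ B C αq b αr c s₀ → suc B ≡ αq + b → C ≡ αr + c →
      (∀ {j l} → j < suc B → l < C → Ok (j , l)) →
      (∀ {i j} → i < b → j < c → σ (αq + i , αr + j) ≡ s₀ + (i + j)) →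
      w + (m * m + 2 * m + 5) ≤ b + c → m * m + 2 * m + 4 ≤ b → 1 ≤ c →
      Into G t (rows (grid (suc B) C))
    flexible-box B C αq b αr c s₀ eB refl ok main room room-b 1≤c
      -- The boundary w(h + 1) is the least multiple of w not below s₀ + m + 1, so its cells have i
      -- + j = m + ξ + 1. The extra m allows for the h ≤ m cells that precede the boundary cell in
      -- its line. As ξ < w, the hypothesis `room` ensures that the diagonal meets the main block.
      with triangular m | m≤n⇒∃[o]m+o≡n room-b | ceiling (suc (s₀ + m)) w (s≤s z≤n) (≤-trans (s≤s z≤n) (≤-trans (m≤n+m 6 _) wide))
    ... | n₃ , e₃ | b′ , refl | h , ξ , ξ<w , eξ
      with on-diagonal (suc (m + ξ)) m b′ c (≤-trans (m≤m+n m ξ) (n≤1+n _))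
        (≤-cert 0 (+-mono-≤ ξ<w room) (diag m ξ w b′ c)) 1≤c
      where
      diag : ∀ m ξ w b′ c → suc (suc (m + ξ)) + (w + (m * m + 2 * m + 4 + b′ + c)) + 0 ≡
        m + b′ + c + (suc ξ + (w + (m * m + 2 * m + 5)))
      diag m ξ w b′ c = solve (m L.∷ ξ L.∷ w L.∷ b′ L.∷ c L.∷ L.[])
    ... | i , j , i+j , m≤i , i≤ , j<c
      with m≤n⇒∃[o]m+o≡n i≤ | m≤n⇒∃[o]m+o≡n j<c | boundary-type
      where
      X≡ : s₀ + (suc i + j) ≡ suc (w * suc h)
      X≡ = trans (trans (cong (λ z → s₀ + suc z) i+j) (+-suc s₀ _)) (cong suc (trans (shape s₀ m ξ) eξ))
        where
        shape : ∀ s₀ m ξ → s₀ + suc (m + ξ) ≡ suc (s₀ + m) + ξ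
        shape s₀ m ξ = solve (s₀ L.∷ m L.∷ ξ L.∷ L.[])
      suc-i<b : suc i < m * m + 2 * m + 4 + b′
      suc-i<b = ≤-cert (m * m + m + 2) i≤ (shape i m b′)
        where
        shape : ∀ i m b′ → suc (suc i) + (m + b′) + (m * m + m + 2) ≡ m * m + 2 * m + 4 + b′ + i
        shape i m b′ = solve (i L.∷ m L.∷ b′ L.∷ L.[])
      -- The next cell of the line has σ = w(h + 1) + 1, still at most w(m + 2).
      boundary-type : h ≤ m
      boundary-type = s≤s⁻¹ (s≤s⁻¹ (*-cancelˡ-< w (suc h) H (≤-trans (≤-reflexive (trans (sym X≡) (sym (main suc-i<b j<c))))
        (proj₂ (proj₂ (ok (subst (αq + suc i <_) (sym eB) (+-monoʳ-< αq suc-i<b)) (+-monoʳ-< αr j<c)))))))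
    ... | ρ , eρ | λ′ , refl | h≤m with m≤n⇒∃[o]m+o≡n (≤-trans h≤m m≤i)
    ...   | i₀ , refl = Flexible.flexible S H 2H≤w (s≤s z≤n) B C ok (αq + i₀) h n₂ n₃ ρ (αr + j) λ′
        (trans eB (trans (cong (αq +_) eb) (sym (+-assoc αq i₀ _))))
        (trans (cong (αr +_) (sym (+-suc j λ′))) (sym (+-assoc αr j (suc λ′)))) type
        (≤-cert 2 (+-mono-≤ (+-mono-≤ h≤m wide) (≤-reflexive e₃)) (near-w h n₃ m w))
        (≤-cert 3 (+-mono-≤ (+-mono-≤ (*-mono-≤ h≤m h≤m) h≤m) (≤-reflexive (sym e₃))) (large h n₃ m))
        (≤-cert (n₃ * h + 2 * m * h + 2 * h) (z≤n {0}) (small h n₃ m))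
        (≤-cert 0 (+-mono-≤ (≤-reflexive e₃) wide) (half n₃ m w))
        (≤-cert (m * m + m + 4) (+-mono-≤ (+-mono-≤ h≤m h≤m) wide) (half′ h m w))
      where
      -- With 2n₃ = m² - m this gives 2n₂ = m² + 3m + 6, the bound `wide`, and h + 1 + n₂ + n₃ ≤ m²
      -- + 2m + 4, the bound `room-b`. The summand 2m + 3 is the least that absorbs both leftovers:
      -- `small` becomes an equality for h = 0.
      n₂ = n₃ + (m + m + 3)
      eb : m * m + 2 * m + 4 + b′ ≡ i₀ + (suc h + (n₂ + (n₃ + ρ)))
      eb = trans (cong (λ z → z + 2 * m + 4 + b′) (sym e₃)) (trans (shape₁ n₃ m b′)
        (trans (cong (λ z → n₃ + n₃ + (m + m) + 4 + z) (sym eρ)) (shape₂ n₃ m h i₀ ρ)))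
        where
        shape₁ : ∀ n₃ m b′ → n₃ + n₃ + m + 2 * m + 4 + b′ ≡ n₃ + n₃ + (m + m) + 4 + (m + b′)
        shape₁ n₃ m b′ = solve (n₃ L.∷ m L.∷ b′ L.∷ L.[])
        shape₂ : ∀ n₃ m h i₀ ρ → n₃ + n₃ + (m + m) + 4 + (h + i₀ + ρ) ≡ i₀ + (suc h + (n₃ + (m + m + 3) + (n₃ + ρ)))
        shape₂ n₃ m h i₀ ρ = solve (n₃ L.∷ m L.∷ h L.∷ i₀ L.∷ ρ L.∷ L.[])
      near-w : ∀ h n₃ m w → suc h + (n₃ + (m + m + 3) + n₃) + suc (suc m) + (m + w + m * m) + 2 ≡
        suc (suc w) + (h + (m * m + 3 * m + 6) + (n₃ + n₃ + m))
      near-w h n₃ m w = solve (h L.∷ n₃ L.∷ m L.∷ w L.∷ L.[])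
      large : ∀ h n₃ m → suc h * suc h + (m * m + m + (n₃ + n₃ + m)) + 3 ≡
        suc h + (n₃ + (m + m + 3) + n₃) + (h * h + h + m * m)
      large h n₃ m = solve (h L.∷ n₃ L.∷ m L.∷ L.[])
      small : ∀ h n₃ m → suc h + (n₃ + (m + m + 3) + n₃) + (suc (suc m) + suc (suc m)) + 0 + (n₃ * h + 2 * m * h + 2 * h) ≡
        suc (suc ((n₃ + (m + m + 3)) * suc (suc h))) + 0
      small h n₃ m = solve (h L.∷ n₃ L.∷ m L.∷ L.[])
      half : ∀ n₃ m w → n₃ + (m + m + 3) + (n₃ + (m + m + 3)) + (m * m + w) + 0 ≡ w + (n₃ + n₃ + m + (m * m + 3 * m + 6))
      half n₃ m w = solve (n₃ L.∷ m L.∷ w L.∷ L.[])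
      half′ : ∀ h m w → suc h + suc h + (m + m + w) + (m * m + m + 4) ≡ w + (h + h + (m * m + 3 * m + 6))
      half′ h m w = solve (h L.∷ m L.∷ w L.∷ L.[])
      type : ∀ i′ → i′ < suc h + (n₂ + n₃) → σ (αq + i₀ + i′ , αr + j) + suc h ≡ w * suc h + suc i′
      type i′ lt = begin
        σ (αq + i₀ + i′ , αr + j) + suc h     ≡⟨ cong (λ z → σ (z , αr + j) + suc h) (+-assoc αq i₀ i′) ⟩
        σ (αq + (i₀ + i′) , αr + j) + suc h   ≡⟨ cong (_+ suc h) (main in-b j<c) ⟩
        s₀ + (i₀ + i′ + j) + suc h            ≡⟨ shape₁ s₀ i₀ i′ j h ⟩
        s₀ + (h + i₀ + j) + suc i′            ≡⟨ cong (λ z → s₀ + z + suc i′) i+j ⟩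
        s₀ + suc (m + ξ) + suc i′             ≡⟨ cong (_+ suc i′) (shape₂ s₀ m ξ) ⟩
        suc (s₀ + m) + ξ + suc i′             ≡⟨ cong (_+ suc i′) eξ ⟩
        w * suc h + suc i′                    ∎
        where
        open ≡-Reasoning
        in-b : i₀ + i′ < m * m + 2 * m + 4 + b′
        in-b = subst (i₀ + i′ <_) (sym eb) (+-monoʳ-< i₀ (≤-trans lt (+-monoʳ-≤ (suc h) (+-monoʳ-≤ n₂ (m≤m+n n₃ ρ)))))
        shape₁ : ∀ s₀ i₀ i′ j h → s₀ + (i₀ + i′ + j) + suc h ≡ s₀ + (h + i₀ + j) + suc i′
        shape₁ s₀ i₀ i′ j h = solve (s₀ L.∷ i₀ L.∷ i′ L.∷ j L.∷ h L.∷ L.[])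
        shape₂ : ∀ s₀ m ξ → s₀ + suc (m + ξ) ≡ suc (s₀ + m) + ξ
        shape₂ s₀ m ξ = solve (s₀ L.∷ m L.∷ ξ L.∷ L.[])

  module NearBox (H : ℕ) (2H≤w : H + H ≤ w) where

    open Greedy H 2H≤w

    -- The snake starts at the cell with the least σ, and n steps raise σ by at most n, which is the
    -- slow growth that `near-into` asks for.
    near-grid : ∀ B C s₀ → 1 ≤ s₀ → s₀ ≤ w →
      (∀ {j l} → j < B → l < C → dom (j , l) × σ (j , l) ≡ s₀ + (j + l) × σ (j , l) ≤ w * H) →
      Into G t (rows (grid B C))
    near-grid zero C s₀ _ _ _ = subst (λ z → Into G t (rows z)) (sym (concatMap-[] (seg id 0 C))) nil
    near-grid (suc B) zero s₀ _ _ _ = nil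
    near-grid (suc B) (suc C) s₀ 1≤s₀ s₀≤w ok = rows-↭ (fromLow-↭ ls)
      (near-into {0 , 0} (fromLow ls) (z≤n ∷ near) (Unique-resp-↭ (↭-sym (fromLow-↭ ls)) (Unique-lines (suc B) 0 (suc C)))
        (All.tabulate λ p → let (d , e , le) = at p in d , ≤-trans 1≤s₀ (≤-trans (m≤m+n s₀ _) (≤-reflexive (sym e))) , le)
        (≤-trans 1≤s₀ s₀≤w) slow)
      where
      open Snake B
      ls = seg id 0 (suc C)
      tail = line 1 B 0 ++ fromHigh (seg id 1 C)
      near : Near (0 , 0) tail
      near = near-line 0 B 0 (near-fromHigh (lineNear-up 0 C))
      at : ∀ {c} → c ∈ fromLow ls → dom c × σ c ≡ s₀ + (proj₁ c + proj₂ c) × σ c ≤ w * H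
      at p = let (x , _ , y) = ∈-lines (suc B) 0 (suc C) (∈-resp-↭ (fromLow-↭ ls) p) in ok x y
      slow : ∀ m rest → fromLow ls ≡ m ++ rest → ∀ {c} → c ∈ m → σ c < w + length m
      slow (x ∷ m) rest e {c} c∈ with Listₚ.∷-injective e
      slow (x ∷ m) rest e {c} (here refl) | refl , _ = ≤-<-trans
        (≤-trans (≤-reflexive (trans (proj₁ (proj₂ (at {0 , 0} (here refl)))) (+-identityʳ s₀))) s₀≤w) (m<m+n w (s≤s z≤n))
      slow (x ∷ m) rest e {c} (there p) | refl , e′ = subst₂ _<_ (sym (proj₁ (proj₂ (at (∈-≡ (sym e) (there (∈-++⁺ˡ p))))))) (sym (+-suc w (length m)))
        (s≤s (+-mono-≤ s₀≤w (≤-trans (≤-reflexive (sym (cong₂ _+_ (∣-∣-identityʳ (proj₁ c)) (∣-∣-identityʳ (proj₂ c)))))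
          (near-bound (Near-++⁻ˡ m (subst (Near (0 , 0)) e′ near)) p))))

    -- The row of `(0 , 0)` begins at the target and is set aside. The other cells form a snake
    -- entered from `(0 , 0)`, on which σ is the distance to that cell.
    near-grid₀ : ∀ B C → 1 ≤ w →
      (∀ {j l} → j < suc B → l < suc C → dom (j , l) × σ (j , l) ≡ j + l × σ (j , l) ≤ w * H) →
      ∃ λ rest → grid (suc B) (suc C) ↭ (0 , 0) ∷ rest × Into G t (rows rest)
    near-grid₀ B C 1≤w ok = tail , ↭-sym (fromLow-↭ ls) , near-into tail near (tl uq)
        (All.tabulate λ p → let (d , e , le) = at p in
          d , ≤-trans (≤-trans (δ-pos (≢-sym (All.lookup (hd uq) p))) (near-size p)) (≤-reflexive (sym e)) , le)
        1≤w slow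
      where
      open Snake B
      ls = seg id 0 (suc C)
      tail = line 1 B 0 ++ fromHigh (seg id 1 C)
      near : Near (0 , 0) tail
      near = near-line 0 B 0 (near-fromHigh (lineNear-up 0 C))
      uq : Unique ((0 , 0) ∷ tail)
      uq = Unique-resp-↭ (↭-sym (fromLow-↭ ls)) (Unique-lines (suc B) 0 (suc C))
      hd : ∀ {x : Cell} {xs} → Unique (x ∷ xs) → All (x ≢_) xs
      hd (p ∷ _) = p
      tl : ∀ {x : Cell} {xs} → Unique (x ∷ xs) → Unique xs
      tl (_ ∷ u) = u
      at : ∀ {c} → c ∈ tail → dom c × σ c ≡ proj₁ c + proj₂ c × σ c ≤ w * H
      at p = let (x , _ , y) = ∈-lines (suc B) 0 (suc C) (∈-resp-↭ (fromLow-↭ ls) (there p)) in ok x y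
      size : ∀ c → δ c (0 , 0) ≡ proj₁ c + proj₂ c
      size (j , l) = cong₂ _+_ (∣-∣-identityʳ j) (∣-∣-identityʳ l)
      near-size : ∀ {c} → c ∈ tail → δ c (0 , 0) ≤ proj₁ c + proj₂ c
      near-size {c} _ = ≤-reflexive (size c)
      slow : ∀ m rest → tail ≡ m ++ rest → ∀ {c} → c ∈ m → σ c < w + length m
      slow m rest e {c} p = subst (_< w + length m) (sym (proj₁ (proj₂ (at (∈-≡ (sym e) (∈-++⁺ˡ p))))))
        (+-mono-≤ 1≤w (≤-trans (≤-reflexive (sym (size c))) (near-bound (Near-++⁻ˡ m (subst (Near (0 , 0)) e near)) p)))

-- Boxes: products of three paths

concatMap-concatMap : (f : B → List C) (g : A → List B) (xs : List A) →
  concatMap f (concatMap g xs) ≡ concatMap (λ x → concatMap f (g x)) xs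
concatMap-concatMap f g [] = refl
concatMap-concatMap f g (x ∷ xs) = trans (concatMap-++ f (g x) _) (cong (concatMap f (g x) ++_) (concatMap-concatMap f g xs))

concatMap-seg : (f : A → List B) (g : ℕ → A) (i m : ℕ) → concatMap f (seg g i m) ≡ concatMap (λ j → f (g j)) (seg id i m)
concatMap-seg f g i zero = refl
concatMap-seg f g i (suc m) = cong (f (g i) ++_) (concatMap-seg f g (suc i) m)

box : (A → A → A → B) → List A → List A → List A → List B
box ψ X Y Z = concatMap (λ x → concatMap (λ y → concatMap (λ z → ψ x y z ∷ []) Z) Y) X

box-swap₁₂ : (ψ : A → A → A → B) (X Y Z : List A) → box (λ y x z → ψ x y z) Y X Z ↭ box ψ X Y Z
box-swap₁₂ ψ X Y Z = concatMap-comm _ Y X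

box-swap₂₃ : (ψ : A → A → A → B) (X Y Z : List A) → box (λ x z y → ψ x y z) X Z Y ↭ box ψ X Y Z
box-swap₂₃ ψ X Y Z = concatMap-cong-↭ (λ x → concatMap-comm _ Z Y) X

box-++₁ : (ψ : A → A → A → B) (X X′ Y Z : List A) → box ψ X Y Z ++ box ψ X′ Y Z ↭ box ψ (X ++ X′) Y Z
box-++₁ ψ X X′ Y Z = ↭-reflexive (sym (concatMap-++ _ X X′))

box-++₂ : (ψ : A → A → A → B) (X Y Y′ Z : List A) → box ψ X Y Z ++ box ψ X Y′ Z ↭ box ψ X (Y ++ Y′) Z
box-++₂ ψ X Y Y′ Z = ↭-trans (↭-sym (concatMap-distrib _ _ X))
  (concatMap-cong-↭ (λ x → ↭-reflexive (sym (concatMap-++ _ Y Y′))) X)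

box-++₃ : (ψ : A → A → A → B) (X Y Z Z′ : List A) → box ψ X Y Z ++ box ψ X Y Z′ ↭ box ψ X Y (Z ++ Z′)
box-++₃ ψ X Y Z Z′ = ↭-trans (↭-sym (concatMap-distrib _ _ X))
  (concatMap-cong-↭ (λ x → ↭-trans (↭-sym (concatMap-distrib _ _ Y))
    (concatMap-cong-↭ (λ y → ↭-reflexive (sym (concatMap-++ _ Z Z′))) Y)) X)

record Path-from (K : Graph) (a : V K) (xs : List (V K)) (f : ℕ → ℕ) (N : ℕ) : Set where
  field
    pt   : ℕ → V K
    list : seg pt 0 N ≡ xs
    geo  : ∀ {i j} → i < N → j < N → Dist K (pt i) (pt j) ∣ i - j ∣
    to   : ∀ {i} → i < N → Dist K (pt i) a (f i)

Monotone : (K : Graph) (a : V K) (xs : List (V K)) (p N : ℕ) → Set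
Monotone K a xs p N = Path-from K a xs (p +_) N

-- Abstracts from the triples of the cube so that the factors can be permuted: every box lemma takes
-- its rows along the first factor, and the swaps below bring any factor to that place.
record Embedding (K G : Graph) (a b c : V K) (t : V G) (ψ : V K → V K → V K → V G) : Set where
  field
    dist : ∀ {x x′ y y′ z z′ m m′ m″} → Dist K x x′ m → Dist K y y′ m′ → Dist K z z′ m″ →
           Dist G (ψ x y z) (ψ x′ y′ z′) (m + (m′ + m″))
    base : ψ a b c ≡ t

module _ {K G : Graph} {t : V G} where

  embedding-swap₁₂ : ∀ {a b c ψ} → Embedding K G a b c t ψ → Embedding K G b a c t (λ y x z → ψ x y z)
  embedding-swap₁₂ E = record
    { dist = λ {_} {_} {_} {_} {_} {_} {m} {m′} {m″} p q r → Dist-cong refl refl (lemma m m′ m″) (Embedding.dist E q p r)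
    ; base = Embedding.base E }
    where
    lemma : ∀ m m′ m″ → m′ + (m + m″) ≡ m + (m′ + m″)
    lemma m m′ m″ = solve (m L.∷ m′ L.∷ m″ L.∷ L.[])

  embedding-swap₂₃ : ∀ {a b c ψ} → Embedding K G a b c t ψ → Embedding K G a c b t (λ x z y → ψ x y z)
  embedding-swap₂₃ E = record
    { dist = λ {_} {_} {_} {_} {_} {_} {m} {m′} {m″} p q r → Dist-cong refl refl (cong (m +_) (+-comm m″ m′)) (Embedding.dist E p r q)
    ; base = Embedding.base E }

  module Box {a b c : V K} {ψ : V K → V K → V K → V G} (E : Embedding K G a b c t ψ)
    {X Y Z : List (V K)} {p w B C : ℕ} {fQ fR : ℕ → ℕ}
    (P : Monotone K a X p w) (Q : Path-from K b Y fQ B) (R : Path-from K c Z fR C) where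

    private
      module P = Path-from P
      module Q = Path-from Q
      module R = Path-from R

    system : RowSystem G t
    system = record
      { w = w
      ; φ = λ { i (j , l) → ψ (P.pt i) (Q.pt j) (R.pt l) }
      ; dom = λ { (j , l) → j < B × l < C }
      ; σ = λ { (j , l) → p + (fQ j + fR l) }
      ; φ-dist = λ { i<w j<w (p , q) (p′ , q′) → Embedding.dist E (P.geo i<w j<w) (Q.geo p p′) (R.geo q q′) }
      ; φ-t = λ { {i} {j , l} i<w (q , r) → Dist-cong refl (Embedding.base E) (lemma p i (fQ j) (fR l))
                  (Embedding.dist E (P.to i<w) (Q.to q) (R.to r)) }
      }
      where
      lemma : ∀ p i x y → p + i + (x + y) ≡ p + (x + y) + i
      lemma p i x y = solve (p L.∷ i L.∷ x L.∷ y L.∷ L.[])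

    open Rows system public

    rows-box : rows (grid B C) ↭ box ψ X Y Z
    rows-box = ↭-trans (↭-reflexive (trans (concatMap-concatMap row (line 0 B) (seg id 0 C))
        (Listₚ.concatMap-cong (λ l → trans (concatMap-seg row (λ j → (j , l)) 0 B)
          (Listₚ.concatMap-cong (λ j → row-≡ _ 0 w) (seg id 0 B))) (seg id 0 C))))
      (↭-trans (concatMap-comm _ (seg id 0 C) (seg id 0 B))
      (↭-trans (concatMap-cong-↭ (λ j → concatMap-comm _ (seg id 0 C) (seg id 0 w)) (seg id 0 B))
      (↭-trans (concatMap-comm _ (seg id 0 B) (seg id 0 w)) (↭-reflexive box-seg))))
      where
      row-≡ : ∀ (f : ℕ → V G) i m → seg f i m ≡ concatMap (λ j → f j ∷ []) (seg id i m)
      row-≡ f i zero = refl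
      row-≡ f i (suc m) = cong (f i ∷_) (row-≡ f (suc i) m)
      box-seg : concatMap (λ i → concatMap (λ j → concatMap (λ l → ψ (P.pt i) (Q.pt j) (R.pt l) ∷ []) (seg id 0 C)) (seg id 0 B)) (seg id 0 w)
        ≡ box ψ X Y Z
      box-seg = sym (trans (trans (cong₂ (λ p q → box ψ p q Z) (sym P.list) (sym Q.list)) (cong (box ψ (seg P.pt 0 w) (seg Q.pt 0 B)) (sym R.list)))
        (trans (concatMap-seg (λ x → concatMap (λ y → concatMap (λ z → ψ x y z ∷ []) (seg R.pt 0 C)) (seg Q.pt 0 B)) P.pt 0 w)
          (Listₚ.concatMap-cong (λ i → trans (concatMap-seg (λ y → concatMap (λ z → ψ (P.pt i) y z ∷ []) (seg R.pt 0 C)) Q.pt 0 B)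
            (Listₚ.concatMap-cong (λ j → concatMap-seg (λ z → ψ (P.pt i) (Q.pt j) z ∷ []) R.pt 0 C) (seg id 0 B))) (seg id 0 w))))

  Dist-zero : ∀ {x y} → Dist K x y 0 → x ≡ y
  Dist-zero ([] , _) = refl

  module _ {a b c : V K} {ψ : V K → V K → V K → V G} (E : Embedding K G a b c t ψ) where

    -- The offsets `αq` and `αr` skip the arm of a spine on which the distance falls. Those cells
    -- still belong to the snakes; only the zone has to lie where the distance grows in both
    -- directions.
    box-flexible : ∀ {X Y Z p w fQ fR} αq b′ αr c′ q r m →
      Monotone K a X p w → Path-from K b Y fQ (αq + b′) → Path-from K c Z fR (αr + c′) → 1 ≤ p →
      (∀ {i} → i < b′ → fQ (αq + i) ≡ q + i) → (∀ {i} → i < c′ → fR (αr + i) ≡ r + i) →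
      (∀ {j l} → j < αq + b′ → l < αr + c′ → p + (fQ j + fR l) ≤ w * suc (suc m)) →
      m * m + 3 * m + 6 ≤ w → w + (m * m + 2 * m + 5) ≤ b′ + c′ → m * m + 2 * m + 4 ≤ b′ → 1 ≤ c′ →
      Into G t (box ψ X Y Z)
    box-flexible {p = p} {w} {fQ} {fR} αq b′ αr c′ q r m P Q R 1≤p mainQ mainR far wide room room-b 1≤c
      with αq + b′ in e | ≤-trans (≤-trans (s≤s {n = 3} z≤n) (≤-trans (m≤n+m 4 _) room-b)) (m≤n+m b′ αq)
    ... | suc B | _ = perm rows-box (FlexibleBox.flexible-box system m wide B (αr + c′) αq b′ αr c′ (p + (q + r)) (sym e) refl
        (λ j< l< → (j< , l<) , ≤-trans 1≤p (m≤m+n p _) , far j< l<)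
        (λ {i} {j} i< j< → trans (cong₂ (λ x y → p + (x + y)) (mainQ i<) (mainR j<)) (lemma p q r i j))
        room room-b 1≤c)
      where
      open Box E P Q R
      lemma : ∀ p q r i j → p + (q + i + (r + j)) ≡ p + (q + r) + (i + j)
      lemma p q r i j = solve (p L.∷ q L.∷ r L.∷ i L.∷ j L.∷ L.[])
    ... | zero | ()

    module _ {X Y Z : List (V K)} {p q r w B C : ℕ}
      (P : Monotone K a X p w) (Q : Monotone K b Y q B) (R : Monotone K c Z r C)
      (H : ℕ) (2H≤w : H + H ≤ w) (far : ∀ {j l} → j < B → l < C → p + (q + j + (r + l)) ≤ w * H) where

      open Box E P Q R

      box-near : 1 ≤ p + (q + r) → p + (q + r) ≤ w → Into G t (box ψ X Y Z)
      box-near lo hi = perm rows-box (NearBox.near-grid system H 2H≤w B C (p + (q + r)) lo hi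
        λ {j} {l} j< l< → (j< , l<) , lemma p q r j l , far j< l<)
        where
        lemma : ∀ p q r i j → p + (q + i + (r + j)) ≡ p + (q + r) + (i + j)
        lemma p q r i j = solve (p L.∷ q L.∷ r L.∷ i L.∷ j L.∷ L.[])

    box-near₀ : ∀ {X Y Z w B C} → Monotone K a X 0 (suc w) → Monotone K b Y 0 (suc B) → Monotone K c Z 0 (suc C) →
      ∀ H → H + H ≤ suc w → (∀ {j l} → j < suc B → l < suc C → j + l ≤ suc w * H) →
      ∃ λ rest → box ψ X Y Z ↭ t ∷ rest × Into G t rest
    box-near₀ {w = w} {B} {C} P Q R H 2H≤w far
      with NearBox.near-grid₀ (Box.system E P Q R) H 2H≤w B C (s≤s z≤n) (λ j< l< → (j< , l<) , refl , far j< l<)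
    ... | cells , perm-cells , into = seg f 1 w ++ rows cells ,
        ↭-trans (↭-sym rows-box) (↭-trans (concatMap⁺ row perm-cells) (↭-reflexive (cong (λ z → z ∷ seg f 1 w ++ rows cells) f0≡t))) ,
        Into-++ (subst (λ z → Into G z (seg f 1 w)) f0≡t (Path.seg-up f (suc w) (row-geo (s≤s z≤n , s≤s z≤n)) 0 w ≤-refl)) into
      where
      open Box E P Q R
      f : ℕ → V G
      f i = RowSystem.φ system i (0 , 0)
      f0≡t : f 0 ≡ t
      f0≡t = trans (cong₂ (λ x g → g x) (start P) (cong₂ (λ y z x → ψ x y z) (start Q) (start R))) (Embedding.base E)
        where
        start : ∀ {d xs N} (M : Monotone K d xs 0 (suc N)) → Path-from.pt M 0 ≡ d
        start M = Dist-zero (Path-from.to M (s≤s z≤n))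

    -- A row whose distance to the target first decreases by α and then increases by β, at cross distance e.
    valley-into : ∀ {x y e₁ e₂ Z} α β → Dist K x a e₁ → Dist K y b e₂ →
      Path-from K c Z (λ i → ∣ i - α ∣) (α + suc β) →
      1 ≤ e₁ + e₂ → e₁ + e₂ ≤ α + β → α < β → Into G t (concatMap (λ z → ψ x y z ∷ []) Z)
    valley-into {x} {y} {e₁} {e₂} {Z} α β dx dy R 1≤e e≤ α<β = subst (Into G t) row-list (go (<-cmp e α))
      where
      open Path-from R
      N = α + suc β
      e = e₁ + e₂
      g : ℕ → V G
      g i = ψ x y (pt i)
      self : ∀ {v d n} → Dist K v d n → Dist K v v 0
      self _ = [] , λ _ ()
      g-geo : ∀ {i j} → i < N → j < N → Dist G (g i) (g j) ∣ i - j ∣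
      g-geo i< j< = Embedding.dist E (self dx) (self dy) (geo i< j<)
      g-to : ∀ {i d} → i < N → ∣ i - α ∣ + e ≡ d → Dist G (g i) t d
      g-to {i} i< refl = Dist-cong refl (Embedding.base E) (trans (sym (+-assoc e₁ e₂ _)) (+-comm e _)) (Embedding.dist E dx dy (to i<))
      row-list : seg g 0 N ≡ concatMap (λ z → ψ x y z ∷ []) Z
      row-list = trans (seg-singletons 0 N) (trans (sym (concatMap-seg (λ z → ψ x y z ∷ []) pt 0 N)) (cong (concatMap (λ z → ψ x y z ∷ [])) list))
        where
        seg-singletons : ∀ i m → seg g i m ≡ concatMap (λ j → g j ∷ []) (seg id i m)
        seg-singletons i zero = refl
        seg-singletons i (suc m) = cong (g i ∷_) (seg-singletons (suc i) m)
      open Path g N g-geo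
      two : ∀ i m j n → i < m → j < n → m + n ≡ N → ∣ i - α ∣ + e ≡ m → ∣ m + j - α ∣ + e ≡ n → Into G t (seg g 0 N)
      two i m j n i<m j<n eN d₁ d₂ = subst (Into G t) (trans (sym (seg-++ g 0 m n)) (cong (seg g 0) eN))
        (Into-++ (seg-hop 0 i m i<m (subst (m ≤_) eN (m≤m+n m n)) (g-to (≤-trans i<m (subst (m ≤_) eN (m≤m+n m n))) d₁))
          (seg-hop m j n j<n (≤-reflexive eN) (g-to (subst (m + j <_) eN (+-monoʳ-< m j<n)) d₂)))
      go : Tri (e < α) (e ≡ α) (α < e) → Into G t (seg g 0 N)
      go (tri< e<α _ _) = two e α (suc β ∸ e) (suc β) e<α (s≤s (m≤n+o⇒m∸n≤o (suc β) e (+-monoˡ-≤ β 1≤e))) refl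
        (trans (cong (_+ e) (m≤n⇒∣m-n∣≡n∸m (<⇒≤ e<α))) (m∸n+n≡m (<⇒≤ e<α)))
        (trans (cong (_+ e) (∣m+n-m∣≡n α _)) (m∸n+n≡m (≤-trans (<⇒≤ e<α) (≤-trans (<⇒≤ α<β) (n≤1+n β)))))
      -- A first part of α vertices would have to be collected at the lowest point, just outside it,
      -- so the cut moves up by one. The second part then has β vertices and needs α < β.
      go (tri≈ _ e≡α _) with m≤n⇒∃[o]m+o≡n α<β | m≤n⇒∃[o]m+o≡n (subst (1 ≤_) e≡α 1≤e)
      ... | o , refl | α′ , eα = two α′ (suc α) o β (≤-trans (≤-reflexive eα) (n≤1+n α)) (s≤s (m≤n+m o α)) (sym (+-suc α β))
        (trans (cong₂ _+_ (trans (cong (λ z → ∣ α′ - z ∣) (sym eα)) (∣-suc∣ α′)) e≡α) refl)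
        (trans (cong₂ _+_ (trans (cong (λ z → ∣ z - α ∣) (sym (+-suc α o))) (∣m+n-m∣≡n α (suc o))) e≡α) (cong suc (+-comm o α)))
      go (tri> _ _ α<e) = seg-hop 0 (α + (N ∸ e)) N
        (subst (α + (N ∸ e) <_) (m+[n∸m]≡n e≤N) (+-monoˡ-< (N ∸ e) α<e)) ≤-refl
        (g-to (subst (α + (N ∸ e) <_) (m+[n∸m]≡n e≤N) (+-monoˡ-< (N ∸ e) α<e))
          (trans (cong (_+ e) (∣m+n-m∣≡n α _)) (m∸n+n≡m e≤N)))
        where
        e≤N : e ≤ N
        e≤N = ≤-trans e≤ (+-monoʳ-≤ α (n≤1+n β))

-- Arithmetic of the pile sizes

-- With E a bound for the distance from the far end of a row, 2 + m is the bound H on the pile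
-- sizes: ⌊E/w⌋, raised to 2 if it is smaller. In the raised case the inequality on `w * (2 + m)`
-- may fail, but then H is just 2.
type-bound : ∀ E w → 1 ≤ w → ∃ λ m → E < w * (3 + m) × (m ≡ 0 ⊎ w * (2 + m) ≤ E)
type-bound E w@(suc _) _ = go (E / w) upper lower
  where
  upper : E < w * suc (E / w)
  upper = ≤-trans (≤-reflexive (cong suc (m≡m%n+[m/n]*n E w)))
    (≤-trans (+-monoˡ-≤ (E / w * w) (m%n<n E w)) (≤-reflexive (*-comm (suc (E / w)) w)))
  lower : w * (E / w) ≤ E
  lower = ≤-trans (≤-reflexive (*-comm w (E / w))) (≤-trans (m≤n+m _ (E % w)) (≤-reflexive (sym (m≡m%n+[m/n]*n E w))))
  go : ∀ q → E < w * suc q → w * q ≤ E → ∃ λ m → E < w * (3 + m) × (m ≡ 0 ⊎ w * (2 + m) ≤ E)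
  go zero up lo = 0 , ≤-trans up (*-monoʳ-≤ w (s≤s z≤n)) , inj₁ refl
  go (suc zero) up lo = 0 , ≤-trans up (*-monoʳ-≤ w (s≤s (s≤s z≤n))) , inj₁ refl
  go (suc (suc m)) up lo = m , up , inj₂ lo

far-from-bound : ∀ {s w E m} → s + w ≤ suc E → E < w * (3 + m) → s ≤ w * (2 + m)
far-from-bound {s} {w} {E} {m} p q = +-cancelʳ-≤ w s _ (≤-trans p (≤-trans q (≤-reflexive (trans (*-suc w (2 + m)) (+-comm w _)))))

half-up : ∀ k → ∃ λ L → k ≤ L + L × L + L ≤ suc k
half-up zero = 0 , z≤n , z≤n
half-up (suc zero) = 1 , s≤s z≤n , ≤-refl
half-up (suc (suc k)) with half-up k
... | L , p , q = suc L , ≤-trans (s≤s (s≤s p)) (≤-reflexive (cong suc (sym (+-suc L L)))) ,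
  ≤-trans (≤-reflexive (cong suc (+-suc L L))) (s≤s (s≤s q))

half-≤ : ∀ {L N} → L + L ≤ suc (N + N) → L ≤ N
half-≤ {L} {N} p with L ≤? N
... | yes q = q
... | no ¬q = ⊥-elim (<-irrefl refl (≤-trans (s≤s (≤-reflexive (sym (+-suc N N)))) (≤-trans (+-mono-≤ (≰⇒> ¬q) (≰⇒> ¬q)) p)))

room-from-square : ∀ {X} m → (2 + m) * (2 + m) ≤ X → 5 ≤ X → m * m + 2 * m + 5 ≤ X
room-from-square zero _ q = q
room-from-square {X} (suc m) p _ = ≤-trans (≤-cert {s = 0} {r = 0} (2 * m + 1) z≤n (shape m)) p
  where
  shape : ∀ m → suc m * suc m + 2 * suc m + 5 + 0 + (2 * m + 1) ≡ (3 + m) * (3 + m) + 0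
  shape = solve-∀

-- The left side exceeds (2 + m)² only for m = 0 and m = 1, where it is 6 and 10.
wide-from-square : ∀ {X} m → (2 + m) * (2 + m) ≤ X → 10 ≤ X → m * m + 3 * m + 6 ≤ X
wide-from-square zero _ q = ≤-trans (s≤s (s≤s (s≤s (s≤s (s≤s (s≤s z≤n)))))) q
wide-from-square (suc zero) _ q = q
wide-from-square {X} (suc (suc m)) p _ = ≤-trans (≤-cert {s = 0} {r = 0} m z≤n (shape m)) p
  where
  shape : ∀ m → (2 + m) * (2 + m) + 3 * (2 + m) + 6 + 0 + m ≡ (4 + m) * (4 + m) + 0
  shape = solve-∀

room-b-from-square : ∀ {X} m → (2 + m) * (2 + m) ≤ X → m * m + 2 * m + 4 ≤ X
room-b-from-square m p = ≤-trans (≤-cert {s = 0} {r = 0} (2 * m) z≤n (shape m)) p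
  where
  shape : ∀ m → m * m + 2 * m + 4 + 0 + 2 * m ≡ (2 + m) * (2 + m) + 0
  shape = solve-∀

module Arithmetic (k D : ℕ) (72≤k : 72 ≤ k) (72DD≤kkk : 72 * (D * D) ≤ k * k * k) (k≤D : k ≤ D) where

  -- The 72 of the theorem is 8 · 3²: the 3 stands for the three coordinates, and together with 4w²
  -- ≥ k² the 8 yields 2h² ≤ k.
  types-cubed : ∀ {w h} → w * h ≤ 3 * D → 8 * ((h * h) * (w * w)) ≤ k * k * k
  types-cubed {w} {h} p = begin
    8 * ((h * h) * (w * w))   ≡⟨ shape₁ w h ⟩
    8 * ((w * h) * (w * h))   ≤⟨ *-monoʳ-≤ 8 (*-mono-≤ p p) ⟩
    8 * ((3 * D) * (3 * D))   ≡⟨ shape₂ D ⟩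
    72 * (D * D)              ≤⟨ 72DD≤kkk ⟩
    k * k * k                 ∎
    where
    open ≤-Reasoning
    shape₁ : ∀ w h → 8 * ((h * h) * (w * w)) ≡ 8 * ((w * h) * (w * h))
    shape₁ = solve-∀
    shape₂ : ∀ D → 8 * ((3 * D) * (3 * D)) ≡ 72 * (D * D)
    shape₂ = solve-∀

  2hh≤k : ∀ {w h} → 1 ≤ w → k ≤ w + w → w * h ≤ 3 * D → 2 * (h * h) ≤ k
  2hh≤k {w@(suc _)} {h} _ k≤2w p = *-cancelʳ-≤ (2 * (h * h)) k (4 * (w * w)) (begin
    2 * (h * h) * (4 * (w * w))   ≡⟨ shape₁ (h * h) (w * w) ⟩
    8 * ((h * h) * (w * w))       ≤⟨ types-cubed {w} {h} p ⟩
    k * k * k                     ≡⟨ *-assoc k k k ⟩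
    k * (k * k)                   ≤⟨ *-monoʳ-≤ k (*-mono-≤ k≤2w k≤2w) ⟩
    k * ((w + w) * (w + w))       ≡⟨ shape₂ k w ⟩
    k * (4 * (w * w))             ∎)
    where
    open ≤-Reasoning
    shape₁ : ∀ a b → 2 * a * (4 * b) ≡ 8 * (a * b)
    shape₁ = solve-∀
    shape₂ : ∀ k w → k * ((w + w) * (w + w)) ≡ k * (4 * (w * w))
    shape₂ = solve-∀

  2HH≤k : ∀ {w m} → 1 ≤ w → k ≤ w + w → m ≡ 0 ⊎ w * (2 + m) ≤ 3 * D → 2 * ((2 + m) * (2 + m)) ≤ k
  2HH≤k _ _ (inj₁ refl) = ≤-trans (m≤m+n 8 64) 72≤k
  2HH≤k {w} {m} 1≤w k≤2w (inj₂ p) = 2hh≤k {w} {2 + m} 1≤w k≤2w p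

  halve : ∀ {a w} → 2 * a ≤ k → k ≤ w + w → a ≤ w
  halve {a} {w} p q = *-cancelˡ-≤ 2 (≤-trans p (≤-trans q (≤-reflexive (cong (w +_) (sym (+-identityʳ w))))))

  36≤ : ∀ {w} → k ≤ w + w → 36 ≤ w
  36≤ = halve {36} 72≤k

  1≤ : ∀ {w} → k ≤ w + w → 1 ≤ w
  1≤ {w} p = ≤-trans (m≤m+n 1 35) (36≤ p)

  two-types : ∀ m w → k ≤ w + w → m ≡ 0 ⊎ w * (2 + m) ≤ 3 * D → (2 + m) + (2 + m) ≤ w
  two-types m w k≤2w small = ≤-trans (≤-cert {s = 0} {r = 0} (m * m + 2 * m) z≤n (shape m)) (halve (2HH≤k {w} {m} (1≤ k≤2w) k≤2w small) k≤2w)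
    where
    shape : ∀ m → (2 + m) + (2 + m) + 0 + (m * m + 2 * m) ≡ (2 + m) * (2 + m) + 0
    shape = solve-∀

  -- For k/2 ≤ w ≤ k the convex function w + k³/(8w²) is at most 9k/8.
  room₁ : ∀ {w g m} → k ≤ w + w → w ≤ k → 9 * k ≤ 8 * g → m ≡ 0 ⊎ w * (2 + m) ≤ 3 * D →
    w + (m * m + 2 * m + 5) ≤ g
  room₁ {w} {g} {m} k≤2w w≤k 9k≤8g p with m≤n⇒∃[o]m+o≡n w≤k
  ... | u , refl with m≤n⇒∃[o]m+o≡n w≤g
    where
    w≤g : w ≤ g
    w≤g = *-cancelˡ-≤ 8 (≤-trans (*-monoʳ-≤ 8 w≤k) (≤-trans (*-monoˡ-≤ k (n≤1+n 8)) 9k≤8g))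
  ... | X , refl = +-monoʳ-≤ w (room-from-square m (square p) five)
    where
    nine : 9 ≤ X
    nine = *-cancelˡ-≤ 8 (≤-cert (8 * u) (+-mono-≤ 72≤k 9k≤8g) (shape w u X))
      where
      shape : ∀ w u X → 8 * 9 + ((w + u) + 8 * (w + X)) + 8 * u ≡ 8 * X + (72 + 9 * (w + u))
      shape = solve-∀
    five : 5 ≤ X
    five = ≤-trans (m≤m+n 5 4) nine
    u≤w : u ≤ w
    u≤w = +-cancelˡ-≤ w u w k≤2w
    -- With u = k - w ≤ w the difference of the two sides is u(6w² - 3wu - u²).
    convex : 8 * (w * (w * w)) + k * k * k ≤ 9 * k * (w * w)
    convex = ≤-cert (2 * (w * (w * u))) (+-mono-≤ (*-monoʳ-≤ 3 (*-monoˡ-≤ w (*-monoˡ-≤ u u≤w))) (*-monoˡ-≤ u (*-mono-≤ u≤w u≤w))) (shape w u)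
      where
      shape : ∀ w u → 8 * (w * (w * w)) + (w + u) * (w + u) * (w + u) + (3 * (w * u * w) + w * w * u) + 2 * (w * (w * u)) ≡
        9 * (w + u) * (w * w) + (3 * (u * u * w) + u * u * u)
      shape = solve-∀
    square : m ≡ 0 ⊎ w * (2 + m) ≤ 3 * D → (2 + m) * (2 + m) ≤ X
    square (inj₁ refl) = ≤-trans (m≤m+n 4 5) nine
    square (inj₂ q) = +-cancelˡ-≤ w _ _ (*-cancelˡ-≤ 8 (≤-trans (cancel w (1≤ k≤2w) (begin
        8 * (w + hh) * (w * w)                   ≡⟨ shape w hh ⟩
        8 * (w * (w * w)) + 8 * (hh * (w * w))   ≤⟨ +-monoʳ-≤ (8 * (w * (w * w))) (types-cubed {w} {2 + m} q) ⟩
        8 * (w * (w * w)) + k * k * k            ≤⟨ convex ⟩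
        9 * k * (w * w)                          ∎)) 9k≤8g))
      where
      open ≤-Reasoning
      hh = (2 + m) * (2 + m)
      shape : ∀ w a → 8 * (w + a) * (w * w) ≡ 8 * (w * (w * w)) + 8 * (a * (w * w))
      shape = solve-∀
      cancel : ∀ {a b} w → 1 ≤ w → a * (w * w) ≤ b * (w * w) → a ≤ b
      cancel {a} {b} w@(suc _) _ = *-cancelʳ-≤ a b (w * w)

  -- W = ⌊3k/7⌋ satisfies 7W ≥ 3k - 6, and 12(3k - 6) ≥ 35k holds exactly when k ≥ 72. Pieces of
  -- length between W and 2W then lie between 5k/12 and 6k/7.
  sevenths : ∃ λ W → 7 * W ≤ 3 * k × 5 * k ≤ 12 * W × 1 ≤ W
  sevenths = go (3 * k / 7) (3 * k % 7) (m≡m%n+[m/n]*n (3 * k) 7) (m%n<n (3 * k) 7)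
    where
    shape : ∀ k W → 7 * (5 * k) + (12 * (6 + W * 7) + k) + 0 ≡ 7 * (12 * W) + (12 * (3 * k) + 72)
    shape = solve-∀
    go : ∀ W r → 3 * k ≡ r + W * 7 → r < 7 → ∃ λ W → 7 * W ≤ 3 * k × 5 * k ≤ 12 * W × 1 ≤ W
    go W r e (s≤s r≤6) = W , ≤-trans (≤-reflexive (*-comm 7 W)) (≤-trans (m≤n+m (W * 7) r) (≤-reflexive (sym e))) , 5k≤12W , 1≤W
      where
      5k≤12W : 5 * k ≤ 12 * W
      5k≤12W = *-cancelˡ-≤ 7 (≤-cert 0 (+-mono-≤ (*-monoʳ-≤ 12 (≤-trans (≤-reflexive e) (+-monoˡ-≤ (W * 7) r≤6))) 72≤k) (shape k W))
      1≤W : 1 ≤ W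
      1≤W = *-cancelˡ-< 12 0 W (≤-trans (*-mono-≤ (m≤m+n 1 4) (≤-trans (m≤m+n 1 71) 72≤k)) 5k≤12W)

  -- The case of two short spines: distances are bounded by `D + g` in place of `3 * D`, and `g` is
  -- also all the room there is across the rows.
  module Narrow {w g m : ℕ} (5k≤12w : 5 * k ≤ 12 * w) (7w<6k : 7 * w + 7 ≤ 6 * k) (k≤g : k ≤ g) (8g≤9k : 8 * g ≤ 9 * k)
    (types : m ≡ 0 ⊎ w * (2 + m) ≤ D + g) where

    private
      hh = (2 + m) * (2 + m)

    30≤w : 30 ≤ w
    30≤w = *-cancelˡ-≤ 12 (≤-trans (*-monoʳ-≤ 5 72≤k) 5k≤12w)

    cancel : ∀ {a b} → a * (w * w) ≤ b * (w * w) → a ≤ b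
    cancel {a} {b} = go w (≤-trans (m≤m+n 1 29) 30≤w)
      where
      go : ∀ w → 1 ≤ w → a * (w * w) ≤ b * (w * w) → a ≤ b
      go w@(suc _) _ = *-cancelʳ-≤ a b (w * w)

    -- As k ≤ D, the bound 8g ≤ 9k gives D + g ≤ 17D/8, and 15 · 17² = 4335 stays below 64 · 72 =
    -- 4608. So the factor 8 of `types-cubed` improves to 15.
    cubed : w * (2 + m) ≤ D + g → 15 * (hh * (w * w)) ≤ k * k * k
    cubed q = *-cancelˡ-≤ 64 (begin
      64 * (15 * (hh * (w * w)))       ≡⟨ shape₁ w (2 + m) ⟩
      15 * ((8 * (w * (2 + m))) * (8 * (w * (2 + m)))) ≤⟨ *-monoʳ-≤ 15 (*-mono-≤ 8E 8E) ⟩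
      15 * ((17 * D) * (17 * D))       ≡⟨ shape₂ D ⟩
      4335 * (D * D)                   ≤⟨ *-monoˡ-≤ (D * D) (m≤m+n 4335 273) ⟩
      4608 * (D * D)                   ≡⟨ shape₃ (D * D) ⟩
      64 * (72 * (D * D))              ≤⟨ *-monoʳ-≤ 64 72DD≤kkk ⟩
      64 * (k * k * k)                 ∎)
      where
      open ≤-Reasoning
      8E : 8 * (w * (2 + m)) ≤ 17 * D
      8E = ≤-trans (*-monoʳ-≤ 8 q) (≤-cert 0 (+-mono-≤ 8g≤9k (*-monoʳ-≤ 9 k≤D)) (shape D g k))
        where
        shape : ∀ D g k → 8 * (D + g) + (9 * k + 9 * D) + 0 ≡ 17 * D + (8 * g + 9 * k)
        shape = solve-∀
      shape₁ : ∀ w h → 64 * (15 * (h * h * (w * w))) ≡ 15 * ((8 * (w * h)) * (8 * (w * h)))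
      shape₁ = solve-∀
      shape₂ : ∀ D → 15 * ((17 * D) * (17 * D)) ≡ 4335 * (D * D)
      shape₂ = solve-∀
      shape₃ : ∀ a → 4608 * a ≡ 64 * (72 * a)
      shape₃ = solve-∀

    -- From k ≤ 12w/5 and (12/5)³ < 15. The bound on `2 * hh` follows in the same way from 2(12/5)²
    -- < 15.
    hh≤w : hh ≤ w
    hh≤w = go types
      where
      open ≤-Reasoning
      shape : ∀ a b → 1875 * a * b ≡ 125 * (15 * (a * b))
      shape = solve-∀
      shape₁ : ∀ k → 125 * (k * k * k) ≡ (5 * k) * (5 * k) * (5 * k)
      shape₁ = solve-∀
      shape₂ : ∀ w → (12 * w) * (12 * w) * (12 * w) ≡ 1728 * (w * (w * w))
      shape₂ = solve-∀
      go : m ≡ 0 ⊎ w * (2 + m) ≤ D + g → hh ≤ w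
      go (inj₁ refl) = ≤-trans (m≤m+n 4 26) 30≤w
      go (inj₂ q) = *-cancelˡ-≤ 1875 (cancel (begin
        1875 * hh * (w * w)                ≡⟨ shape hh (w * w) ⟩
        125 * (15 * (hh * (w * w)))        ≤⟨ *-monoʳ-≤ 125 (cubed q) ⟩
        125 * (k * k * k)                  ≡⟨ shape₁ k ⟩
        (5 * k) * (5 * k) * (5 * k)        ≤⟨ *-mono-≤ (*-mono-≤ 5k≤12w 5k≤12w) 5k≤12w ⟩
        (12 * w) * (12 * w) * (12 * w)     ≡⟨ shape₂ w ⟩
        1728 * (w * (w * w))               ≤⟨ *-monoˡ-≤ (w * (w * w)) (m≤m+n 1728 147) ⟩
        1875 * (w * (w * w))               ≡⟨ sym (*-assoc 1875 w (w * w)) ⟩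
        1875 * w * (w * w)                 ∎))

    2hh≤k′ : 2 * hh ≤ k
    2hh≤k′ = go types
      where
      open ≤-Reasoning
      shape₁ : ∀ a b → 375 * a * b ≡ 25 * (15 * (a * b))
      shape₁ = solve-∀
      shape₂ : ∀ k → 25 * (k * k * k) ≡ k * ((5 * k) * (5 * k))
      shape₂ = solve-∀
      shape₃ : ∀ k w → k * ((12 * w) * (12 * w)) ≡ 144 * k * (w * w)
      shape₃ = solve-∀
      shape₄ : ∀ a → 144 * (2 * a) ≡ 288 * a
      shape₄ = solve-∀
      go : m ≡ 0 ⊎ w * (2 + m) ≤ D + g → 2 * hh ≤ k
      go (inj₁ refl) = ≤-trans (m≤m+n 8 64) 72≤k
      go (inj₂ q) = *-cancelˡ-≤ 144 (≤-trans (≤-reflexive (shape₄ hh)) (≤-trans (*-monoˡ-≤ hh (m≤m+n 288 87)) (cancel (begin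
        375 * hh * (w * w)               ≡⟨ shape₁ hh (w * w) ⟩
        25 * (15 * (hh * (w * w)))       ≤⟨ *-monoʳ-≤ 25 (cubed q) ⟩
        25 * (k * k * k)                 ≡⟨ shape₂ k ⟩
        k * ((5 * k) * (5 * k))          ≤⟨ *-monoʳ-≤ k (*-mono-≤ 5k≤12w 5k≤12w) ⟩
        k * ((12 * w) * (12 * w))        ≡⟨ shape₃ k w ⟩
        144 * k * (w * w)                ∎))))

    room₂ : w + (m * m + 2 * m + 5) ≤ g
    room₂ with m≤n⇒∃[o]m+o≡n w≤k
      where
      w≤k : w ≤ k
      w≤k = *-cancelˡ-≤ 7 (≤-trans (m≤m+n (7 * w) 7) (≤-trans 7w<6k (*-monoˡ-≤ k (n≤1+n 6))))
    ... | u , eu = ≤-trans (+-monoʳ-≤ w (room-from-square m (go types) (≤-trans (m≤m+n 5 6) 11≤u))) (≤-trans (≤-reflexive eu) k≤g)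
      where
      open ≤-Reasoning
      k+7≤7u : k + 7 ≤ 7 * u
      k+7≤7u = ≤-cert 0 (+-mono-≤ 7w<6k (≤-reflexive (cong (7 *_) (sym eu)))) (shape w u k)
        where
        shape : ∀ w u k → k + 7 + (6 * k + 7 * (w + u)) + 0 ≡ 7 * u + (7 * w + 7 + 7 * k)
        shape = solve-∀
      11≤u : 11 ≤ u
      11≤u = *-cancelˡ-≤ 7 (≤-trans (≤-trans (m≤m+n 77 2) (+-monoˡ-≤ 7 72≤k)) k+7≤7u)
      split₅ : 5 * w + 5 * u ≡ 5 * k
      split₅ = trans (sym (*-distribˡ-+ 5 w u)) (cong (5 *_) eu)
      split₄ : 4 * w + 4 * u ≡ 4 * k
      split₄ = trans (sym (*-distribˡ-+ 4 w u)) (cong (4 *_) eu)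
      -- For w between 5k/12 and 6k/7 the cubic (k - w)w² is concave, and at both ends it is about
      -- k³/10, well above k³/15. Breaking the range at 3k/5 and 3k/4 makes it enough to bound u and
      -- w separately by multiples of k.
      large : k * k * k ≤ 15 * u * (w * w)
      large with 5 * w ≤? 3 * k | 4 * w ≤? 3 * k
      ... | yes p | _ = *-cancelˡ-≤ 50 (begin
        50 * (k * k * k)                     ≡⟨ shape₁ k ⟩
        (2 * k) * ((5 * k) * (5 * k))        ≤⟨ *-mono-≤ 2k≤5u (*-mono-≤ 5k≤12w 5k≤12w) ⟩
        (5 * u) * ((12 * w) * (12 * w))      ≡⟨ shape₂ u w ⟩
        720 * (u * (w * w))                  ≤⟨ *-monoˡ-≤ (u * (w * w)) (m≤m+n 720 30) ⟩
        750 * (u * (w * w))                  ≡⟨ shape₃ u (w * w) ⟩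
        50 * (15 * u * (w * w))              ∎)
        where
        2k≤5u : 2 * k ≤ 5 * u
        2k≤5u = ≤-cert 0 (+-mono-≤ p (≤-reflexive (sym split₅))) (shape (5 * w) (5 * u) k)
          where
          shape : ∀ a b k → 2 * k + (3 * k + (a + b)) + 0 ≡ b + (a + 5 * k)
          shape = solve-∀
        shape₁ : ∀ k → 50 * (k * k * k) ≡ (2 * k) * ((5 * k) * (5 * k))
        shape₁ = solve-∀
        shape₂ : ∀ u w → (5 * u) * ((12 * w) * (12 * w)) ≡ 720 * (u * (w * w))
        shape₂ = solve-∀
        shape₃ : ∀ u b → 750 * (u * b) ≡ 50 * (15 * u * b)
        shape₃ = solve-∀
      ... | no ¬p | yes p = *-cancelˡ-≤ 9 (begin
        9 * (k * k * k)                      ≡⟨ shape₁ k ⟩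
        k * ((3 * k) * (3 * k))              ≤⟨ *-mono-≤ k≤4u (*-mono-≤ (<⇒≤ (≰⇒> ¬p)) (<⇒≤ (≰⇒> ¬p))) ⟩
        (4 * u) * ((5 * w) * (5 * w))        ≡⟨ shape₂ u w ⟩
        100 * (u * (w * w))                  ≤⟨ *-monoˡ-≤ (u * (w * w)) (m≤m+n 100 35) ⟩
        135 * (u * (w * w))                  ≡⟨ shape₃ u (w * w) ⟩
        9 * (15 * u * (w * w))               ∎)
        where
        k≤4u : k ≤ 4 * u
        k≤4u = ≤-cert 0 (+-mono-≤ p (≤-reflexive (sym split₄))) (shape (4 * w) (4 * u) k)
          where
          shape : ∀ a b k → k + (3 * k + (a + b)) + 0 ≡ b + (a + 4 * k)
          shape = solve-∀
        shape₁ : ∀ k → 9 * (k * k * k) ≡ k * ((3 * k) * (3 * k))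
        shape₁ = solve-∀
        shape₂ : ∀ u w → (4 * u) * ((5 * w) * (5 * w)) ≡ 100 * (u * (w * w))
        shape₂ = solve-∀
        shape₃ : ∀ u b → 135 * (u * b) ≡ 9 * (15 * u * b)
        shape₃ = solve-∀
      ... | no _ | no ¬p = *-cancelˡ-≤ 9 (begin
        9 * (k * k * k)                      ≡⟨ shape₁ k ⟩
        k * ((3 * k) * (3 * k))              ≤⟨ *-mono-≤ (≤-trans (m≤m+n k 7) k+7≤7u) (*-mono-≤ (<⇒≤ (≰⇒> ¬p)) (<⇒≤ (≰⇒> ¬p))) ⟩
        (7 * u) * ((4 * w) * (4 * w))        ≡⟨ shape₂ u w ⟩
        112 * (u * (w * w))                  ≤⟨ *-monoˡ-≤ (u * (w * w)) (m≤m+n 112 23) ⟩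
        135 * (u * (w * w))                  ≡⟨ shape₃ u (w * w) ⟩
        9 * (15 * u * (w * w))               ∎)
        where
        shape₁ : ∀ k → 9 * (k * k * k) ≡ k * ((3 * k) * (3 * k))
        shape₁ = solve-∀
        shape₂ : ∀ u w → (7 * u) * ((4 * w) * (4 * w)) ≡ 112 * (u * (w * w))
        shape₂ = solve-∀
        shape₃ : ∀ u b → 135 * (u * b) ≡ 9 * (15 * u * b)
        shape₃ = solve-∀
      go : m ≡ 0 ⊎ w * (2 + m) ≤ D + g → hh ≤ u
      go (inj₁ refl) = ≤-trans (m≤m+n 4 7) 11≤u
      go (inj₂ q) = *-cancelˡ-≤ 15 (cancel (≤-trans (≤-reflexive (*-assoc 15 hh (w * w))) (≤-trans (cubed q) large)))

-- Splitting boxes and paths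

seg-shift : ∀ (f : ℕ → A) a i m → seg (λ j → f (a + j)) i m ≡ seg f (a + i) m
seg-shift f a i zero = refl
seg-shift f a i (suc m) = cong (f (a + i) ∷_) (trans (seg-shift f a (suc i) m) (cong (λ z → seg f z m) (+-suc a i)))

seg-mirror : ∀ (f : ℕ → A) m → seg (λ i → f (m ∸ suc i)) 0 m ↭ seg f 0 m
seg-mirror f zero = ↭-refl
seg-mirror f (suc m) = ↭-trans (prep (f m) (↭-trans (↭-reflexive (sym (seg-shift (λ i → f (suc m ∸ suc i)) 1 0 m))) (seg-mirror f m)))
  (↭-sym (seg-∷ʳ f 0 m))

∣mirror∣ : ∀ m {i j} → i ≤ m → j ≤ m → ∣ m ∸ i - m ∸ j ∣ ≡ ∣ i - j ∣
∣mirror∣ m {zero} {j} z≤n q = trans (m≤n⇒∣n-m∣≡n∸m (m∸n≤m m j)) (m∸[m∸n]≡n q)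
∣mirror∣ m {suc i} {zero} p z≤n = trans (m≤n⇒∣m-n∣≡n∸m (m∸n≤m m (suc i))) (m∸[m∸n]≡n p)
∣mirror∣ (suc m) {suc i} {suc j} (s≤s p) (s≤s q) = ∣mirror∣ m p q

box-↭ : (ψ : A → A → A → B) {X X′ Y Y′ Z Z′ : List A} → X ↭ X′ → Y ↭ Y′ → Z ↭ Z′ → box ψ X Y Z ↭ box ψ X′ Y′ Z′
box-↭ ψ {X} {X′} {Y} {Y′} p q r = ↭-trans (concatMap⁺ _ p)
  (concatMap-cong-↭ (λ x → ↭-trans (concatMap⁺ _ q) (concatMap-cong-↭ (λ y → concatMap⁺ _ r) Y′)) X′)

-- The eight boxes of three bisected factors, used for the arms of the spines and again for spines
-- against branches. The last two boxes enter as one, because in the first use their rows may run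
-- along the whole third spine.
assemble : ∀ {G : Graph} {t : V G} (ψ : A → A → A → V G) (M₁ A₁ M₂ A₂ M₃ A₃ : List A) {S₁ S₂ S₃ : List A} →
  M₁ ++ A₁ ↭ S₁ → M₂ ++ A₂ ↭ S₂ → M₃ ++ A₃ ↭ S₃ →
  (∃ λ rest → box ψ M₁ M₂ M₃ ↭ t ∷ rest × Into G t rest) → Into G t (box ψ M₁ M₂ A₃) →
  Into G t (box ψ M₁ A₂ M₃) → Into G t (box ψ M₁ A₂ A₃) → Into G t (box ψ A₁ M₂ M₃) → Into G t (box ψ A₁ M₂ A₃) →
  Into G t (box ψ A₁ A₂ (M₃ ++ A₃)) → ∃ λ rest → box ψ S₁ S₂ S₃ ↭ t ∷ rest × Into G t rest
assemble {t = t} ψ M₁ A₁ M₂ A₂ M₃ A₃ {S₁} {S₂} {S₃} p₁ p₂ p₃ (rest , split , mmm) mma mam maa amm ama aaz =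
  ((rest ++ box ψ M₁ M₂ A₃) ++ box ψ M₁ A₂ Z) ++ box ψ A₁ Y Z , reorder ,
  Into-++ (Into-++ (Into-++ mmm mma) (perm (box-++₃ ψ M₁ A₂ M₃ A₃) (Into-++ mam maa)))
    (perm (box-++₂ ψ A₁ M₂ A₂ Z) (Into-++ (perm (box-++₃ ψ A₁ M₂ M₃ A₃) (Into-++ amm ama)) aaz))
  where
  open PermutationReasoning
  Y = M₂ ++ A₂
  Z = M₃ ++ A₃
  reorder : box ψ S₁ S₂ S₃ ↭ ((t ∷ rest ++ box ψ M₁ M₂ A₃) ++ box ψ M₁ A₂ Z) ++ box ψ A₁ Y Z
  reorder = begin
    box ψ S₁ S₂ S₃
      ↭⟨ box-↭ ψ p₁ p₂ p₃ ⟨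
    box ψ (M₁ ++ A₁) Y Z
      ↭⟨ box-++₁ ψ M₁ A₁ Y Z ⟨
    box ψ M₁ Y Z ++ box ψ A₁ Y Z
      ↭⟨ ++⁺ʳ (box ψ A₁ Y Z) (box-++₂ ψ M₁ M₂ A₂ Z) ⟨
    (box ψ M₁ M₂ Z ++ box ψ M₁ A₂ Z) ++ box ψ A₁ Y Z
      ↭⟨ ++⁺ʳ (box ψ A₁ Y Z) (++⁺ʳ (box ψ M₁ A₂ Z) (box-++₃ ψ M₁ M₂ M₃ A₃)) ⟨
    ((box ψ M₁ M₂ M₃ ++ box ψ M₁ M₂ A₃) ++ box ψ M₁ A₂ Z) ++ box ψ A₁ Y Z
      ↭⟨ ++⁺ʳ (box ψ A₁ Y Z) (++⁺ʳ (box ψ M₁ A₂ Z) (++⁺ʳ (box ψ M₁ M₂ A₃) split)) ⟩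
    ((t ∷ rest ++ box ψ M₁ M₂ A₃) ++ box ψ M₁ A₂ Z) ++ box ψ A₁ Y Z ∎

module _ {K : Graph} {a : V K} where

  Path-split : ∀ {xs f} m n → Path-from K a xs f (m + n) →
    ∃₂ λ ys zs → ys ++ zs ≡ xs × Path-from K a ys f m × Path-from K a zs (λ i → f (m + i)) n
  Path-split m n P = seg pt 0 m , seg pt m n , trans (sym (seg-++ pt 0 m n)) list ,
    record { pt = pt ; list = refl
           ; geo = λ p q → geo (≤-trans p (m≤m+n m n)) (≤-trans q (m≤m+n m n)) ; to = λ p → to (≤-trans p (m≤m+n m n)) } ,
    record { pt = λ i → pt (m + i) ; list = trans (seg-shift pt m 0 n) (cong (λ z → seg pt z n) (+-identityʳ m))
           ; geo = λ {i} {j} p q → Dist-cong refl refl (∣m+n-m+o∣≡∣n-o∣ m i j) (geo (+-monoʳ-< m p) (+-monoʳ-< m q))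
           ; to = λ p → to (+-monoʳ-< m p) }
    where open Path-from P

  Path-≗ : ∀ {xs f g N} → (∀ i → f i ≡ g i) → Path-from K a xs f N → Path-from K a xs g N
  Path-≗ e P = record { pt = pt ; list = list ; geo = geo ; to = λ p → Dist-cong refl refl (e _) (to p) }
    where open Path-from P

  -- Pieces of length `W` are split off at the root side while at least `2W` vertices remain, so no
  -- piece is too short and none reaches length `2W`.
  cut : ∀ W → 1 ≤ W → (𝒫 : List (V K) → Set) → (∀ ys zs → 𝒫 ys → 𝒫 zs → 𝒫 (ys ++ zs)) →
    (∀ {ys p w} → 1 ≤ p → Monotone K a ys p w → W ≤ w → w < W + W → 𝒫 ys) →
    ∀ fuel {xs p N} → N ≤ fuel → 1 ≤ p → Monotone K a xs p N → W ≤ N → 𝒫 xs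
  cut W 1≤W 𝒫 app base zero N≤ 1≤p P W≤N = ⊥-elim (<-irrefl refl (≤-trans 1≤W (≤-trans W≤N N≤)))
  cut W 1≤W 𝒫 app base (suc fuel) {N = N} N≤ 1≤p P W≤N with N <? W + W
  ... | yes N< = base 1≤p P W≤N N<
  ... | no N≮ with m≤n⇒∃[o]m+o≡n W≤N
  ...   | n , refl with Path-split W n P
  ...     | ys , zs , refl , P₁ , P₂ = app ys zs (base 1≤p P₁ ≤-refl (m<m+n W 1≤W))
    (cut W 1≤W 𝒫 app base fuel (s≤s⁻¹ (≤-trans (+-monoˡ-≤ n 1≤W) N≤)) (≤-trans 1≤p (m≤m+n _ W))
      (Path-≗ (λ i → sym (+-assoc _ W i)) P₂) (+-cancelˡ-≤ W W n (≮⇒≥ N≮)))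

-- A spine through the root a, at distance α from one end and β from the other, and further paths leading
-- away from a; together they partition the graph.
record Skeleton (K : Graph) (a : V K) (k : ℕ) : Set where
  field
    α β       : ℕ
    spine     : List (V K)
    others    : List (List (V K))
    spinePath : Path-from K a spine (λ i → ∣ i - α ∣) (α + suc β)
    α≤β       : α ≤ β
    k≤α+β     : k ≤ α + β
    branch    : ∀ {xs} → xs ∈ others → ∃₂ λ p N → 1 ≤ p × Monotone K a xs p N × k ≤ N + N
    unique    : Unique (spine ++ concat others)
    complete  : ∀ v → v ∈ spine ++ concat others

  private module S = Path-from spinePath

  main tail : List (V K)
  main = seg S.pt α (suc β)
  tail = seg (λ i → S.pt (α ∸ suc i)) 0 α

  spine-↭ : main ++ tail ↭ spine
  spine-↭ = ↭-trans (++-comm main tail) (↭-trans (++⁺ʳ main (seg-mirror S.pt α))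
    (↭-reflexive (trans (sym (seg-++ S.pt 0 α (suc β))) S.list)))

  main-path : Monotone K a main 0 (suc β)
  main-path = record
    { pt = λ i → S.pt (α + i)
    ; list = trans (seg-shift S.pt α 0 (suc β)) (cong (λ z → seg S.pt z (suc β)) (+-identityʳ α))
    ; geo = λ {i} {j} p q → Dist-cong refl refl (∣m+n-m+o∣≡∣n-o∣ α i j) (S.geo (+-monoʳ-< α p) (+-monoʳ-< α q))
    ; to = λ {i} p → Dist-cong refl refl (∣m+n-m∣≡n α i) (S.to (+-monoʳ-< α p)) }

  tail-path : Monotone K a tail 1 α
  tail-path = record
    { pt = λ i → S.pt (α ∸ suc i)
    ; list = refl
    ; geo = λ {i} {j} p q → Dist-cong refl refl (∣mirror∣ α p q) (S.geo (below i) (below j))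
    ; to = λ {i} p → Dist-cong refl refl (trans (m≤n⇒∣m-n∣≡n∸m (m∸n≤m α (suc i))) (m∸[m∸n]≡n p)) (S.to (below i)) }
    where
    below : ∀ i → α ∸ suc i < α + suc β
    below i = ≤-<-trans (m∸n≤m α (suc i)) (m<m+n α (s≤s z≤n))

  k≤β+β : k ≤ β + β
  k≤β+β = ≤-trans k≤α+β (+-monoˡ-≤ β α≤β)

  k≤main : k ≤ suc β + suc β
  k≤main = ≤-trans k≤β+β (+-mono-≤ (n≤1+n β) (n≤1+n β))

  spine-far : ∀ {i} → i < α + suc β → ∣ i - α ∣ ≤ β
  spine-far {i} i< with ≤-total i α
  ... | inj₁ i≤α = ≤-trans (≤-reflexive (m≤n⇒∣m-n∣≡n∸m i≤α)) (≤-trans (m∸n≤m α i) α≤β)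
  ... | inj₂ α≤i = ≤-trans (≤-reflexive (m≤n⇒∣n-m∣≡n∸m α≤i)) (m≤n+o⇒m∸n≤o i α (s≤s⁻¹ (≤-trans i< (≤-reflexive (+-suc α β)))))

-- Covering the cube by boxes

module Assembly {K G : Graph} {t : V G} (k D : ℕ) (72≤k : 72 ≤ k) (72DD≤kkk : 72 * (D * D) ≤ k * k * k) (k≤D : k ≤ D)
  (diameter : ∀ {x y r} → Dist K x y r → r ≤ D) where

  open Arithmetic k D 72≤k 72DD≤kkk k≤D

  spread-bound : ∀ {a b c X Y Z p w fQ fR B C} → Monotone K a X p w → Path-from K b Y fQ B → Path-from K c Z fR C → 1 ≤ w →
    ∀ {j l} → j < B → l < C → p + (fQ j + fR l) + w ≤ suc (3 * D)
  spread-bound {p = p} {suc w} {fQ} {fR} P Q R _ {j} {l} j< l< = ≤-trans (≤-reflexive (shape p (fQ j) (fR l) w))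
    (s≤s (+-mono-≤ (diameter (Path-from.to P ≤-refl))
      (+-mono-≤ (diameter (Path-from.to Q j<)) (≤-trans (diameter (Path-from.to R l<)) (≤-reflexive (sym (+-identityʳ D)))))))
    where
    shape : ∀ p x y w → p + (x + y) + suc w ≡ suc (p + w + (x + y))
    shape = solve-∀

  -- The rows run along the shorter branch, so the longer one provides the summand w of the required
  -- room, and the monotone part of the third factor, of length at least k/2, provides H².
  two-branches≤ : ∀ {a b c ψ} → Embedding K G a b c t ψ → ∀ {X Y Z p w q N fR} αr c′ r → Monotone K a X p w → Monotone K b Y q N →
    Path-from K c Z fR (αr + c′) → 1 ≤ p → k ≤ w + w → w ≤ N → (∀ {i} → i < c′ → fR (αr + i) ≡ r + i) → k ≤ c′ + c′ →
    Into G t (box ψ X Y Z)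
  two-branches≤ E {w = w} {q} {N} αr c′ r P Q R 1≤p k≤2w w≤N mainR k≤2c with type-bound (3 * D) w (1≤ k≤2w)
  ... | m , D< , small = box-flexible E 0 N αr c′ q r m P Q R 1≤p (λ _ → refl) mainR
      (λ j< l< → far-from-bound {w = w} {m = m} (spread-bound P Q R (1≤ k≤2w) j< l<) D<)
      (wide-from-square m square≤w (≤-trans (m≤m+n 10 26) (36≤ k≤2w)))
      (+-mono-≤ w≤N (room-from-square m (halve 2HH k≤2c) (≤-trans (m≤m+n 5 31) (36≤ k≤2c))))
      (room-b-from-square m (≤-trans square≤w w≤N)) (1≤ k≤2c)
    where
    2HH = 2HH≤k {w} {m} (1≤ k≤2w) k≤2w small
    square≤w = halve 2HH k≤2w

  two-branches : ∀ {a b c ψ} → Embedding K G a b c t ψ → ∀ {X Y Z p w q N fR} αr c′ r → Monotone K a X p w → Monotone K b Y q N →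
    Path-from K c Z fR (αr + c′) → 1 ≤ p → 1 ≤ q → k ≤ w + w → k ≤ N + N → (∀ {i} → i < c′ → fR (αr + i) ≡ r + i) → k ≤ c′ + c′ →
    Into G t (box ψ X Y Z)
  two-branches {ψ = ψ} E {X} {Y} {Z} {w = w} {N = N} αr c′ r P Q R 1≤p 1≤q k≤2w k≤2N mainR k≤2c with ≤-total w N
  ... | inj₁ w≤N = two-branches≤ E αr c′ r P Q R 1≤p k≤2w w≤N mainR k≤2c
  ... | inj₂ N≤w = perm (box-swap₁₂ ψ X Y Z) (two-branches≤ (embedding-swap₁₂ E) αr c′ r Q P R 1≤q k≤2N N≤w mainR k≤2c)

  module _ {a b c : V K} {ψ : V K → V K → V K → V G} (E : Embedding K G a b c t ψ) where

    module OneBranch (S : Skeleton K b k) (S′ : Skeleton K c k) where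

      private
        module S = Skeleton S
        module S′ = Skeleton S′
        g = suc S.β + suc S′.β

      𝒫 : List (V K) → Set
      𝒫 xs = Into G t (box ψ xs S.spine S′.spine)

      𝒫-++ : ∀ ys zs → 𝒫 ys → 𝒫 zs → 𝒫 (ys ++ zs)
      𝒫-++ ys zs i j = perm (box-++₁ ψ ys zs S.spine S′.spine) (Into-++ i j)

      long-piece : 9 * k ≤ 8 * g → ∀ {ys p w} → 1 ≤ p → Monotone K a ys p w → k ≤ w + w → w ≤ k → 𝒫 ys
      long-piece 9k≤8g {w = w} 1≤p P k≤2w w≤k with type-bound (3 * D) w (1≤ k≤2w)
      ... | m , D< , small = box-flexible E S.α (suc S.β) S′.α (suc S′.β) 0 0 m P S.spinePath S′.spinePath 1≤p
          (λ {i} _ → ∣m+n-m∣≡n S.α i) (λ {i} _ → ∣m+n-m∣≡n S′.α i)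
          (λ j< l< → far-from-bound {w = w} {m = m} (spread-bound P S.spinePath S′.spinePath (1≤ k≤2w) j< l<) D<)
          (wide-from-square m (halve 2HH k≤2w) (≤-trans (m≤m+n 10 26) (36≤ k≤2w)))
          (room₁ {w} {_} {m} k≤2w w≤k 9k≤8g small)
          (room-b-from-square m (halve 2HH S.k≤main)) (s≤s z≤n)
        where
        2HH = 2HH≤k {w} {m} (1≤ k≤2w) k≤2w small

      k≤g : k ≤ g
      k≤g = half-≤ (≤-trans (+-mono-≤ S.k≤main S′.k≤main) (≤-trans (≤-reflexive (shape (suc S.β) (suc S′.β))) (n≤1+n _)))
        where
        shape : ∀ b c → b + b + (c + c) ≡ b + c + (b + c)
        shape = solve-∀

      -- On a spine no vertex is farther from the root than the end of the longer arm, so only one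
      -- coordinate has to be charged to the diameter.
      narrow-bound : ∀ {ys p w x y} → Monotone K a ys p w → 1 ≤ w → x ≤ S.β → y ≤ S′.β → p + (x + y) + w ≤ suc (D + g)
      narrow-bound {p = p} {suc w} {x} {y} P _ x≤ y≤ =
        ≤-cert 2 (+-mono-≤ (diameter (Path-from.to P ≤-refl)) (+-mono-≤ x≤ y≤)) (shape p w x y D S.β S′.β)
        where
        shape : ∀ p w x y D β β′ → p + (x + y) + suc w + (D + (β + β′)) + 2 ≡ suc (D + (suc β + suc β′)) + (p + w + (x + y))
        shape = solve-∀

      short-piece : 8 * g ≤ 9 * k → ∀ {ys p w} → 1 ≤ p → Monotone K a ys p w → 5 * k ≤ 12 * w → 7 * w + 7 ≤ 6 * k → 1 ≤ w → 𝒫 ys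
      short-piece 8g≤9k {p = p} {w} 1≤p P 5k≤12w 7w<6k 1≤w with type-bound (D + g) w 1≤w
      ... | m , D< , small = box-flexible E S.α (suc S.β) S′.α (suc S′.β) 0 0 m P S.spinePath S′.spinePath 1≤p
          (λ {i} _ → ∣m+n-m∣≡n S.α i) (λ {i} _ → ∣m+n-m∣≡n S′.α i)
          (λ j< l< → far-from-bound {w = w} {m = m} (narrow-bound P 1≤w (S.spine-far j<) (S′.spine-far l<)) D<)
          (wide-from-square m N.hh≤w (≤-trans (m≤m+n 10 20) N.30≤w))
          N.room₂ (room-b-from-square m (halve N.2hh≤k′ S.k≤main)) (s≤s z≤n)
        where
        module N = Narrow {w} {g} {m} 5k≤12w 7w<6k k≤g 8g≤9k small

      -- If the spines are short then so are the distances, and shorter rows do.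
      one-branch : ∀ {X p N} → Monotone K a X p N → 1 ≤ p → k ≤ N + N → 𝒫 X
      one-branch {X} {p} {N} P 1≤p k≤2N = go (9 * k ≤? 8 * g) (half-up k) sevenths
        where
        go : Dec (9 * k ≤ 8 * g) → (∃ λ L → k ≤ L + L × L + L ≤ suc k) → (∃ λ W → 7 * W ≤ 3 * k × 5 * k ≤ 12 * W × 1 ≤ W) → 𝒫 X
        -- With L = ⌈k/2⌉ the pieces are shorter than 2L ≤ k + 1, hence of length between k/2 and k.
        go (yes 9k≤8g) (L , k≤2L , 2L≤) _ = cut L (1≤ k≤2L) 𝒫 𝒫-++
          (λ 1≤p P L≤w w< → long-piece 9k≤8g 1≤p P (≤-trans k≤2L (+-mono-≤ L≤w L≤w)) (s≤s⁻¹ (≤-trans w< 2L≤)))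
          N ≤-refl 1≤p P (half-≤ (≤-trans 2L≤ (s≤s k≤2N)))
        go (no ¬9k≤8g) _ (W , 7W≤3k , 5k≤12W , 1≤W) = cut W 1≤W 𝒫 𝒫-++
          (λ {_} {_} {w} 1≤p P W≤w w< → short-piece (<⇒≤ (≰⇒> ¬9k≤8g)) 1≤p P (≤-trans 5k≤12W (*-monoʳ-≤ 12 W≤w))
            (≤-cert 0 (+-mono-≤ (*-monoʳ-≤ 7 w<) (*-monoʳ-≤ 2 7W≤3k)) (shape w W k)) (≤-trans 1≤W W≤w))
          N ≤-refl 1≤p P (*-cancelˡ-≤ 7 (≤-cert N (+-mono-≤ 7W≤3k (*-monoʳ-≤ 3 k≤2N)) (shape′ (7 * W) (3 * k) N)))
          where
          shape : ∀ w W k → 7 * w + 7 + (7 * (W + W) + 2 * (3 * k)) + 0 ≡ 6 * k + (7 * suc w + 2 * (7 * W))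
          shape = solve-∀
          shape′ : ∀ a b N → a + (b + 3 * (N + N)) + N ≡ 7 * N + (a + b)
          shape′ = solve-∀

  -- An arm of a spine starts at the root or next to it, whence the 3. This is far below w ≥ 36, so
  -- that the snake begins with σ ≤ w.
  near-root : ∀ {a b c ψ} → Embedding K G a b c t ψ → ∀ {X Y Z p q r w B C} →
    Monotone K a X p w → Monotone K b Y q B → Monotone K c Z r C → k ≤ w + w → 1 ≤ p + (q + r) → p + (q + r) ≤ 3 →
    Into G t (box ψ X Y Z)
  near-root E {w = w} P Q R k≤2w lo hi with type-bound (3 * D) w (1≤ k≤2w)
  ... | m , D< , small = box-near E P Q R (2 + m) (two-types m w k≤2w small)
    (λ j< l< → far-from-bound {w = w} {m = m} (spread-bound P Q R (1≤ k≤2w) j< l<) D<) lo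
    (≤-trans hi (≤-trans (m≤m+n 3 33) (36≤ k≤2w)))

  near-root₀ : ∀ {a b c ψ} → Embedding K G a b c t ψ → ∀ {X Y Z w B C} →
    Monotone K a X 0 (suc w) → Monotone K b Y 0 (suc B) → Monotone K c Z 0 (suc C) → k ≤ suc w + suc w →
    ∃ λ rest → box ψ X Y Z ↭ t ∷ rest × Into G t rest
  near-root₀ E {w = w} P Q R k≤2w with type-bound (3 * D) (suc w) (s≤s z≤n)
  ... | m , D< , small = box-near₀ E P Q R (2 + m) (two-types m (suc w) k≤2w small)
    (λ j< l< → far-from-bound {w = suc w} {m = m} (spread-bound P Q R (s≤s z≤n) j< l<) D<)

  module ThreeSpines {a b c : V K} {ψ : V K → V K → V K → V G} (E : Embedding K G a b c t ψ)
    (S₁ : Skeleton K a k) (S₂ : Skeleton K b k) (S₃ : Skeleton K c k)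
    (α₁≤α₃ : Skeleton.α S₁ ≤ Skeleton.α S₃) (α₂≤α₃ : Skeleton.α S₂ ≤ Skeleton.α S₃) where

    private
      module S₁ = Skeleton S₁
      module S₂ = Skeleton S₂
      module S₃ = Skeleton S₃
      Z₃ = S₃.main ++ S₃.tail

    rows₁ : ∀ {Y q B Z r C} → Monotone K b Y q B → Monotone K c Z r C → 1 ≤ q + r → q + r ≤ 3 → Into G t (box ψ S₁.main Y Z)
    rows₁ Q R lo hi = near-root E S₁.main-path Q R S₁.k≤main lo hi

    rows₂ : ∀ {Z r C} → Monotone K c Z r C → r ≤ 2 → Into G t (box ψ S₁.tail S₂.main Z)
    rows₂ {Z} R r≤2 = perm (box-swap₁₂ ψ S₁.tail S₂.main Z)
      (near-root (embedding-swap₁₂ E) S₂.main-path S₁.tail-path R S₂.k≤main (s≤s z≤n) (s≤s r≤2))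

    rows₃ : ∀ {Z r C} → Monotone K c Z r C → k ≤ C + C → r ≤ 1 → Into G t (box ψ S₁.tail S₂.tail Z)
    rows₃ {Z} {r} R k≤2C r≤1 = perm (↭-trans (box-swap₁₂ (λ x z y → ψ x y z) S₁.tail Z S₂.tail) (box-swap₂₃ ψ S₁.tail S₂.tail Z))
      (near-root (embedding-swap₁₂ (embedding-swap₂₃ E)) R S₁.tail-path S₂.tail-path k≤2C (≤-trans (s≤s z≤n) (m≤n+m 2 r)) (+-monoˡ-≤ 2 r≤1))

    path-member : ∀ {d xs f N x} → Path-from K d xs f N → x ∈ xs → ∃ λ i → i < N × Dist K x d (f i)
    path-member {N = N} P x∈ with ∈-seg 0 N (∈-≡ (sym (Path-from.list P)) x∈)
    ... | i , i<N , refl = i , i<N , Path-from.to P i<N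

    -- Both first tails may be too short for rows. If the third spine has arms of different lengths,
    -- it is used as a whole: the cross distance is at most α₁ + α₂ ≤ α₃ + β₃, which is why the
    -- third factor must have the longest tail. If its arms are equal, its tail has at least k/2
    -- vertices and carries rows itself.
    corner : Into G t (box ψ S₁.tail S₂.tail Z₃)
    corner with S₃.α <? S₃.β
    ... | yes α<β = perm (box-↭ ψ {S₁.tail} {S₁.tail} {S₂.tail} {S₂.tail} {S₃.spine} {Z₃} ↭-refl ↭-refl (↭-sym S₃.spine-↭)) valleys
      where
      valley : ∀ {x y} → (∃ λ i → i < S₁.α × Dist K x a (1 + i)) → (∃ λ i → i < S₂.α × Dist K y b (1 + i)) →
        Into G t (concatMap (λ z → ψ x y z ∷ []) S₃.spine)
      valley (i , i< , dx) (j , j< , dy) = valley-into E S₃.α S₃.β dx dy S₃.spinePath (s≤s z≤n)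
        (+-mono-≤ (≤-trans i< α₁≤α₃) (≤-trans j< (≤-trans α₂≤α₃ S₃.α≤β))) α<β
      valleys : Into G t (box ψ S₁.tail S₂.tail S₃.spine)
      valleys = Into-concatMap (λ x → concatMap (λ y → concatMap (λ z → ψ x y z ∷ []) S₃.spine) S₂.tail) S₁.tail λ {x} x∈ →
        Into-concatMap (λ y → concatMap (λ z → ψ x y z ∷ []) S₃.spine) S₂.tail λ y∈ →
          valley (path-member S₁.tail-path x∈) (path-member S₂.tail-path y∈)
    ... | no α≮β = perm (box-++₃ ψ S₁.tail S₂.tail S₃.main S₃.tail)
      (Into-++ (rows₃ S₃.main-path S₃.k≤main z≤n)
        (rows₃ S₃.tail-path (≤-trans S₃.k≤β+β (+-mono-≤ (≮⇒≥ α≮β) (≮⇒≥ α≮β))) ≤-refl))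

    three-spines : ∃ λ rest → box ψ S₁.spine S₂.spine S₃.spine ↭ t ∷ rest × Into G t rest
    three-spines = assemble ψ S₁.main S₁.tail S₂.main S₂.tail S₃.main S₃.tail S₁.spine-↭ S₂.spine-↭ S₃.spine-↭
      (near-root₀ E S₁.main-path S₂.main-path S₃.main-path S₁.k≤main)
      (rows₁ S₂.main-path S₃.tail-path (s≤s z≤n) (s≤s z≤n)) (rows₁ S₂.tail-path S₃.main-path (s≤s z≤n) (s≤s z≤n))
      (rows₁ S₂.tail-path S₃.tail-path (s≤s z≤n) (s≤s (s≤s z≤n)))
      (rows₂ S₃.main-path z≤n) (rows₂ S₃.tail-path (s≤s z≤n)) corner

  module Whole {a b c : V K} {ψ : V K → V K → V K → V G} (E : Embedding K G a b c t ψ)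
    (S₁ : Skeleton K a k) (S₂ : Skeleton K b k) (S₃ : Skeleton K c k) where

    private
      module S₁ = Skeleton S₁
      module S₂ = Skeleton S₂
      module S₃ = Skeleton S₃
      O₁ = concat S₁.others
      O₂ = concat S₂.others
      O₃ = concat S₃.others

    spines : ∃ λ rest → box ψ S₁.spine S₂.spine S₃.spine ↭ t ∷ rest × Into G t rest
    spines = go (≤-total S₁.α S₂.α) (≤-total S₁.α S₃.α) (≤-total S₂.α S₃.α)
      where
      reorder : ∀ {xs ys} → xs ↭ ys → (∃ λ rest → xs ↭ t ∷ rest × Into G t rest) → ∃ λ rest → ys ↭ t ∷ rest × Into G t rest
      reorder p (rest , split , into) = rest , ↭-trans (↭-sym p) split , into
      go : S₁.α ≤ S₂.α ⊎ S₂.α ≤ S₁.α → S₁.α ≤ S₃.α ⊎ S₃.α ≤ S₁.α → S₂.α ≤ S₃.α ⊎ S₃.α ≤ S₂.α →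
        ∃ λ rest → box ψ S₁.spine S₂.spine S₃.spine ↭ t ∷ rest × Into G t rest
      go _ (inj₁ p) (inj₁ q) = ThreeSpines.three-spines E S₁ S₂ S₃ p q
      go (inj₁ p) _ (inj₂ q) = reorder (box-swap₂₃ ψ S₁.spine S₂.spine S₃.spine)
        (ThreeSpines.three-spines (embedding-swap₂₃ E) S₁ S₃ S₂ p q)
      go (inj₂ p) (inj₂ q) _ = reorder
        (↭-trans (box-swap₂₃ (λ y x z → ψ x y z) S₂.spine S₁.spine S₃.spine) (box-swap₁₂ ψ S₁.spine S₂.spine S₃.spine))
        (ThreeSpines.three-spines (embedding-swap₂₃ (embedding-swap₁₂ E)) S₂ S₃ S₁ p q)
      -- The two remaining patterns of comparisons are circular, so transitivity supplies the
      -- missing inequality.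
      go (inj₂ p) (inj₁ q) (inj₂ r) = ThreeSpines.three-spines E S₁ S₂ S₃ q (≤-trans p q)
      go (inj₁ p) (inj₂ q) (inj₁ r) = ThreeSpines.three-spines E S₁ S₂ S₃ (≤-trans p r) r

    over₁ : ∀ Y Z os → (∀ {xs} → xs ∈ os → Into G t (box ψ xs Y Z)) → Into G t (box ψ (concat os) Y Z)
    over₁ Y Z [] h = nil
    over₁ Y Z (x ∷ os) h = perm (box-++₁ ψ x (concat os) Y Z) (Into-++ (h (here refl)) (over₁ Y Z os λ p → h (there p)))

    over₂ : ∀ X Z os → (∀ {xs} → xs ∈ os → Into G t (box ψ X xs Z)) → Into G t (box ψ X (concat os) Z)
    over₂ X Z [] h = subst (Into G t) (sym (concatMap-[] X)) nil
    over₂ X Z (x ∷ os) h = perm (box-++₂ ψ X x (concat os) Z) (Into-++ (h (here refl)) (over₂ X Z os λ p → h (there p)))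

    over₃ : ∀ X Y os → (∀ {xs} → xs ∈ os → Into G t (box ψ X Y xs)) → Into G t (box ψ X Y (concat os))
    over₃ X Y [] h = subst (Into G t) (sym (trans (Listₚ.concatMap-cong (λ x → concatMap-[] Y) X) (concatMap-[] X))) nil
    over₃ X Y (x ∷ os) h = perm (box-++₃ ψ X Y x (concat os)) (Into-++ (h (here refl)) (over₃ X Y os λ p → h (there p)))

    whole : ∃ λ rest → box ψ (S₁.spine ++ O₁) (S₂.spine ++ O₂) (S₃.spine ++ O₃) ↭ t ∷ rest × Into G t rest
    whole = assemble ψ S₁.spine O₁ S₂.spine O₂ S₃.spine O₃ ↭-refl ↭-refl ↭-refl
      spines ss· s·s s·· ·ss ·s· (perm (box-++₃ ψ O₁ O₂ S₃.spine O₃) (Into-++ ··s ···))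
      where
      ss· : Into G t (box ψ S₁.spine S₂.spine O₃)
      ss· = over₃ S₁.spine S₂.spine S₃.others λ {xs} x∈ → let (p , N , 1≤p , P , k≤) = S₃.branch x∈ in
        perm (↭-trans (box-swap₁₂ (λ x z y → ψ x y z) S₁.spine xs S₂.spine) (box-swap₂₃ ψ S₁.spine S₂.spine xs))
          (OneBranch.one-branch (embedding-swap₁₂ (embedding-swap₂₃ E)) S₁ S₂ P 1≤p k≤)
      s·s : Into G t (box ψ S₁.spine O₂ S₃.spine)
      s·s = over₂ S₁.spine S₃.spine S₂.others λ {xs} x∈ → let (p , N , 1≤p , P , k≤) = S₂.branch x∈ in
        perm (box-swap₁₂ ψ S₁.spine xs S₃.spine) (OneBranch.one-branch (embedding-swap₁₂ E) S₁ S₃ P 1≤p k≤)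
      ·ss : Into G t (box ψ O₁ S₂.spine S₃.spine)
      ·ss = over₁ S₂.spine S₃.spine S₁.others λ x∈ → let (p , N , 1≤p , P , k≤) = S₁.branch x∈ in OneBranch.one-branch E S₂ S₃ P 1≤p k≤
      s·· : Into G t (box ψ S₁.spine O₂ O₃)
      s·· = over₂ S₁.spine O₃ S₂.others λ {ys} y∈ → over₃ S₁.spine ys S₃.others λ {zs} z∈ →
        let (p , N , 1≤p , P , k≤) = S₂.branch y∈ ; (p′ , N′ , 1≤p′ , P′ , k≤′) = S₃.branch z∈ in
        perm (↭-trans (box-swap₂₃ (λ y x z → ψ x y z) ys S₁.spine zs) (box-swap₁₂ ψ S₁.spine ys zs))
          (two-branches (embedding-swap₂₃ (embedding-swap₁₂ E)) S₁.α (suc S₁.β) 0 P P′ S₁.spinePath 1≤p 1≤p′ k≤ k≤′ (λ {i} _ → ∣m+n-m∣≡n S₁.α i) S₁.k≤main)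
      ·s· : Into G t (box ψ O₁ S₂.spine O₃)
      ·s· = over₁ S₂.spine O₃ S₁.others λ {xs} x∈ → over₃ xs S₂.spine S₃.others λ {zs} z∈ →
        let (p , N , 1≤p , P , k≤) = S₁.branch x∈ ; (p′ , N′ , 1≤p′ , P′ , k≤′) = S₃.branch z∈ in
        perm (box-swap₂₃ ψ xs S₂.spine zs)
          (two-branches (embedding-swap₂₃ E) S₂.α (suc S₂.β) 0 P P′ S₂.spinePath 1≤p 1≤p′ k≤ k≤′ (λ {i} _ → ∣m+n-m∣≡n S₂.α i) S₂.k≤main)
      ··s : Into G t (box ψ O₁ O₂ S₃.spine)
      ··s = over₁ O₂ S₃.spine S₁.others λ {xs} x∈ → over₂ xs S₃.spine S₂.others λ y∈ →
        let (p , N , 1≤p , P , k≤) = S₁.branch x∈ ; (p′ , N′ , 1≤p′ , P′ , k≤′) = S₂.branch y∈ in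
        two-branches E S₃.α (suc S₃.β) 0 P P′ S₃.spinePath 1≤p 1≤p′ k≤ k≤′ (λ {i} _ → ∣m+n-m∣≡n S₃.α i) S₃.k≤main
      ··· : Into G t (box ψ O₁ O₂ O₃)
      ··· = over₁ O₂ O₃ S₁.others λ {xs} x∈ → over₂ xs O₃ S₂.others λ {ys} y∈ → over₃ xs ys S₃.others λ z∈ →
        let (p , N , 1≤p , P , k≤) = S₁.branch x∈ ; (p′ , N′ , 1≤p′ , P′ , k≤′) = S₂.branch y∈ ; (p″ , N″ , 1≤p″ , P″ , k≤″) = S₃.branch z∈ in
        two-branches E 0 N″ p″ P P′ P″ 1≤p 1≤p′ k≤ k≤′ (λ _ → refl) k≤″

-- Walks

module _ {G : Graph} where

  walk-++ : ∀ {x y z m n} → Walk G x y m → Walk G y z n → Walk G x z (m + n)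
  walk-++ [] w = w
  walk-++ (e ∷ v) w = e ∷ walk-++ v w

  walk-sym : (∀ {x y} → Adj G x y → Adj G y x) → ∀ {x y m} → Walk G x y m → Walk G y x m
  walk-sym s [] = []
  walk-sym s {m = suc m} (e ∷ w) = subst (Walk G _ _) (+-comm m 1) (walk-++ (walk-sym s w) (s e ∷ []))

  Dist-sym : (∀ {x y} → Adj G x y → Adj G y x) → ∀ {x y m} → Dist G x y m → Dist G y x m
  Dist-sym s (w , min) = walk-sym s w , λ j j< v → min j j< (walk-sym s v)

  Dist-≤ : ∀ {x y m n} → Dist G x y m → Walk G x y n → m ≤ n
  Dist-≤ {m = m} {n} (_ , min) w = ≮⇒≥ λ n<m → min n n<m w

  Dist-lower : ∀ {x y m} → Walk G x y m → (∀ {n} → Walk G x y n → m ≤ n) → Dist G x y m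
  Dist-lower w min = w , λ j j< v → <⇒≱ j< (min v)

least : ∀ {P : ℕ → Set} → (∀ m → Dec (P m)) → ∀ {N} → P N → ∃ λ m → P m × (∀ j → j < m → ¬ P j)
least {P} P? {N} pN with below N
  where
  below : ∀ N → (∃ λ m → P m × (∀ j → j < m → ¬ P j)) ⊎ (∀ j → j < N → ¬ P j)
  below zero = inj₂ λ _ ()
  below (suc N) with below N
  ... | inj₁ r = inj₁ r
  ... | inj₂ none with P? N
  ...   | yes p = inj₁ (N , p , none)
  ...   | no ¬p = inj₂ λ j j< pj → go j (m≤n⇒m<n∨m≡n (s≤s⁻¹ j<)) pj
    where
    go : ∀ j → j < N ⊎ j ≡ N → ¬ P j
    go j (inj₁ lt) = none j lt
    go j (inj₂ refl) = ¬p
... | inj₁ r = r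
... | inj₂ none = N , pN , none

-- Simple paths, depth and descendants in a tree

module Tree {n : ℕ} (T : SimpleGraph n) (tree : IsTree T) where

  K : Graph
  K = toGraph T

  E : Fin n → Fin n → Set
  E = adj T

  E-sym : ∀ {x y} → E x y → E y x
  E-sym = SimpleGraph.sym T

  connected : Connected K
  connected = proj₁ (proj₂ tree)

  acyclic : ¬ HasCycle T
  acyclic = proj₂ (proj₂ tree)

  data Via (P : Fin n → Set) : Fin n → Fin n → Set where
    stop : ∀ {x} → P x → Via P x x
    _∷_  : ∀ {x y z} → P x × E x y → Via P y z → Via P x z

  via-++ : ∀ {P x y z} → Via P x y → Via P y z → Via P x z
  via-++ (stop _) w = w
  via-++ (e ∷ v) w = e ∷ via-++ v w

  via-start : ∀ {P x y} → Via P x y → P x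
  via-start (stop p) = p
  via-start ((p , _) ∷ _) = p

  via-sym : ∀ {P x y} → Via P x y → Via P y x
  via-sym (stop p) = stop p
  via-sym ((p , e) ∷ v) = via-++ (via-sym v) ((via-start v , E-sym e) ∷ stop p)

  walk-via : ∀ {x y m} → Walk K x y m → Via (λ _ → ⊤) x y
  walk-via [] = stop tt
  walk-via (e ∷ w) = (tt , e) ∷ walk-via w

  record SimplePath (P : Fin n → Set) (x y : Fin n) : Set where
    field
      vs     : List (Fin n)
      chain  : Chain T (x ∷ vs)
      last   : Last (x ∷ vs) y
      unique : Unique (x ∷ vs)
      inside : All P (x ∷ vs)

  suffix : ∀ {P x w vs y} → x ∈ w ∷ vs → Chain T (w ∷ vs) → Last (w ∷ vs) y → Unique (w ∷ vs) → All P (w ∷ vs) → SimplePath P x y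
  suffix (here refl) c l u i = record { vs = _ ; chain = c ; last = l ; unique = u ; inside = i }
  suffix (there p) (cons _ c) (Last.there l) (_ ∷ u) (_ ∷ i) = suffix p c l u i

  loop-erase : ∀ {P x y} → Via P x y → SimplePath P x y
  loop-erase (stop p) = record { vs = [] ; chain = one ; last = Last.here ; unique = [] ∷ [] ; inside = p ∷ [] }
  loop-erase {x = x} (_∷_ {y = w} (p , e) v) with loop-erase v
  ... | S with any? (Fin._≟_ x) (w ∷ SimplePath.vs S)
  ...   | yes x∈ = suffix x∈ (SimplePath.chain S) (SimplePath.last S) (SimplePath.unique S) (SimplePath.inside S)
  ...   | no x∉ = record { vs = w ∷ SimplePath.vs S ; chain = cons e (SimplePath.chain S) ; last = Last.there (SimplePath.last S)
                         ; unique = Allₚ.¬Any⇒All¬ _ x∉ ∷ SimplePath.unique S ; inside = p ∷ SimplePath.inside S }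

  no-detour : ∀ {x y y′} → y ≢ y′ → E x y → E x y′ → ¬ Via (x ≢_) y y′
  no-detour {x} {y} {y′} y≢y′ e e′ v with loop-erase v
  ... | record { vs = [] ; last = Last.here } = y≢y′ refl
  ... | record { vs = w ∷ vs ; chain = c ; last = l ; unique = u ; inside = i } =
    acyclic (x , y ∷ w ∷ vs , y′ , s≤s (s≤s (s≤s z≤n)) , i ∷ u , cons e c , Last.there l , E-sym e′)

  -- Adjacency is an arbitrary relation, but a tree decides it: a simple path from x to y is either
  -- a single edge, or so long that an edge between its ends would close a cycle.
  adj? : ∀ x y → Dec (E x y)
  adj? x y with x Fin.≟ y
  ... | yes refl = no (irrfl T)
  ... | no x≢y with loop-erase (walk-via (proj₂ (connected x y)))
  ...   | record { vs = [] ; last = Last.here } = ⊥-elim (x≢y refl)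
  ...   | record { vs = w ∷ [] ; chain = cons e one ; last = Last.there Last.here } = yes e
  ...   | record { vs = w ∷ w′ ∷ vs ; chain = c ; last = l ; unique = u } =
    no λ e → acyclic (x , w ∷ w′ ∷ vs , y , s≤s (s≤s (s≤s z≤n)) , u , c , l , E-sym e)

  walk? : ∀ m x y → Dec (Walk K x y m)
  walk? zero x y = map′ (λ { refl → [] }) (λ { [] → refl }) (x Fin.≟ y)
  walk? (suc m) x y = map′ (λ { (_ , e , w) → e ∷ w }) (λ { (e ∷ w) → _ , e , w })
    (Fin.any? λ z → adj? x z ×-dec walk? m z y)

  distance : ∀ x y → ∃ (Dist K x y)
  distance x y = least (λ m → walk? m x y) (proj₂ (connected x y))

  module Rooted (r : Fin n) where

    dep : Fin n → ℕ
    dep x = proj₁ (distance x r)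

    dep-dist : ∀ x → Dist K x r (dep x)
    dep-dist x = proj₂ (distance x r)

    dep-≤ : ∀ {x m} → Walk K x r m → dep x ≤ m
    dep-≤ w = Dist-≤ (dep-dist _) w

    dep-walk : ∀ {x y m} → Walk K x y m → dep x ≤ m + dep y
    dep-walk {y = y} w = dep-≤ (walk-++ w (proj₁ (dep-dist y)))

    dep-root : dep r ≡ 0
    dep-root = n≤0⇒n≡0 (dep-≤ [])

    dep-zero : ∀ {x} → dep x ≡ 0 → x ≡ r
    dep-zero {x} e = go (subst (Walk K x r) e (proj₁ (dep-dist x)))
      where
      go : Walk K x r 0 → x ≡ r
      go [] = refl

    Child : Fin n → Fin n → Set
    Child x y = E x y × dep y ≡ suc (dep x)

    parent : ∀ {x d} → dep x ≡ suc d → ∃ λ y → Child y x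
    parent {x} {d} e with subst (Walk K x r) e (proj₁ (dep-dist x))
    ... | _∷_ {y = y} a w = y , E-sym a , ≤-antisym (dep-walk (a ∷ [])) (≤-trans (s≤s (dep-≤ w)) (≤-reflexive (sym e)))

    -- After the first vertex fewer than `dep x` steps to the root remain, so `x` cannot occur any
    -- more.
    avoid : ∀ {x y m} → Walk K y r m → m ≤ dep x → x ≢ y → Via (x ≢_) y r
    avoid [] _ x≢y = stop x≢y
    avoid {x} (a ∷ w) m≤ x≢y = (x≢y , a) ∷ avoid w (<⇒≤ m≤) λ { refl → <⇒≱ m≤ (dep-≤ w) }

    loopless : ∀ {x y} → E x y → x ≢ y
    loopless e refl = irrfl T e

    unique-lower : ∀ {x y y′} → E x y → E x y′ → dep y ≤ dep x → dep y′ ≤ dep x → y ≡ y′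
    unique-lower {x} {y} {y′} e e′ p p′ with y Fin.≟ y′
    ... | yes q = q
    ... | no y≢y′ = ⊥-elim (no-detour y≢y′ e e′
      (via-++ (avoid (proj₁ (dep-dist y)) p (loopless e)) (via-sym (avoid (proj₁ (dep-dist y′)) p′ (loopless e′)))))

    unique-parent : ∀ {x x′ y} → Child x y → Child x′ y → x ≡ x′
    unique-parent (e , d) (e′ , d′) = unique-lower (E-sym e) (E-sym e′) (lower d) (lower d′)
      where
      lower : ∀ {a b} → b ≡ suc a → a ≤ b
      lower refl = n≤1+n _

    -- Besides its parent a vertex has no neighbour of at most its own depth, which also rules out
    -- edges inside a level.
    edge-down : ∀ {x y} → E x y → dep y ≤ dep x → Child y x
    edge-down {x} {y} e le = go (dep x) refl
      where
      go : ∀ d → dep x ≡ d → Child y x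
      go zero eq = ⊥-elim (loopless e (trans (dep-zero eq) (sym (dep-zero (n≤0⇒n≡0 (≤-trans le (≤-reflexive eq)))))))
      go (suc d) eq with parent eq
      ... | z , ez , dz with unique-lower e (E-sym ez) le (≤-trans (n≤1+n _) (≤-reflexive (sym dz)))
      ...   | refl = E-sym e , dz

    edge-cases : ∀ {x y} → E x y → Child x y ⊎ Child y x
    edge-cases {x} {y} e with ≤-total (dep x) (dep y)
    ... | inj₁ le = inj₁ (edge-down (E-sym e) le)
    ... | inj₂ le = inj₂ (edge-down e le)

    data Below (x : Fin n) : Fin n → Set where
      self : Below x x
      up   : ∀ {y z} → Below x y → Child y z → Below x z

    below-dep : ∀ {x y} → Below x y → dep x ≤ dep y
    below-dep self = ≤-refl
    below-dep (up b (_ , d)) = ≤-trans (below-dep b) (≤-trans (n≤1+n _) (≤-reflexive (sym d)))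

    below-unique : ∀ {x x′ y} → Below x y → Below x′ y → dep x ≡ dep x′ → x ≡ x′
    below-unique self self _ = refl
    below-unique self (up b (_ , d)) e = ⊥-elim (<-irrefl refl (≤-trans (s≤s (below-dep b)) (≤-reflexive (trans (sym d) e))))
    below-unique (up b (_ , d)) self e = ⊥-elim (<-irrefl refl (≤-trans (s≤s (below-dep b)) (≤-reflexive (trans (sym d) (sym e)))))
    below-unique (up b c) (up b′ c′) e with unique-parent c c′
    ... | refl = below-unique b b′ e

    below-split : ∀ {x y} → Below x y → x ≡ y ⊎ ∃ λ c → Child x c × Below c y
    below-split self = inj₁ refl
    below-split (up b c) with below-split b
    ... | inj₁ refl = inj₂ (_ , c , self)
    ... | inj₂ (d , xd , b′) = inj₂ (d , xd , up b′ c)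

    below-join : ∀ {x c y} → Child x c → Below c y → Below x y
    below-join e self = up self e
    below-join e (up b c) = up (below-join e b) c

    below-root : ∀ y → Below r y
    below-root y = go (dep y) refl
      where
      go : ∀ d {y} → dep y ≡ d → Below r y
      go zero e with dep-zero e
      ... | refl = self
      go (suc d) e with parent e
      ... | z , c , e′ = up (go d (suc-injective (trans (sym e′) e))) (c , e′)

    child? : ∀ x y → Dec (Child x y)
    child? x y = adj? x y ×-dec (dep y ≟ suc (dep x))

    children : Fin n → List (Fin n)
    children x = filter (child? x) (allFin n)

    ∈-children : ∀ {x y} → Child x y → y ∈ children x
    ∈-children c = ∈-filter⁺ (child? _) (∈-allFin _) c

    children-∈ : ∀ {x y} → y ∈ children x → Child x y
    children-∈ p = proj₂ (∈-filter⁻ (child? _) {xs = allFin n} p)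

    children-unique : ∀ x → Unique (children x)
    children-unique x = Uniqueₚ.filter⁺ (child? x) (Uniqueₚ.allFin⁺ n)

    -- x ∷ ms leads from x downwards to a vertex without children.
    data Desc : Fin n → List (Fin n) → Set where
      leaf : ∀ {x} → (∀ {y} → ¬ Child x y) → Desc x []
      down : ∀ {x y ms} → Child x y → Desc y ms → Desc x (y ∷ ms)

    record End (x : Fin n) (m : ℕ) : Set where
      field
        e         : Fin n
        walk      : Walk K x e m
        below     : Below x e
        childless : ∀ {y} → ¬ Child e y

    end : ∀ {x ms} → Desc x ms → End x (length ms)
    end (leaf l) = record { walk = [] ; below = self ; childless = l }
    end (down c d) = record { walk = proj₁ c ∷ walk ; below = below-join c below ; childless = childless }
      where open End (end d)

    end-leaf : ∀ {e} → (∀ {y} → ¬ Child e y) → 1 ≤ dep e → IsLeaf T e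
    end-leaf {e} childless 1≤ with m≤n⇒∃[o]m+o≡n 1≤
    ... | d , eq with parent (sym eq)
    ...   | u , c = u , E-sym (proj₁ c) , only
      where
      only : ∀ w → E e w → w ≡ u
      only w ew with edge-cases ew
      ... | inj₁ q = ⊥-elim (childless q)
      ... | inj₂ q = unique-parent q c

-- Joining two arms into a spine

at : ∀ {A : Set} → A → List A → ℕ → A
at d [] _ = d
at d (x ∷ xs) zero = x
at d (x ∷ xs) (suc i) = at d xs i

seg-at : ∀ {A : Set} (d : A) xs → seg (at d xs) 0 (length xs) ≡ xs
seg-at d [] = refl
seg-at d (x ∷ xs) = cong (x ∷_) (trans (sym (seg-shift (at d (x ∷ xs)) 1 0 (length xs))) (seg-at d xs))

seg-cong : ∀ {A : Set} {f g : ℕ → A} i m → (∀ j → j < m → f (i + j) ≡ g (i + j)) → seg f i m ≡ seg g i m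
seg-cong i zero h = refl
seg-cong {f = f} {g} i (suc m) h = cong₂ _∷_ (subst (λ z → f z ≡ g z) (+-identityʳ i) (h 0 (s≤s z≤n)))
  (seg-cong (suc i) m λ j j< → subst (λ z → f z ≡ g z) (+-suc i j) (h (suc j) (s≤s j<)))

module Joined {K : Graph} (K-sym : ∀ {x y} → Adj K x y → Adj K y x) {r : V K} {A B : List (V K)} {α β : ℕ}
  (PA : Monotone K r A 1 α) (PB : Monotone K r B 0 (suc β))
  (cross : ∀ {i j} → i < α → j < suc β → Dist K (Path-from.pt PA i) (Path-from.pt PB j) (suc i + j)) where

  private
    module PA = Path-from PA
    module PB = Path-from PB

  choose : ∀ i → Dec (i < α) → V K
  choose i (yes _) = PA.pt (α ∸ suc i)
  choose i (no _) = PB.pt (i ∸ α)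

  pt : ℕ → V K
  pt i = choose i (i <? α)

  pt-low : ∀ {i} → i < α → pt i ≡ PA.pt (α ∸ suc i)
  pt-low {i} i< with i <? α
  ... | yes _ = refl
  ... | no i≮ = ⊥-elim (i≮ i<)

  pt-high : ∀ i → pt (α + i) ≡ PB.pt i
  pt-high i with α + i <? α
  ... | yes lt = ⊥-elim (<⇒≱ lt (m≤m+n α i))
  ... | no _ = cong PB.pt (m+n∸m≡n α i)

  spine : List (V K)
  spine = seg pt 0 (α + suc β)

  spine-↭ : spine ↭ A ++ B
  spine-↭ = ↭-trans (↭-reflexive (seg-++ pt 0 α (suc β))) (++⁺
    (↭-trans (↭-reflexive (seg-cong 0 α λ j j< → pt-low j<)) (↭-trans (seg-mirror PA.pt α) (↭-reflexive PA.list)))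
    (↭-reflexive (trans (trans (cong (λ z → seg pt z (suc β)) (sym (+-identityʳ α))) (sym (seg-shift pt α 0 (suc β))))
      (trans (seg-cong 0 (suc β) λ j _ → pt-high j) PB.list))))

  data Place : ℕ → Set where
    low  : ∀ {i} → i < α → Place i
    high : ∀ j → j < suc β → Place (α + j)

  place : ∀ {i} → i < α + suc β → Place i
  place {i} i< with i <? α
  ... | yes p = low p
  ... | no ¬p with m≤n⇒∃[o]m+o≡n (≮⇒≥ ¬p)
  ...   | j , refl = high j (+-cancelˡ-< α j (suc β) i<)

  mirrored : ∀ {i} → i < α → α ∸ suc i < α
  mirrored {i} i< = ≤-trans (≤-reflexive (sym (+-∸-assoc 1 i<))) (m∸n≤m α i)

  mixed : ∀ {i j} → i < α → suc (α ∸ suc i) + j ≡ ∣ i - α + j ∣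
  mixed {i} {j} i< with m≤n⇒∃[o]m+o≡n i<
  ... | o , refl = trans (cong (λ z → suc z + j) (m+n∸m≡n (suc i) o))
    (sym (trans (cong (λ z → ∣ i - z ∣) (shape i o j)) (∣m-m+n∣≡n i (suc o + j))))
    where
    shape : ∀ i o j → suc i + o + j ≡ i + (suc o + j)
    shape = solve-∀

  geo : ∀ {i j} → Place i → Place j → Dist K (pt i) (pt j) ∣ i - j ∣
  geo (low p) (low q) = Dist-cong (sym (pt-low p)) (sym (pt-low q)) (∣mirror∣ α p q) (PA.geo (mirrored p) (mirrored q))
  geo (low p) (high j q) = Dist-cong (sym (pt-low p)) (sym (pt-high j)) (mixed p) (cross (mirrored p) q)
  geo {j = i} (high j q) (low p) = Dist-cong (sym (pt-high j)) (sym (pt-low p)) (trans (mixed p) (∣-∣-comm i (α + j)))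
    (Dist-sym K-sym (cross (mirrored p) q))
  geo (high i p) (high j q) = Dist-cong (sym (pt-high i)) (sym (pt-high j)) (sym (∣m+n-m+o∣≡∣n-o∣ α i j)) (PB.geo p q)

  to : ∀ {i} → Place i → Dist K (pt i) r ∣ i - α ∣
  to {i} (low p) = Dist-cong (sym (pt-low p)) refl
    (trans (sym (+-identityʳ _)) (trans (mixed {j = 0} p) (cong (λ z → ∣ i - z ∣) (+-identityʳ α)))) (PA.to (mirrored p))
  to (high j q) = Dist-cong (sym (pt-high j)) refl (sym (∣m+n-m∣≡n α j)) (PB.to q)

  path : Path-from K r spine (λ i → ∣ i - α ∣) (α + suc β)
  path = record { pt = pt ; list = refl ; geo = λ p q → geo (place p) (place q) ; to = λ p → to (place p) }

-- Decomposing a rooted tree into a spine and branches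

module Decomposition {n : ℕ} (T : SimpleGraph n) (tree : IsTree T) (r : Fin n) (k : ℕ) where
  open Tree T tree
  open Rooted r

  module _ (gap : ∀ {x y m} → x ≢ y → IsLeaf T x → IsLeaf T y → Walk K x y m → k ≤ m) where

    -- A step changes the depth by at most one, so a walk that descends at every step is shortest.
    levels : ∀ {f : ℕ → Fin n} {N p} → (∀ i → i < N → dep (f i) ≡ p + i) →
      (∀ i j → i + j < N → Walk K (f i) (f (i + j)) j) → ∀ {i j} → i < N → j < N → Dist K (f i) (f j) ∣ i - j ∣
    levels {f} {N} {p} deps walks {i} {j} i< j< = both (≤-total i j)
      where
      upward : ∀ {i j} → i ≤ j → j < N → Dist K (f i) (f j) ∣ i - j ∣
      upward {i} i≤j lt with m≤n⇒∃[o]m+o≡n i≤j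
      ... | o , refl = Dist-cong refl refl (sym (∣m-m+n∣≡n i o)) (Dist-lower (walks i o lt) λ {n} w →
        +-cancelʳ-≤ (p + i) o n (≤-trans (≤-reflexive (trans (shape p i o) (sym (deps (i + o) lt))))
          (≤-trans (dep-walk (walk-sym E-sym w)) (≤-reflexive (cong (n +_) (deps i (≤-<-trans (m≤m+n i o) lt)))))))
        where
        shape : ∀ p i o → o + (p + i) ≡ p + (i + o)
        shape = solve-∀
      both : i ≤ j ⊎ j ≤ i → Dist K (f i) (f j) ∣ i - j ∣
      both (inj₁ i≤j) = upward i≤j j<
      both (inj₂ j≤i) = Dist-cong refl refl (∣-∣-comm j i) (Dist-sym E-sym (upward j≤i i<))

    desc-dep : ∀ {x ms} → Desc x ms → ∀ i → i < suc (length ms) → dep (at r (x ∷ ms) i) ≡ dep x + i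
    desc-dep d zero _ = sym (+-identityʳ _)
    desc-dep (leaf _) (suc i) (s≤s ())
    desc-dep (down c d) (suc i) (s≤s lt) = trans (desc-dep d i lt) (trans (cong (_+ i) (proj₂ c)) (sym (+-suc _ i)))

    desc-walk : ∀ {x ms} → Desc x ms → ∀ i j → i + j < suc (length ms) → Walk K (at r (x ∷ ms) i) (at r (x ∷ ms) (i + j)) j
    desc-walk d zero zero _ = []
    desc-walk (leaf _) zero (suc j) (s≤s ())
    desc-walk (down c d) zero (suc j) (s≤s lt) = proj₁ c ∷ desc-walk d 0 j lt
    desc-walk (leaf _) (suc i) j (s≤s ())
    desc-walk (down c d) (suc i) j (s≤s lt) = desc-walk d i j lt

    desc-path : ∀ {x ms} → Desc x ms → Monotone K r (x ∷ ms) (dep x) (suc (length ms))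
    desc-path {x} {ms} d = record
      { pt = at r (x ∷ ms) ; list = seg-at r (x ∷ ms)
      ; geo = levels (desc-dep d) (desc-walk d)
      ; to = λ {i} i< → Dist-cong refl refl (desc-dep d i i<) (dep-dist _) }

    at-∈ : ∀ (xs : List (Fin n)) i → i < length xs → at r xs i ∈ xs
    at-∈ (x ∷ xs) zero _ = here refl
    at-∈ (x ∷ xs) (suc i) (s≤s lt) = there (at-∈ xs i lt)

    -- Both descents end in leaves of the tree. The leaves differ, since a vertex has only one
    -- ancestor at the depth of y and y′, and the walk between them through x has the length on the
    -- right.
    leaves-apart : ∀ {x y y′ ms ms′} → Child x y → Child x y′ → y ≢ y′ → Desc y ms → Desc y′ ms′ →
      k ≤ suc (length ms) + suc (length ms′)
    leaves-apart {x} {y} {y′} {ms} {ms′} c c′ y≢y′ d d′ = subst (k ≤_) (+-suc (length ms) (suc (length ms′)))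
      (gap e≢e′ (end-leaf EL.childless (deep c EL.below)) (end-leaf ER.childless (deep c′ ER.below))
        (walk-++ (walk-sym E-sym EL.walk) (E-sym (proj₁ c) ∷ proj₁ c′ ∷ ER.walk)))
      where
      module EL = End (end d)
      module ER = End (end d′)
      e≢e′ : EL.e ≢ ER.e
      e≢e′ q = y≢y′ (below-unique EL.below (subst (Below y′) (sym q) ER.below) (trans (proj₂ c) (sym (proj₂ c′))))
      deep : ∀ {y e} → Child x y → Below y e → 1 ≤ dep e
      deep (_ , q) b = ≤-trans (≤-trans (s≤s z≤n) (≤-reflexive (sym q))) (below-dep b)

    Good : List (Fin n) → Set
    Good xs = ∃₂ λ y ms → xs ≡ y ∷ ms × Desc y ms × 1 ≤ dep y × k ≤ length xs + length xs

    record Cover (P : Fin n → Set) (main : List (Fin n)) (os : List (List (Fin n))) : Set where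
      field
        good     : ∀ {xs} → xs ∈ os → Good xs
        unique   : Unique (main ++ concat os)
        sound    : ∀ {v} → v ∈ main ++ concat os → P v
        complete : ∀ {v} → P v → v ∈ main ++ concat os

    good-++ : ∀ {os os′} → (∀ {xs} → xs ∈ os → Good xs) → (∀ {xs} → xs ∈ os′ → Good xs) → ∀ {xs} → xs ∈ os ++ os′ → Good xs
    good-++ {os} g g′ p with ∈-++⁻ os p
    ... | inj₁ q = g q
    ... | inj₂ q = g′ q

    merge : ∀ {P Q R m m′ os os′} → Cover P m os → Cover Q m′ os′ → (∀ {v} → P v → ¬ Q v) → Good m′ →
      (∀ {v} → R v → P v ⊎ Q v) → (∀ {v} → P v → R v) → (∀ {v} → Q v → R v) → Cover R m (m′ ∷ os ++ os′)
    merge {P} {Q} {R} {m} {m′} {os} {os′} C C′ dis g split left right = record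
      { good = λ { (here refl) → g ; (there p) → good-++ C.good C′.good p }
      ; unique = Unique-resp-↭ (↭-sym reorder) (Uniqueₚ.++⁺ C.unique C′.unique λ { (p , q) → dis (C.sound p) (C′.sound q) })
      ; sound = λ p → from (∈-++⁻ (m ++ concat os) (∈-resp-↭ reorder p))
      ; complete = λ p → ∈-resp-↭ (↭-sym reorder) (into (split p)) }
      where
      module C = Cover C
      module C′ = Cover C′
      reorder : m ++ concat (m′ ∷ os ++ os′) ↭ (m ++ concat os) ++ (m′ ++ concat os′)
      reorder = ↭-trans (↭-reflexive (cong (λ z → m ++ (m′ ++ z)) (sym (Listₚ.concat-++ os os′))))
        (↭-trans (++⁺ˡ m (shifts m′ (concat os))) (↭-reflexive (sym (Listₚ.++-assoc m (concat os) _))))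
      from : ∀ {v} → v ∈ m ++ concat os ⊎ v ∈ m′ ++ concat os′ → R v
      from (inj₁ p) = left (C.sound p)
      from (inj₂ p) = right (C′.sound p)
      into : ∀ {v} → P v ⊎ Q v → v ∈ (m ++ concat os) ++ (m′ ++ concat os′)
      into (inj₁ p) = ∈-++⁺ˡ (C.complete p)
      into (inj₂ p) = ∈-++⁺ʳ (m ++ concat os) (C′.complete p)

    record Sub (x : Fin n) : Set where
      field
        ms    : List (Fin n)
        os    : List (List (Fin n))
        desc  : Desc x ms
        cover : Cover (Below x) (x ∷ ms) os

    Under : List (Fin n) → Fin n → Set
    Under cs v = ∃ λ c → c ∈ cs × Below c v

    record Forest (cs : List (Fin n)) : Set where
      field
        y     : Fin n
        y∈    : y ∈ cs
        ms    : List (Fin n)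
        os    : List (List (Fin n))
        desc  : Desc y ms
        cover : Cover (Under cs) (y ∷ ms) os

    separate : ∀ {x c cs v} → (∀ {y} → y ∈ c ∷ cs → Child x y) → All (c ≢_) cs → Below c v → ¬ Under cs v
    separate ch c∉ b (c′ , p , b′) = All.lookup c∉ p (below-unique b b′ (trans (proj₂ (ch (here refl))) (sym (proj₂ (ch (there p))))))

    -- The longer of two descending paths is cut off; it has at least k / 2 vertices.
    forest : ∀ {x} c cs → (∀ {y} → y ∈ c ∷ cs → Child x y) → Unique (c ∷ cs) → (∀ {y} → Child x y → Sub y) → Forest (c ∷ cs)
    forest c [] ch _ sub = record { y = c ; y∈ = here refl ; ms = S.ms ; os = S.os ; desc = S.desc ; cover = record
        { good = C.good ; unique = C.unique ; sound = λ p → c , here refl , C.sound p ; complete = λ { (_ , here refl , b) → C.complete b } } }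
      where
      module S = Sub (sub (ch (here refl)))
      module C = Cover S.cover
    forest {x} c (c′ ∷ cs) ch (c∉ ∷ uq) sub = go (≤-total (length S.ms) (length F.ms))
      where
      module S = Sub (sub (ch (here refl)))
      module F = Forest (forest c′ cs (λ p → ch (there p)) uq sub)
      apart : k ≤ suc (length S.ms) + suc (length F.ms)
      apart = leaves-apart (ch (here refl)) (ch (there F.y∈)) (All.lookup c∉ F.y∈) S.desc F.desc
      1≤dep : ∀ {y} → Child x y → 1 ≤ dep y
      1≤dep (_ , q) = ≤-trans (s≤s z≤n) (≤-reflexive (sym q))
      dis : ∀ {v} → Below c v → ¬ Under (c′ ∷ cs) v
      dis = separate ch c∉
      split : ∀ {v} → Under (c ∷ c′ ∷ cs) v → Below c v ⊎ Under (c′ ∷ cs) v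
      split (_ , here refl , b) = inj₁ b
      split (d , there p , b) = inj₂ (d , p , b)
      right : ∀ {v} → Under (c′ ∷ cs) v → Under (c ∷ c′ ∷ cs) v
      right (d , p , b) = d , there p , b
      go : length S.ms ≤ length F.ms ⊎ length F.ms ≤ length S.ms → Forest (c ∷ c′ ∷ cs)
      go (inj₁ le) = record { y = c ; y∈ = here refl ; ms = S.ms ; os = (F.y ∷ F.ms) ∷ S.os ++ F.os ; desc = S.desc
        ; cover = merge S.cover F.cover dis
            (F.y , F.ms , refl , F.desc , 1≤dep (ch (there F.y∈)) , ≤-trans apart (+-monoˡ-≤ _ (s≤s le)))
            split (λ b → c , here refl , b) right }
      go (inj₂ le) = record { y = F.y ; y∈ = there F.y∈ ; ms = F.ms ; os = (c ∷ S.ms) ∷ F.os ++ S.os ; desc = F.desc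
        ; cover = merge F.cover S.cover (λ u b → dis b u)
            (c , S.ms , refl , S.desc , 1≤dep (ch (here refl)) , ≤-trans apart (+-monoʳ-≤ (suc (length S.ms)) (s≤s le)))
            (λ u → Sum.swap (split u)) right (λ b → c , here refl , b) }

    under-children : ∀ {x v} → Below x v → x ≡ v ⊎ Under (children x) v
    under-children b with below-split b
    ... | inj₁ e = inj₁ e
    ... | inj₂ (c , xc , b′) = inj₂ (c , ∈-children xc , b′)

    below-fresh : ∀ {x v cs} → (∀ {y} → y ∈ cs → Child x y) → Under cs v → x ≢ v
    below-fresh ch (c , p , b) refl = <-irrefl refl (≤-trans (≤-reflexive (sym (proj₂ (ch p)))) (below-dep b))

    subtree : ∀ (M : ℕ) → (∀ v → dep v ≤ M) → ∀ fuel x → M ≤ dep x + fuel → Sub x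
    subtree M bound zero x le = record { ms = [] ; os = [] ; desc = leaf childless ; cover = record
        { good = λ () ; unique = [] ∷ [] ; sound = λ { (here refl) → self } ; complete = λ b → only (below-split b) } }
      where
      childless : ∀ {y} → ¬ Child x y
      childless {y} (_ , q) = <-irrefl refl (≤-trans (≤-reflexive (sym q)) (≤-trans (bound y) (≤-trans le (≤-reflexive (+-identityʳ _)))))
      only : ∀ {v} → x ≡ v ⊎ (∃ λ c → Child x c × Below c v) → v ∈ x ∷ []
      only (inj₁ refl) = here refl
      only (inj₂ (c , xc , _)) = ⊥-elim (childless xc)
    subtree M bound (suc fuel) x le = go (children x) children-∈ (children-unique x) under-children
      where
      sub : ∀ {y} → Child x y → Sub y
      sub {y} (_ , q) = subtree M bound fuel y (≤-trans le (≤-reflexive (trans (+-suc (dep x) fuel) (cong (_+ fuel) (sym q)))))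
      go : ∀ cs → (∀ {y} → y ∈ cs → Child x y) → Unique cs → (∀ {v} → Below x v → x ≡ v ⊎ Under cs v) → Sub x
      go [] ch uq all = record { ms = [] ; os = [] ; desc = leaf childless ; cover = record
          { good = λ () ; unique = [] ∷ [] ; sound = λ { (here refl) → self } ; complete = λ b → only (all b) } }
        where
        only : ∀ {v} → x ≡ v ⊎ Under [] v → v ∈ x ∷ []
        only (inj₁ refl) = here refl
        childless : ∀ {y} → ¬ Child x y
        childless c with all (up self c)
        ... | inj₁ refl = loopless (proj₁ c) refl
      go (c ∷ cs) ch uq all = record { ms = F.y ∷ F.ms ; os = F.os ; desc = down (ch F.y∈) F.desc ; cover = record
          { good = C.good
          ; unique = All.tabulate (λ p → below-fresh ch (C.sound p)) ∷ C.unique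
          ; sound = λ { (here refl) → self ; (there p) → let (d , q , b) = C.sound p in below-join (ch q) b }
          ; complete = λ b → into (all b) } }
        where
        module F = Forest (forest c cs ch uq sub)
        module C = Cover F.cover
        into : ∀ {v} → x ≡ v ⊎ Under (c ∷ cs) v → v ∈ x ∷ (F.y ∷ F.ms) ++ concat F.os
        into (inj₁ refl) = here refl
        into (inj₂ u) = there (C.complete u)

    -- The descendants of `c` can be left only by the edge from `c` to the root. Until that step the
    -- depth falls by at most one at a time, and from the root at least `dep v` steps remain.
    cross-lower : ∀ {c u v m} → Child r c → Below c u → ¬ Below c v → Walk K u v m → dep u + dep v ≤ m
    cross-lower rc b ¬b [] = ⊥-elim (¬b b)
    cross-lower {c} {u} {v} {suc m} rc b ¬b (_∷_ {y = u′} e w) = go (edge-cases e)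
      where
      inside : Below c u′ → dep u + dep v ≤ suc m
      inside b′ = ≤-trans (+-monoˡ-≤ (dep v) (dep-walk (e ∷ []))) (s≤s (cross-lower rc b′ ¬b w))
      above : ∀ {u} → Below c u → Child u′ u → dep u + dep v ≤ suc m ⊎ Below c u′
      above self (e′ , q) with unique-parent (e′ , q) rc
      ... | refl = inj₁ (≤-trans (≤-reflexive (cong (_+ dep v) (trans q (cong suc dep-root)))) (s≤s (dep-≤ (walk-sym E-sym w))))
      above (up b d) q with unique-parent q d
      ... | refl = inj₂ b
      go : Child u u′ ⊎ Child u′ u → dep u + dep v ≤ suc m
      go (inj₁ q) = inside (up b q)
      go (inj₂ q) with above b q
      ... | inj₁ le = le
      ... | inj₂ b′ = inside b′

    cross-dist : ∀ {c u v} → Child r c → Below c u → ¬ Below c v → Dist K u v (dep u + dep v)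
    cross-dist {u = u} {v} rc b ¬b = Dist-lower (walk-++ (proj₁ (dep-dist u)) (walk-sym E-sym (proj₁ (dep-dist v)))) (cross-lower rc b ¬b)

    branch : ∀ {xs} → Good xs → ∃₂ λ p N → 1 ≤ p × Monotone K r xs p N × k ≤ N + N
    branch (y , ms , refl , d , 1≤ , k≤) = dep y , suc (length ms) , 1≤ , desc-path d , k≤

    desc-below : ∀ {x ms} → Desc x ms → ∀ i → i < suc (length ms) → Below x (at r (x ∷ ms) i)
    desc-below d zero _ = self
    desc-below (leaf _) (suc i) (s≤s ())
    desc-below (down c d) (suc i) (s≤s lt) = below-join c (desc-below d i lt)

    first-level : ∀ {c} → Child r c → dep c ≡ 1
    first-level (_ , q) = trans q (cong suc dep-root)

    main-arm : ∀ {b ms} → Child r b → Desc b ms → Monotone K r (r ∷ b ∷ ms) 0 (suc (suc (length ms)))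
    main-arm {b} {ms} rb d = subst (λ z → Monotone K r (r ∷ b ∷ ms) z (suc (suc (length ms)))) dep-root (desc-path (down rb d))

    two-arms : ∀ {a b ms ms′} os → Child r a → Child r b → a ≢ b → Desc a ms → Desc b ms′ → length ms ≤ length ms′ →
      (∀ {xs} → xs ∈ os → Good xs) → Unique (r ∷ (a ∷ ms) ++ (b ∷ ms′) ++ concat os) →
      (∀ v → v ∈ r ∷ (a ∷ ms) ++ (b ∷ ms′) ++ concat os) → Skeleton K r k
    two-arms {a} {b} {ms} {ms′} os ra rb a≢b da db le good uq all = record
      { α = suc (length ms) ; β = suc (length ms′) ; spine = J.spine ; others = os ; spinePath = J.path
      ; α≤β = s≤s le ; k≤α+β = leaves-apart ra rb a≢b da db ; branch = λ p → branch (good p)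
      ; unique = Unique-resp-↭ (↭-sym reorder) uq ; complete = λ v → ∈-resp-↭ (↭-sym reorder) (all v) }
      where
      side-arm : Monotone K r (a ∷ ms) 1 (suc (length ms))
      side-arm = subst (λ z → Monotone K r (a ∷ ms) z (suc (length ms))) (first-level ra) (desc-path da)
      side-pt : ∀ {z} (e : dep a ≡ z) i → Path-from.pt (subst (λ z → Monotone K r (a ∷ ms) z (suc (length ms))) e (desc-path da)) i ≡ at r (a ∷ ms) i
      side-pt refl i = refl
      main-pt : ∀ {z} (e : dep r ≡ z) i → Path-from.pt (subst (λ z → Monotone K r (r ∷ b ∷ ms′) z (suc (suc (length ms′)))) e (desc-path (down rb db))) i ≡ at r (r ∷ b ∷ ms′) i
      main-pt refl i = refl
      outside : ∀ j → j < suc (suc (length ms′)) → ¬ Below a (at r (r ∷ b ∷ ms′) j)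
      outside zero _ q = <-irrefl refl (≤-trans (≤-reflexive (sym (first-level ra))) (≤-trans (below-dep q) (≤-reflexive dep-root)))
      outside (suc j) (s≤s lt) q = a≢b (below-unique q (desc-below db j lt) (trans (first-level ra) (sym (first-level rb))))
      cross : ∀ {i j} → i < suc (length ms) → j < suc (suc (length ms′)) →
        Dist K (Path-from.pt side-arm i) (Path-from.pt (main-arm rb db) j) (suc i + j)
      cross {i} {j} i< j< = Dist-cong (sym (side-pt (first-level ra) i)) (sym (main-pt dep-root j))
        (cong₂ _+_ (trans (desc-dep da i i<) (cong (_+ i) (first-level ra)))
          (trans (desc-dep (down rb db) j j<) (cong (_+ j) dep-root)))
        (cross-dist ra (desc-below da i i<) (outside j j<))
      module J = Joined E-sym side-arm (main-arm rb db) cross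
      reorder : J.spine ++ concat os ↭ r ∷ (a ∷ ms) ++ (b ∷ ms′) ++ concat os
      reorder = ↭-trans (++⁺ʳ (concat os) (↭-trans J.spine-↭ (shift r (a ∷ ms) (b ∷ ms′))))
        (↭-reflexive (cong (r ∷_) (Listₚ.++-assoc (a ∷ ms) (b ∷ ms′) (concat os))))

    -- A root with a single child is a leaf, so its only arm joins two leaves and has at least k
    -- edges; the other arm is empty.
    one-arm : ∀ {b ms} os → Child r b → (∀ {y} → Child r y → y ≡ b) → Desc b ms → (∀ {xs} → xs ∈ os → Good xs) →
      Unique (r ∷ (b ∷ ms) ++ concat os) → (∀ v → v ∈ r ∷ (b ∷ ms) ++ concat os) → Skeleton K r k
    one-arm {b} {ms} os rb only d good uq all = record
      { α = 0 ; β = suc (length ms) ; spine = J.spine ; others = os ; spinePath = J.path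
      ; α≤β = z≤n ; k≤α+β = gap r≢e root-leaf (end-leaf Z.childless 1≤e) (proj₁ rb ∷ Z.walk) ; branch = λ p → branch (good p)
      ; unique = Unique-resp-↭ (↭-sym reorder) uq ; complete = λ v → ∈-resp-↭ (↭-sym reorder) (all v) }
      where
      module Z = End (end d)
      1≤e : 1 ≤ dep Z.e
      1≤e = ≤-trans (≤-reflexive (sym (first-level rb))) (below-dep Z.below)
      r≢e : r ≢ Z.e
      r≢e q = <-irrefl refl (≤-trans 1≤e (≤-reflexive (trans (cong dep (sym q)) dep-root)))
      root-leaf : IsLeaf T r
      root-leaf = b , proj₁ rb , λ w e → neighbour (edge-cases e)
        where
        neighbour : ∀ {w} → Child r w ⊎ Child w r → w ≡ b
        neighbour (inj₁ c) = only c
        neighbour (inj₂ (_ , q)) with trans (sym q) dep-root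
        ... | ()
      none : Monotone K r [] 1 0
      none = record { pt = λ _ → r ; list = refl ; geo = λ () ; to = λ () }
      module J = Joined E-sym none (main-arm rb d) (λ ())
      reorder : J.spine ++ concat os ↭ r ∷ (b ∷ ms) ++ concat os
      reorder = ++⁺ʳ (concat os) J.spine-↭

    skeleton : ∀ M → (∀ v → dep v ≤ M) → (∃₂ λ (x y : Fin n) → x ≢ y) → Skeleton K r k
    skeleton M bound (p , q , p≢q) = go (children r) children-∈ (children-unique r) (λ v → under-children (below-root v))
      where
      sub : ∀ {y} → Child r y → Sub y
      sub {y} _ = subtree M bound M y (m≤n+m M (dep y))
      go : ∀ cs → (∀ {y} → y ∈ cs → Child r y) → Unique cs → (∀ v → r ≡ v ⊎ Under cs v) → Skeleton K r k
      go [] ch uq all = ⊥-elim (p≢q (trans (sym (only p)) (only q)))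
        where
        only : ∀ v → r ≡ v
        only v with all v
        ... | inj₁ e = e
      go (c ∷ []) ch uq all = one-arm S.os (ch (here refl)) only S.desc C.good
        (All.tabulate (λ p → below-fresh ch (c , here refl , C.sound p)) ∷ C.unique) (λ v → into (all v))
        where
        module S = Sub (sub (ch (here refl)))
        module C = Cover S.cover
        only : ∀ {y} → Child r y → y ≡ c
        only {y} ry with all y
        ... | inj₁ refl = ⊥-elim (loopless (proj₁ ry) refl)
        ... | inj₂ (_ , here refl , b) = sym (below-unique b self (trans (first-level (ch (here refl))) (sym (first-level ry))))
        into : ∀ {v} → r ≡ v ⊎ Under (c ∷ []) v → v ∈ r ∷ (c ∷ S.ms) ++ concat S.os
        into (inj₁ refl) = here refl
        into (inj₂ (_ , here refl , b)) = there (C.complete b)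
      go (c ∷ c′ ∷ cs) ch (c∉ ∷ uq) all = choose (≤-total (length S.ms) (length F.ms))
        where
        module S = Sub (sub (ch (here refl)))
        module F = Forest (forest c′ cs (λ p → ch (there p)) uq sub)
        module C = Cover S.cover
        module C′ = Cover F.cover
        LS = (c ∷ S.ms) ++ concat S.os
        LF = (F.y ∷ F.ms) ++ concat F.os
        os = S.os ++ F.os
        uqLL : Unique (LS ++ LF)
        uqLL = Uniqueₚ.++⁺ C.unique C′.unique λ { (p , q) → separate ch c∉ (C.sound p) (C′.sound q) }
        fresh : ∀ {v} → v ∈ LS ++ LF → r ≢ v
        fresh p with ∈-++⁻ LS p
        ... | inj₁ q = below-fresh ch (c , here refl , C.sound q)
        ... | inj₂ q = let (d , d∈ , b) = C′.sound q in below-fresh ch (d , there d∈ , b)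
        into : ∀ {v} → r ≡ v ⊎ Under (c ∷ c′ ∷ cs) v → v ∈ r ∷ LS ++ LF
        into (inj₁ refl) = here refl
        into (inj₂ (_ , here refl , b)) = there (∈-++⁺ˡ (C.complete b))
        into (inj₂ (d , there p , b)) = there (∈-++⁺ʳ LS (C′.complete (d , p , b)))
        total : Unique (r ∷ LS ++ LF)
        total = All.tabulate fresh ∷ uqLL
        reorder : LS ++ LF ↭ (c ∷ S.ms) ++ (F.y ∷ F.ms) ++ concat os
        reorder = ↭-trans (interchange-↭ (c ∷ S.ms) (concat S.os) (F.y ∷ F.ms) (concat F.os))
          (↭-reflexive (trans (Listₚ.++-assoc (c ∷ S.ms) (F.y ∷ F.ms) _) (cong (λ z → (c ∷ S.ms) ++ (F.y ∷ F.ms) ++ z) (Listₚ.concat-++ S.os F.os))))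
        choose : length S.ms ≤ length F.ms ⊎ length F.ms ≤ length S.ms → Skeleton K r k
        choose (inj₁ le) = two-arms os (ch (here refl)) (ch (there F.y∈)) (All.lookup c∉ F.y∈) S.desc F.desc le (good-++ C.good C′.good)
          (Unique-resp-↭ (prep r reorder) total) (λ v → ∈-resp-↭ (prep r reorder) (into (all v)))
        choose (inj₂ le) = two-arms os (ch (there F.y∈)) (ch (here refl)) (≢-sym (All.lookup c∉ F.y∈)) F.desc S.desc le (good-++ C.good C′.good)
          (Unique-resp-↭ reorder′ total) (λ v → ∈-resp-↭ reorder′ (into (all v)))
          where
          reorder′ = prep r (↭-trans reorder (shifts (c ∷ S.ms) (F.y ∷ F.ms)))

-- The cube

module _ {G H : Graph} where

  walk-left : ∀ {x x′ y m} → Walk G x x′ m → Walk (G □ H) (x , y) (x′ , y) m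
  walk-left [] = []
  walk-left (e ∷ w) = inj₂ (e , refl) ∷ walk-left w

  walk-right : ∀ {x y y′ m} → Walk H y y′ m → Walk (G □ H) (x , y) (x , y′) m
  walk-right [] = []
  walk-right (e ∷ w) = inj₁ (refl , e) ∷ walk-right w

  walk-project : ∀ {x x′ y y′ m} → Walk (G □ H) (x , y) (x′ , y′) m →
    ∃₂ λ m₁ m₂ → m₁ + m₂ ≡ m × Walk G x x′ m₁ × Walk H y y′ m₂
  walk-project [] = 0 , 0 , refl , [] , []
  walk-project (inj₁ (refl , e) ∷ w) with walk-project w
  ... | m₁ , m₂ , refl , u , v = m₁ , suc m₂ , +-suc m₁ m₂ , u , e ∷ v
  walk-project (inj₂ (e , refl) ∷ w) with walk-project w
  ... | m₁ , m₂ , refl , u , v = suc m₁ , m₂ , refl , e ∷ u , v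

  □-dist : ∀ {x x′ y y′ m n} → Dist G x x′ m → Dist H y y′ n → Dist (G □ H) (x , y) (x′ , y′) (m + n)
  □-dist d d′ = Dist-lower (walk-++ (walk-left (proj₁ d)) (walk-right (proj₁ d′))) lower
    where
    lower : ∀ {j} → Walk (G □ H) _ _ j → _ ≤ j
    lower w with walk-project w
    ... | m₁ , m₂ , refl , u , v = +-mono-≤ (Dist-≤ d u) (Dist-≤ d′ v)

-- The key `κ` recovers the index from an entry, which makes the lists of different indices
-- disjoint.
Unique-concatMap : ∀ {A B : Set} {f : A → List B} (κ : B → A) → (∀ x → Unique (f x)) → (∀ x {v} → v ∈ f x → κ v ≡ x) →
  ∀ {xs} → Unique xs → Unique (concatMap f xs)
Unique-concatMap κ uf key [] = []
Unique-concatMap {f = f} κ uf key {x ∷ xs} (x∉ ∷ u) = Uniqueₚ.++⁺ (uf x) (Unique-concatMap κ uf key u)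
  λ { (p , q) → fresh xs x∉ (key x p) q }
  where
  fresh : ∀ xs {v} → All (x ≢_) xs → κ v ≡ x → v ∉ concatMap f xs
  fresh (y ∷ xs) (x≢y ∷ n) e p with ∈-++⁻ (f y) p
  ... | inj₁ q = x≢y (trans (sym e) (key y q))
  ... | inj₂ q = fresh xs n e q

∈-concatMap-key : ∀ {A B : Set} {f : A → List B} {P : B → Set} → (∀ x {v} → v ∈ f x → P v) → ∀ xs {v} → v ∈ concatMap f xs → P v
∈-concatMap-key {f = f} h (x ∷ xs) p with ∈-++⁻ (f x) p
... | inj₁ q = h x q
... | inj₂ q = ∈-concatMap-key h xs q

triple : ∀ {A : Set} → A → A → A → A × A × A
triple x y z = x , y , z

box-unique : ∀ {A : Set} {X Y Z : List A} → Unique X → Unique Y → Unique Z → Unique (box triple X Y Z)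
box-unique {A} {X} {Y} {Z} uX uY uZ = Unique-concatMap proj₁
  (λ x → Unique-concatMap (λ v → proj₁ (proj₂ v))
    (λ y → Unique-concatMap (λ v → proj₂ (proj₂ v)) (λ z → [] ∷ []) (λ { z (here refl) → refl }) uZ)
    (λ y → ∈-concatMap-key {P = λ v → proj₁ (proj₂ v) ≡ y} (λ { z (here refl) → refl }) Z) uY)
  (λ x → ∈-concatMap-key {P = λ v → proj₁ v ≡ x} (λ y → ∈-concatMap-key {P = λ v → proj₁ v ≡ x} (λ { z (here refl) → refl }) Z) Y) uX

box-complete : ∀ {A : Set} {X Y Z : List A} → (∀ v → v ∈ X) → (∀ v → v ∈ Y) → (∀ v → v ∈ Z) → ∀ v → v ∈ box triple X Y Z
box-complete cX cY cZ (x , y , z) =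
  ∈-concatMap⁺ _ (lose (cX x) (∈-concatMap⁺ _ (lose (cY y) (∈-concatMap⁺ _ (lose (cZ z) (here refl))))))

cube-embedding : ∀ {K : Graph} (a b c : V K) → Embedding K (cube K) a b c (a , b , c) triple
cube-embedding a b c = record { dist = λ p q r → □-dist p (□-dist q r) ; base = refl }

largest : ∀ {P : ℕ → Set} → (∀ m → Dec (P m)) → P 0 → ∀ B → ∃ λ D → P D × (∀ {r} → r ≤ B → P r → r ≤ D)
largest P? p₀ zero = 0 , p₀ , λ r≤ _ → r≤
largest P? p₀ (suc B) with P? (suc B)
... | yes p = suc B , p , λ r≤ _ → r≤
... | no ¬p with largest P? p₀ B
...   | D , pD , max = D , pD , λ r≤ pr → max (s≤s⁻¹ (≤∧≢⇒< r≤ λ { refl → ¬p pr })) pr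

theorem3p8 : ∀ {n} (T : SimpleGraph n) (k : ℕ) → IsTree T → HasSpread T k → 72 ≤ k →
    (∀ x y r → Dist (toGraph T) x y r → 72 * (r * r) ≤ k ^ 3) →
    Stackable (cube (toGraph T))
theorem3p8 {n} T k tree ((p , q , p≢q , _) , spread) 72≤k diam (a , b , c) =
  stackable-onto (a , b , c) (proj₁ result) (proj₂ (proj₂ result))
    (Unique-resp-↭ (proj₁ (proj₂ result)) (box-unique (Skeleton.unique (skel a)) (Skeleton.unique (skel b)) (Skeleton.unique (skel c))))
    (λ v → ∈-resp-↭ (proj₁ (proj₂ result))
      (box-complete (Skeleton.complete (skel a)) (Skeleton.complete (skel b)) (Skeleton.complete (skel c)) v))
  where
  open Tree T tree
  -- `D` is the largest distance that the hypothesis admits rather than the true diameter; in this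
  -- way `k ≤ D` follows from 72 ≤ k alone.
  bounded : ∃ λ D → 72 * (D * D) ≤ k * k * k × (∀ {r} → r ≤ k * k * k → 72 * (r * r) ≤ k * k * k → r ≤ D)
  bounded = largest (λ m → 72 * (m * m) ≤? k * k * k) z≤n (k * k * k)
  D = proj₁ bounded
  cube-≡ : k ^ 3 ≡ k * k * k
  cube-≡ = trans (cong (λ z → k * (k * z)) (*-identityʳ k)) (sym (*-assoc k k k))
  small : ∀ r → 72 * (r * r) ≤ k * k * k → r ≤ D
  small r le = proj₂ (proj₂ bounded) (≤-trans (r≤ r) le) le
    where
    r≤ : ∀ r → r ≤ 72 * (r * r)
    r≤ zero = z≤n
    r≤ r@(suc _) = ≤-trans (m≤m*n r r) (m≤n*m (r * r) 72)
  diameter : ∀ {x y r} → Dist K x y r → r ≤ D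
  diameter {x} {y} {r} d = small r (≤-trans (diam x y r d) (≤-reflexive cube-≡))
  k≤D : k ≤ D
  k≤D = small k (≤-trans (*-monoˡ-≤ (k * k) 72≤k) (≤-reflexive (sym (*-assoc k k k))))
  gap : ∀ {x y m} → x ≢ y → IsLeaf T x → IsLeaf T y → Walk K x y m → k ≤ m
  gap {x} {y} x≢y lx ly w = ≤-trans (spread x y _ x≢y lx ly (proj₂ (distance x y))) (Dist-≤ (proj₂ (distance x y)) w)
  skel : ∀ r → Skeleton K r k
  skel r = Decomposition.skeleton T tree r k gap D (λ v → diameter (Rooted.dep-dist r v)) (p , q , p≢q)
  result = Assembly.Whole.whole k D 72≤k (proj₁ (proj₂ bounded)) k≤D diameter (cube-embedding a b c) (skel a) (skel b) (skel c)
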